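{- Let $m\ge 2$ and $n\ge 1$ be integers. Let $\operatorname{TSRP}(m,n,2)$ be the set of primitive TSR matrices of order $n$ over $\mathbb{F}_{2^m}$ and let $P_2(m,n)$ be the set of primitive polynomials of degree $n$ in $\mathbb{F}_{2^m}[X]$ of the form $X^n-\mu g(X)$, where $\mu$ is a primitive element of $\mathbb{F}_{2^m}$ and $g(X)\in\mathbb{F}_2[X]$ with $g(0)=1$ and $\deg g\le n-1$. Then $$|\operatorname{TSRP}(m,n,2)| = \frac{|P_2(m,n)|}{m}\cdot\frac{|\mathbb{GL}_m(\mathbb{F}_2)|}{2^m-1}.$$
   Context: A polynomial of degree $d$ over a finite field $\mathbb{F}_Q$ is primitive if it is monic and irreducible and one (equivalently every) root generates $\mathbb{F}_{Q^d}^*$; an element of $\mathbb{F}_{2^m}$ is primitive if it generates $\mathbb{F}_{2^m}^*$. A TSR matrix of order $n$ over $\mathbb{F}_{2^m}$ is an $mn\times mn$ block matrix over $\mathbb{F}_2$ with $m\times m$ blocks of the form $$T=\begin{pmatrix} \mathbf{0} & \mathbf{0} & \cdots & \mathbf{0} & c_0A\\ I_m & \mathbf{0} & \cdots & \mathbf{0} & c_1A\\ \mathbf{0} & I_m & \cdots & \mathbf{0} & c_2A\\ \vdots & & \ddots & & \vdots\\ \mathbf{0} & \mathbf{0} & \cdots & I_m & c_{n-1}A\end{pmatrix},$$ with $c_0,\dots,c_{n-1}\in\mathbb{F}_2$ and $A\in M_m(\mathbb{F}_2)$. It is primitive if $\det(XI_{mn}-T)\in\mathbb{F}_2[X]$ is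 a primitive polynomial of degree $mn$ over $\mathbb{F}_2$; $\operatorname{TSRP}(m,n,2)$ is the set of all such primitive matrices. $\mathbb{GL}_m(\mathbb{F}_2)$ is the group of invertible $m\times m$ matrices over $\mathbb{F}_2$. -}

module Defs where

open import Data.Bool using (Bool; true; false; _∧_; _xor_; if_then_else_)
open import Data.Nat using (ℕ; zero; suc; _+_; _*_; _∸_; _^_; _≤_; _<_; _≡ᵇ_; _<ᵇ_)
open import Data.Fin using (Fin; toℕ; fromℕ<; remQuot)
import Data.Fin as F
open import Data.Fin.Properties using (_≟_)
open import Data.Vec using (Vec; []; _∷_; lookup; tabulate; zipWith; map; init; last; replicate; foldr′)
open import Data.List using (List; length)
open import Data.List.Membership.Propositional using (_∈_)
open import Data.List.Relation.Unary.Unique.Propositional using (Unique)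
open import Data.Product using (Σ; _×_; _,_; proj₁; proj₂; ∃; ∃-syntax)
open import Data.Sum using (_⊎_)
open import Relation.Binary.PropositionalEquality using (_≡_; _≢_)
open import Relation.Nullary using (Dec; yes; no)

_HasSize_ : {A : Set} → (A → Set) → ℕ → Set
_HasSize_ {A} P k =
  Σ (List A) λ L → (length L ≡ k) × Unique L ×
    ((x : A) → x ∈ L → P x) × ((x : A) → P x → x ∈ L)

-- Ring operations (we only instantiate them with commutative rings:
-- F_2, F_2[X], F_{2^m} = F_2[X]/(p), F_{2^m}[X]).

record Ops : Set₁ where
  field
    C   : Set
    0#  : C
    1#  : C
    _⊕_ : C → C → C
    _⊗_ : C → C → C
    ⊖_  : C → C

open Ops public

F2 : Ops
F2 = record { C = Bool ; 0# = false ; 1# = true ; _⊕_ = _xor_ ; _⊗_ = _∧_ ; ⊖_ = λ x → x }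

module _ (R : Ops) where
  private
    open module R' = Ops R using () renaming (C to K)

  sumUpTo : ℕ → (ℕ → K) → K
  sumUpTo zero    f = f 0
  sumUpTo (suc k) f = Ops._⊕_ R (sumUpTo k f) (f (suc k))

  sumFin : ∀ {k} → (Fin k → K) → K
  sumFin {zero}  f = Ops.0# R
  sumFin {suc k} f = Ops._⊕_ R (f F.zero) (sumFin (λ j → f (F.suc j)))

  Poly : Set
  Poly = ℕ → K

  mulP : Poly → Poly → Poly
  mulP g h k = sumUpTo k (λ i → Ops._⊗_ R (g i) (h (k ∸ i)))

  PolyRing : Ops
  PolyRing = record
    { C = Poly
    ; 0# = λ _ → Ops.0# R
    ; 1# = λ k → if k ≡ᵇ 0 then Ops.1# R else Ops.0# R
    ; _⊕_ = λ g h k → Ops._⊕_ R (g k) (h k)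
    ; _⊗_ = mulP
    ; ⊖_ = λ g k → Ops.⊖_ R (g k) }

  constP : K → Poly
  constP c k = if k ≡ᵇ 0 then c else Ops.0# R

  varX : Poly
  varX k = if k ≡ᵇ 1 then Ops.1# R else Ops.0# R

  IsDeg : Poly → ℕ → Set
  IsDeg g e = (g e ≢ Ops.0# R) × ((k : ℕ) → e < k → g k ≡ Ops.0# R)

  Monic : ℕ → Poly → Set
  Monic d f = (f d ≡ Ops.1# R) × ((k : ℕ) → d < k → f k ≡ Ops.0# R)

  Irreducible : ℕ → Poly → Set
  Irreducible d f = (1 ≤ d) ×
    ((g h : Poly) (e₁ e₂ : ℕ) → IsDeg g e₁ → IsDeg h e₂ →
       ((k : ℕ) → f k ≡ mulP g h k) → (e₁ ≡ 0) ⊎ (e₂ ≡ 0))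

  lowCoeffs : (d : ℕ) → Poly → Vec K d
  lowCoeffs d f = tabulate (λ i → f (toℕ i))

  -- unit element of K[X]/(f), as a coefficient vector of length d
  oneVec : (d : ℕ) → Vec K d
  oneVec d = tabulate (λ i → if toℕ i ≡ᵇ 0 then Ops.1# R else Ops.0# R)

  -- multiplication by X in K[X]/(f), f monic of degree d with lower
  -- coefficients fl:  X·r = shift r − r_{d-1}·(f − X^d)
  xmul : ∀ {d} → Vec K d → Vec K d → Vec K d
  xmul {zero}  fl r = []
  xmul {suc d} fl r =
    zipWith (Ops._⊕_ R) (Ops.0# R ∷ init r)
            (map (λ fi → Ops.⊖_ R (Ops._⊗_ R (last r) fi)) fl)

  pow : K → ℕ → K
  pow x zero    = Ops.1# R
  pow x (suc k) = Ops._⊗_ R x (pow x k)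

  det : ∀ {k} → (Fin k → Fin k → K) → K
  det {zero}  M = Ops.1# R
  det {suc k} M = sumFin (λ j →
      Ops._⊗_ R (sgn (toℕ j) (M F.zero j))
                (det (λ r s → M (F.suc r) (F.punchIn j s))))
    where
    sgn : ℕ → K → K
    sgn zero          x = x
    sgn (suc zero)    x = Ops.⊖_ R x
    sgn (suc (suc i)) x = sgn i x

iter : {A : Set} → (A → A) → ℕ → A → A
iter g zero    x = x
iter g (suc k) x = g (iter g k x)

-- the element generating multiplication by g has multiplicative order N
-- (starting from the unit `one`): g^N(one) = one and g^k(one) ≠ one, 0<k<N
HasOrder : {A : Set} → A → (A → A) → ℕ → Set
HasOrder one g N = (iter g N one ≡ one) ×
  ((k : ℕ) → 0 < k → k < N → iter g k one ≢ one)

-- Primitive polynomial of degree d over a field K with q elements: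
-- monic, irreducible, and its root X in K[X]/(f) ≅ F_{q^d} generates
-- the multiplicative group, i.e. has order q^d − 1.
PrimitivePoly : (R : Ops) → (q d : ℕ) → Poly R → Set
PrimitivePoly R q d f = Monic R d f × Irreducible R d f ×
  HasOrder (oneVec R d) (xmul R (lowCoeffs R d f)) (q ^ d ∸ 1)

-- The field F_{2^m} modelled as F_2[X]/(p), p monic irreducible of degree m;
-- elements are coefficient vectors of length m.

GF : (m : ℕ) → Poly F2 → Ops
GF m p = record
  { C = Vec Bool m
  ; 0# = replicate m false
  ; 1# = oneVec F2 m
  ; _⊕_ = zipWith _xor_
  ; _⊗_ = λ a b → foldr′ (λ ai acc → zipWith _xor_ (map (ai ∧_) b) (xmul F2 pl acc))
                         (replicate m false) a
  ; ⊖_ = λ x → x }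
  where pl = lowCoeffs F2 m p

PrimitiveElt : (R : Ops) → ℕ → C R → Set
PrimitiveElt R q μ = HasOrder (1# R) (_⊗_ R μ) (q ∸ 1)

vcoef : (R : Ops) → ∀ {n} → Vec (C R) n → ℕ → C R
vcoef R {n} v k with k Data.Nat.<? n
... | yes k<n = lookup v (fromℕ< k<n)
... | no  _   = 0# R

monicPoly : (R : Ops) → ∀ {n} → Vec (C R) n → Poly R
monicPoly R {n} a k = if k ≡ᵇ n then 1# R else vcoef R a k

-- P_2(m,n): lower coefficient vectors a of primitive polynomials
-- X^n + a(X) of degree n over F_{2^m} of the form X^n − μ g(X),
-- μ primitive in F_{2^m}, g ∈ F_2[X], g(0) = 1, deg g ≤ n − 1
-- (g given by its n coefficients of degrees 0..n-1).
P₂ : (m n : ℕ) → Poly F2 → Vec (Vec Bool m) n → Set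
P₂ m n p a =
  PrimitivePoly (GF m p) (2 ^ m) n (monicPoly (GF m p) a) ×
  Σ (Vec Bool m) λ μ → Σ (Vec Bool n) λ g →
    PrimitiveElt (GF m p) (2 ^ m) μ × (vcoef F2 g 0 ≡ true) ×
    (a ≡ tabulate (λ i → ⊖_ (GF m p) (_⊗_ (GF m p) μ
                      (if lookup g i then 1# (GF m p) else 0# (GF m p)))))

Mat : ℕ → Set
Mat k = Vec (Vec Bool k) k

-- TSR matrix of order n with blocks of size m; the index of entry i of
-- block I is I·m + i (Data.Fin.combine / remQuot).
tsr : (m n : ℕ) → Vec Bool n → Mat m → Mat (n * m)
tsr m n c A = tabulate λ r → tabulate λ s → entry (remQuot {n} m r) (remQuot {n} m s)
  where
  entry : Fin n × Fin m → Fin n × Fin m → Bool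
  entry (I , i) (J , j) =
    if toℕ J ≡ᵇ n ∸ 1
      then lookup c I ∧ lookup (lookup A i) j
      else ((toℕ I ≡ᵇ suc (toℕ J)) ∧ (toℕ i ≡ᵇ toℕ j))

charPoly : ∀ {k} → Mat k → Poly F2
charPoly {k} M = det (PolyRing F2) (λ r s →
  _⊕_ (PolyRing F2) (if toℕ r ≡ᵇ toℕ s then varX F2 else 0# (PolyRing F2))
                    (⊖_ (PolyRing F2) (constP F2 (lookup (lookup M r) s))))

IsTSR : (m n : ℕ) → Mat (n * m) → Set
IsTSR m n M = Σ (Vec Bool n) λ c → Σ (Mat m) λ A → M ≡ tsr m n c A

TSRP : (m n : ℕ) → Mat (n * m) → Set
TSRP m n M = IsTSR m n M × PrimitivePoly F2 2 (n * m) (charPoly M)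

matMul : ∀ {k} → Mat k → Mat k → Mat k
matMul A B = tabulate λ i → tabulate λ j →
  sumFin F2 (λ l → lookup (lookup A i) l ∧ lookup (lookup B l) j)

idMat : (k : ℕ) → Mat k
idMat k = tabulate λ i → tabulate λ j → toℕ i ≡ᵇ toℕ j

GL : (m : ℕ) → Mat m → Set
GL m A = Σ (Mat m) λ B → (matMul A B ≡ idMat m) × (matMul B A ≡ idMat m)

{-# OPTIONS --safe #-}
module Submission where

-- Write K = GF m p and q = 2^m. Call a linear map of a finite space cyclic if it permutes
-- the nonzero vectors in a single cycle. By Cayley–Hamilton the characteristic polynomial
-- of M is primitive iff M is cyclic, and X^n − μg is primitive over K iff multiplication
-- by X modulo it is cyclic on K^n. A linear isomorphism B : K → F₂^m with Bμ = AB carries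
-- this multiplication to the TSR matrix T with parameters g and A. So one counts the
-- triples (T, X^n − μg, B) in two ways: each pair (X^n − μg, B) determines A = BμB⁻¹ and
-- T, and each T ∈ TSRP belongs to exactly m(q − 1) pairs. For the latter let ψ be the
-- characteristic polynomial of A and repeat the construction over F₂[X]/(ψ) with μ the
-- class of X. Cyclicity makes this ring a field, and its class of X, being the norm of a
-- generator of a field with q^n elements, has order q − 1. Hence ψ | X^q − X has exactly
-- m roots μ in K, and for each of them B is determined by the nonzero vector B(1).

open import Defs
open import Data.Bool using (Bool; true; false; _∧_; _xor_; if_then_else_)
import Data.Bool.Properties as Bool
open import Data.Empty using (⊥; ⊥-elim)
open import Data.Fin using (Fin; zero; suc; toℕ; fromℕ; fromℕ<; inject₁; punchIn; combine; remQuot; _↑ˡ_; _↑ʳ_)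
import Data.Fin.Properties as Fin
open import Data.List as List using (List; []; _∷_; _++_; length)
import Data.List.Membership.DecPropositional as DecMembership
open import Data.List.Membership.Propositional using (_∈_; _∉_; find; lose)
open import Data.List.Membership.Propositional.Properties
  using (∈-map⁺; ∈-map⁻; ∈-++⁺ˡ; ∈-++⁺ʳ; ∈-++⁻; ∈-filter⁺; ∈-filter⁻; ∈-∃++; ∈-applyUpTo⁻; ∈-applyDownFrom⁻)
open import Data.List.Properties using (length-map; length-++; length-applyUpTo; length-applyDownFrom)
open import Data.List.Relation.Unary.All as All using (All; []; _∷_)
import Data.List.Relation.Unary.All.Properties as All
open import Data.List.Relation.Unary.AllPairs using ([]; _∷_)
open import Data.List.Relation.Unary.Any as Any using (here; there)
open import Data.List.Relation.Unary.Unique.Propositional using (Unique)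
import Data.List.Relation.Unary.Unique.Propositional.Properties as Unique
open import Data.Nat using (ℕ; zero; suc; _+_; _*_; _∸_; _^_; _≤_; _<_; z≤n; s≤s; _≡ᵇ_; >-nonZero)
import Data.Nat.Properties as ℕ
open import Data.Product using (Σ; _×_; _,_; proj₁; proj₂; ∃; ∃-syntax)
open import Data.Sum as Sum using (_⊎_; inj₁; inj₂)
open import Data.Unit using (⊤; tt)
open import Data.Vec as Vec using (Vec; []; _∷_; lookup; tabulate; zipWith; replicate; init; last; foldr′; insertAt; concat)
import Data.Vec.Properties as Vec
open import Function using (_∘_; case_of_)
open import Relation.Binary using (DecidableEquality; tri<; tri≈; tri>)
open import Relation.Binary.PropositionalEquality
open import Relation.Nullary using (¬_; Dec; yes; no)

-- Finite counting

-- Primitivity is defined by irreducibility together with the order of X, but over a field the order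
-- alone decides: if X runs through all nonzero residues modulo f, then f cannot split. Primitivity
-- over F₂ and over K thus becomes cyclicity of one map, and cyclicity passes, in both directions,
-- along an equivariant additive map between spaces of equal size that does not kill 1. The obstacle
-- is the fibre over a given T. At first nothing is known about A: F₂[X]/(ψ) may have zero divisors,
-- and evaluation at e₀ may have a kernel. The cycle of T still pulls back along this evaluation,
-- and the norm then yields the order of X modulo ψ. Instead of an isomorphism of F₂[X]/(ψ) with K,
-- the roots of ψ in K are counted; this is the factor m. T determines c and A because cyclicity
-- forces c₀ ≠ 0, that is c₀ = 1 over F₂, so that A itself stands in the corner of T; for the same
-- reason μ is the constant coefficient of the polynomial. Characteristic 2 removes all signs, and m
-- ≥ 2 keeps the exponents q^i, i < n, below the period q^n - 1.

unique-⊆⇒length≤ : {A : Set} {xs ys : List A} → Unique xs → (∀ {x} → x ∈ xs → x ∈ ys) → length xs ≤ length ys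
unique-⊆⇒length≤ {xs = []} _ _ = z≤n
unique-⊆⇒length≤ {A} {x ∷ xs} {ys} (x∉ ∷ u) sub with ∈-∃++ (sub (here refl))
... | as , bs , refl = subst (suc (length xs) ≤_) (sym eq) (s≤s (unique-⊆⇒length≤ u sub′))
  where
  eq : length (as ++ x ∷ bs) ≡ suc (length (as ++ bs))
  eq = trans (length-++ as) (trans (ℕ.+-suc _ _) (cong suc (sym (length-++ as))))
  sub′ : ∀ {y} → y ∈ xs → y ∈ as ++ bs
  sub′ {y} y∈ with ∈-++⁻ as (sub (there y∈))
  ... | inj₁ p = ∈-++⁺ˡ p
  ... | inj₂ (here refl) = ⊥-elim (All.lookup x∉ y∈ refl)
  ... | inj₂ (there p) = ∈-++⁺ʳ as p

-- Pigeonhole in the form used for orbits: enough distinct iterates exhaust the space, so that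
-- surjectivity comes without constructing an inverse.
unique-full : {A : Set} → DecidableEquality A → {xs ys : List A} → Unique xs →
  (∀ {x} → x ∈ xs → x ∈ ys) → length ys ≤ length xs → ∀ {y} → y ∈ ys → y ∈ xs
unique-full _≟_ {xs} {ys} u sub le {y} y∈ with DecMembership._∈?_ _≟_ y xs
... | yes p = p
... | no y∉ = ⊥-elim (ℕ.<-irrefl refl (ℕ.≤-trans (unique-⊆⇒length≤ {xs = y ∷ xs} (All.¬Any⇒All¬ xs y∉ ∷ u) sub′) le))
  where
  sub′ : ∀ {x} → x ∈ y ∷ xs → x ∈ ys
  sub′ (here refl) = y∈
  sub′ (there p) = sub p

HasSize-unique : {A : Set} {P : A → Set} {k l : ℕ} → P HasSize k → P HasSize l → k ≡ l
HasSize-unique (L , refl , u , s , c) (L′ , refl , u′ , s′ , c′) = ℕ.≤-antisym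
  (unique-⊆⇒length≤ u (λ p → c′ _ (s _ p))) (unique-⊆⇒length≤ u′ (λ p → c _ (s′ _ p)))

HasSize-resp : {A : Set} {P Q : A → Set} {k : ℕ} → (∀ x → P x → Q x) → (∀ x → Q x → P x) →
  P HasSize k → Q HasSize k
HasSize-resp f g (L , e , u , s , c) = L , e , u , (λ x p → f x (s x p)) , (λ x q → c x (g x q))

-- Counting by fibres, where `Q` may vary with the first component. Both sides of the double count
-- are instances.
HasSize-Σ : {A B : Set} {P : A → Set} {Q : A → B → Set} {k l : ℕ} → P HasSize k →
  (∀ a → P a → Q a HasSize l) → (λ (ab : A × B) → P (proj₁ ab) × Q (proj₁ ab) (proj₂ ab)) HasSize (k * l)
HasSize-Σ {A} {B} {P} {Q} {k} {l} (L , refl , u , s , c) h =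
  HasSize-resp (λ { (a , b) (p , q) → s a p , q }) (λ { (a , b) (p , q) → c a p , q }) (go L u (λ a p → h a (s a p)))
  where
  go : (L : List A) → Unique L → (∀ a → a ∈ L → Q a HasSize l) →
       (λ (ab : A × B) → (proj₁ ab ∈ L) × Q (proj₁ ab) (proj₂ ab)) HasSize (length L * l)
  go [] _ _ = [] , refl , [] , (λ _ ()) , λ { _ (() , _) }
  go (a ∷ as) (a∉ ∷ u) h with h a (here refl) | go as u (λ x p → h x (there p))
  ... | (La , ea , ua , sa , ca) | (R , eR , uR , sR , cR) =
    List.map (a ,_) La ++ R
    , trans (length-++ (List.map (a ,_) La)) (cong₂ _+_ (trans (length-map _ La) ea) eR)
    , Unique.++⁺ (Unique.map⁺ (cong proj₂) ua) uR disj
    , sound , complete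
    where
    disj : ∀ {x} → (x ∈ List.map (a ,_) La) × (x ∈ R) → ⊥
    disj (p , q) with ∈-map⁻ (a ,_) p
    ... | b , _ , refl = All.lookup a∉ (proj₁ (sR _ q)) refl
    sound : ∀ x → x ∈ List.map (a ,_) La ++ R → (proj₁ x ∈ a ∷ as) × Q (proj₁ x) (proj₂ x)
    sound x p with ∈-++⁻ (List.map (a ,_) La) p
    ... | inj₂ q = there (proj₁ (sR x q)) , proj₂ (sR x q)
    ... | inj₁ q with ∈-map⁻ (a ,_) q
    ... | b , b∈ , refl = here refl , sa b b∈
    complete : ∀ x → (proj₁ x ∈ a ∷ as) × Q (proj₁ x) (proj₂ x) → x ∈ List.map (a ,_) La ++ R
    complete (_ , b) (here refl , q) = ∈-++⁺ˡ (∈-map⁺ (a ,_) (ca b q))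
    complete (x , b) (there p , q) = ∈-++⁺ʳ (List.map (a ,_) La) (cR (x , b) (p , q))

-- The bijection is a relation because a partner is constructed from a proof of `P` or `Q`, hence is
-- not given by a function on all of `A` or `B`.
HasSize-transport : {A B : Set} {P : A → Set} {Q : B → Set} (R : A → B → Set) {k : ℕ} →
  (∀ a → P a → ∃[ b ] Q b × R a b) → (∀ b → Q b → ∃[ a ] P a × R a b) →
  (∀ {a a′ b} → P a → P a′ → Q b → R a b → R a′ b → a ≡ a′) →
  (∀ {a b b′} → P a → Q b → Q b′ → R a b → R a b′ → b ≡ b′) →
  P HasSize k → Q HasSize k
HasSize-transport {A} {B} {P} {Q} R fwd bwd inj fun (L , refl , u , s , c) with go L u s
  where
  go : (L : List A) → Unique L → (∀ a → a ∈ L → P a) →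
    Σ (List B) λ L′ → (length L′ ≡ length L) × Unique L′ ×
      (∀ b → b ∈ L′ → Q b × ∃[ a ] (a ∈ L) × R a b) × (∀ a → a ∈ L → ∃[ b ] (b ∈ L′) × R a b)
  go [] _ _ = [] , refl , [] , (λ _ ()) , λ _ ()
  go (a ∷ as) (a∉ ∷ u) s with go as u (λ x p → s x (there p)) | fwd a (s a (here refl))
  ... | (L′ , e , u′ , s′ , c′) | (b , q , r) =
    b ∷ L′ , cong suc e , All.¬Any⇒All¬ L′ b∉ ∷ u′ , s″ , c″
    where
    b∉ : b ∉ L′
    b∉ b∈ with s′ b b∈
    ... | _ , a′ , a′∈ , r′ = All.lookup a∉ a′∈ (inj (s a (here refl)) (s a′ (there a′∈)) q r r′)
    s″ : ∀ x → x ∈ b ∷ L′ → Q x × ∃[ y ] (y ∈ a ∷ as) × R y x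
    s″ x (here refl) = q , a , here refl , r
    s″ x (there p) with s′ x p
    ... | q′ , a′ , a′∈ , r′ = q′ , a′ , there a′∈ , r′
    c″ : ∀ x → x ∈ a ∷ as → ∃[ y ] (y ∈ b ∷ L′) × R x y
    c″ x (here refl) = b , here refl , r
    c″ x (there p) with c′ x p
    ... | y , y∈ , r′ = y , there y∈ , r′
... | (L′ , e , u′ , s′ , c′) = L′ , e , u′ , (λ b p → proj₁ (s′ b p)) , complete
  where
  complete : ∀ b → Q b → b ∈ L′
  complete b q with bwd b q
  ... | a , p , r with c′ a (c a p)
  ... | b′ , b′∈ , r′ = subst (_∈ L′) (fun p (proj₁ (s′ b′ b′∈)) q r′ r) b′∈

HasSize-filter : {A : Set} {P Q : A → Set} {k : ℕ} → (∀ x → Dec (Q x)) → P HasSize k →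
  ∃[ l ] (λ x → P x × Q x) HasSize l
HasSize-filter Q? (L , _ , u , s , c) = _ , List.filter Q? L , refl , Unique.filter⁺ Q? u ,
  (λ x p → let q = ∈-filter⁻ Q? p in s x (proj₁ q) , proj₂ q) ,
  (λ x (p , q) → ∈-filter⁺ Q? (c x p) q)

HasSize-remove : {A : Set} {k : ℕ} → DecidableEquality A → (z : A) →
  (λ (_ : A) → ⊤) HasSize (suc k) → (λ x → x ≢ z) HasSize k
HasSize-remove {A} {k} _≟_ z (L , e , u , _ , c) with ∈-∃++ (c z tt)
... | as , bs , refl = as ++ bs , ℕ.suc-injective (trans (sym eq) e) , uniq as u , (λ x p q → z∉ as u (subst (_∈ as ++ bs) q p)) , complete
  where
  eq : length (as ++ z ∷ bs) ≡ suc (length (as ++ bs))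
  eq = trans (length-++ as) (trans (ℕ.+-suc _ _) (cong suc (sym (length-++ as))))
  drop-mid : ∀ as {x} → x ∈ as ++ bs → x ∈ as ++ z ∷ bs
  drop-mid as p with ∈-++⁻ as p
  ... | inj₁ q = ∈-++⁺ˡ q
  ... | inj₂ q = ∈-++⁺ʳ as (there q)
  uniq : ∀ as → Unique (as ++ z ∷ bs) → Unique (as ++ bs)
  uniq [] (_ ∷ u) = u
  uniq (a ∷ as) (a∉ ∷ u) = All.tabulate (λ p → All.lookup a∉ (drop-mid as p)) ∷ uniq as u
  z∉ : ∀ as → Unique (as ++ z ∷ bs) → z ∉ as ++ bs
  z∉ [] (z∉ ∷ u) p = All.lookup z∉ p refl
  z∉ (a ∷ as) (a∉ ∷ u) (here refl) = All.lookup a∉ (∈-++⁺ʳ as (here refl)) refl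
  z∉ (a ∷ as) (a∉ ∷ u) (there p) = z∉ as u p
  complete : ∀ x → x ≢ z → x ∈ as ++ bs
  complete x x≢z with ∈-++⁻ as (c x tt)
  ... | inj₁ q = ∈-++⁺ˡ q
  ... | inj₂ (here e) = ⊥-elim (x≢z e)
  ... | inj₂ (there q) = ∈-++⁺ʳ as q

Size : Set → ℕ → Set
Size A k = (λ (_ : A) → ⊤) HasSize k

Vec-Size : {A : Set} {k : ℕ} → Size A k → ∀ n → Size (Vec A n) (k ^ n)
Vec-Size sA zero = ([] ∷ []) , refl , [] ∷ [] , (λ _ _ → tt) , λ { [] _ → here refl }
Vec-Size sA (suc n) = HasSize-transport (λ (xv : _ × Vec _ n) w → w ≡ proj₁ xv ∷ proj₂ xv)
  (λ { (x , v) _ → x ∷ v , tt , refl })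
  (λ { (x ∷ v) _ → (x , v) , (tt , tt) , refl })
  (λ { _ _ _ refl refl → refl })
  (λ { _ _ _ refl refl → refl })
  (HasSize-Σ {Q = λ _ _ → ⊤} sA (λ _ _ → Vec-Size sA n))

HasSize-cover : {A : Set} {P Q : A → Set} {n k l : ℕ} → Size A n → P HasSize k → Q HasSize l →
  (∀ x → P x ⊎ Q x) → n ≤ k + l
HasSize-cover (L , refl , u , _ , _) (Lp , refl , _ , _ , cp) (Lq , refl , _ , _ , cq) h =
  subst (length L ≤_) (length-++ Lp) (unique-⊆⇒length≤ u (λ {x} _ → cover x))
  where
  cover : ∀ x → x ∈ Lp ++ Lq
  cover x with h x
  ... | inj₁ p = ∈-++⁺ˡ (cp x p)
  ... | inj₂ q = ∈-++⁺ʳ Lp (cq x q)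

-- Orbits of a map

iter-+ : {A : Set} (g : A → A) (a b : ℕ) (x : A) → iter g (a + b) x ≡ iter g a (iter g b x)
iter-+ g zero b x = refl
iter-+ g (suc a) b x = cong g (iter-+ g a b x)

iter-comm : {A : Set} (g : A → A) (a b : ℕ) (x : A) → iter g a (iter g b x) ≡ iter g b (iter g a x)
iter-comm g a b x = trans (sym (iter-+ g a b x)) (trans (cong (λ k → iter g k x) (ℕ.+-comm a b)) (iter-+ g b a x))

iter-fixed : {A : Set} (g : A → A) (k : ℕ) {x : A} → g x ≡ x → iter g k x ≡ x
iter-fixed g zero e = refl
iter-fixed g (suc k) e = trans (cong g (iter-fixed g k e)) e

iter-period : {A : Set} (g : A → A) {N : ℕ} {x : A} → iter g N x ≡ x → ∀ k → iter g (k * N) x ≡ x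
iter-period g e zero = refl
iter-period g {N} {x} e (suc k) = trans (iter-+ g N (k * N) x) (trans (cong (iter g N) (iter-period g e k)) e)

iter-map : {A B : Set} (f : A → B) {g : A → A} {h : B → B} → (∀ x → f (g x) ≡ h (f x)) →
  ∀ k x → f (iter g k x) ≡ iter h k (f x)
iter-map f e zero x = refl
iter-map f {g} {h} e (suc k) x = trans (e (iter g k x)) (cong h (iter-map f e k x))

-- If V has N + 1 elements and x fixes z, an orbit of length N that avoids z consists of all other
-- elements, so this is a single cycle. Quantifying over the starting vector removes the
-- distinguished unit of `HasOrder`, so that the property can be restarted at the image of a unit.
Cyclic : {V : Set} → V → (V → V) → ℕ → Set
Cyclic {V} z x N = ∀ v → v ≢ z → HasOrder v x N

module _ {V : Set} {z one : V} {x : V → V} {N : ℕ} (0<N : 0 < N) (xz : x z ≡ z) (ord : HasOrder one x N) where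

  -- After k steps, kN - k further ones complete k full periods. This takes the place of an inverse
  -- of x on the orbit.
  orbit-return : ∀ k → ∃[ l ] iter x l (iter x k one) ≡ one
  orbit-return k = k * N ∸ k , trans (sym (iter-+ x (k * N ∸ k) k one))
    (trans (cong (λ i → iter x i one) (ℕ.m∸n+n≡m k≤)) (iter-period x (proj₁ ord) k))
    where
    k≤ : k ≤ k * N
    k≤ = ℕ.≤-trans (ℕ.≤-reflexive (sym (ℕ.*-identityʳ k))) (ℕ.*-monoʳ-≤ k 0<N)

  orbit-≢ : one ≢ z → ∀ k → iter x k one ≢ z
  orbit-≢ ne k e with orbit-return k
  ... | l , r = ne (trans (sym r) (trans (cong (iter x l) e) (iter-fixed x l xz)))

  private
    no-coincidence : ∀ {i j} → i < j → j < N → iter x i one ≢ iter x j one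
    -- N - j further steps send x^j one back to one, hence x^i one as well, which would be a period
    -- shorter than N.
    no-coincidence {i} {j} i<j j<N e = proj₂ ord (N ∸ j + i) pos small eq
      where
      pos : 0 < N ∸ j + i
      pos = ℕ.≤-trans (ℕ.m<n⇒0<n∸m j<N) (ℕ.m≤m+n _ i)
      small : N ∸ j + i < N
      small = ℕ.≤-trans (ℕ.+-monoʳ-< (N ∸ j) i<j) (ℕ.≤-reflexive (ℕ.m∸n+n≡m (ℕ.<⇒≤ j<N)))
      eq : iter x (N ∸ j + i) one ≡ one
      eq = trans (iter-+ x (N ∸ j) i one) (trans (cong (iter x (N ∸ j)) e)
        (trans (sym (iter-+ x (N ∸ j) j one))
        (trans (cong (λ k → iter x k one) (ℕ.m∸n+n≡m (ℕ.<⇒≤ j<N))) (proj₁ ord))))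

  orbit-injective : ∀ {i j} → i < N → j < N → iter x i one ≡ iter x j one → i ≡ j
  orbit-injective {i} {j} i<N j<N e with ℕ.<-cmp i j
  ... | tri< i<j _ _ = ⊥-elim (no-coincidence i<j j<N e)
  ... | tri≈ _ e′ _ = e′
  ... | tri> _ _ j<i = ⊥-elim (no-coincidence j<i i<N (sym e))

  -- The N iterates are distinct and differ from z, so together with z they fill a set of N + 1
  -- elements.
  orbit-cover : DecidableEquality V → Size V (suc N) → one ≢ z →
    ∀ v → v ≢ z → ∃[ k ] (k < N) × (v ≡ iter x k one)
  orbit-cover _≟_ (L , len , _ , _ , all) ne v v≢z = ∈-applyUpTo⁻ (λ k → iter x k one) v∈
    where
    orbit : List V
    orbit = List.applyUpTo (λ k → iter x k one) N
    z∉ : ∀ {y} → y ∈ orbit → z ≢ y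
    z∉ p e with ∈-applyUpTo⁻ (λ k → iter x k one) p
    ... | k , _ , q = orbit-≢ ne k (trans (sym q) (sym e))
    uniq : Unique (z ∷ orbit)
    uniq = All.tabulate z∉ ∷ Unique.applyUpTo⁺₁ _ N no-coincidence
    v∈ : v ∈ orbit
    v∈ with unique-full _≟_ uniq (λ {y} _ → all y tt)
          (ℕ.≤-reflexive (trans len (cong suc (sym (length-applyUpTo (λ k → iter x k one) N))))) (all v tt)
    ... | here e = ⊥-elim (v≢z e)
    ... | there p = p

  order⇒cyclic : DecidableEquality V → Size V (suc N) → one ≢ z → Cyclic z x N
  order⇒cyclic _≟_ sz ne v v≢z with orbit-cover _≟_ sz ne v v≢z
  ... | j , _ , refl = trans (iter-comm x N j one) (cong (iter x j) (proj₁ ord)) ,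
    λ k 0<k k<N e → proj₂ ord k 0<k k<N (back k e)
    where
    back : ∀ k → iter x k (iter x j one) ≡ iter x j one → iter x k one ≡ one
    back k e with orbit-return j
    ... | l , r = trans (sym (trans (iter-comm x l k _) (cong (iter x k) r))) (trans (cong (iter x l) e) r)

module _ {V W : Set} (_≟V_ : DecidableEquality V) (_≟W_ : DecidableEquality W)
  {z : V} {z′ : W} {x : V → V} {x′ : W → W} {N : ℕ} (0<N : 0 < N)
  (xz : x z ≡ z) (xz′ : x′ z′ ≡ z′)
  (Φ : V → W) (equi : ∀ v → Φ (x v) ≡ x′ (Φ v)) where

  -- A vector v ≠ z lies on the orbit of one, so some power of x moves it to one; by equivariance Φ
  -- v = z′ would force Φ one = z′.
  equivariant-kernel : Size V (suc N) → {one : V} → HasOrder one x N → one ≢ z → Φ one ≢ z′ →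
    ∀ v → Φ v ≡ z′ → v ≡ z
  equivariant-kernel sz {one} ord ne ne′ v e with v ≟V z
  ... | yes p = p
  ... | no v≢z with orbit-cover 0<N xz ord _≟V_ sz ne v v≢z
  ... | k , _ , refl with orbit-return 0<N xz ord k
  ... | l , r = ⊥-elim (ne′ (trans (cong Φ (sym r)) (trans (iter-map Φ equi l _)
                  (trans (cong (iter x′ l) e) (iter-fixed x′ l xz′)))))

  -- The hypothesis that a trivial kernel gives injectivity stands for the additivity of Φ. It keeps
  -- the lemma free of module structures, which differ between source and target in the
  -- applications.
  cyclic-forward : Size V (suc N) → Size W (suc N) →
    ((∀ v → Φ v ≡ z′ → v ≡ z) → ∀ {a b} → Φ a ≡ Φ b → a ≡ b) →
    {one : V} → HasOrder one x N → one ≢ z → Φ one ≢ z′ → Cyclic z′ x′ N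
  cyclic-forward szV szW inj {one} ord ne ne′ = order⇒cyclic 0<N xz′ ord′ _≟W_ szW ne′
    where
    ord′ : HasOrder (Φ one) x′ N
    ord′ = trans (sym (iter-map Φ equi N one)) (cong Φ (proj₁ ord)) ,
      λ k 0<k k<N e → proj₂ ord k 0<k k<N
        (inj (equivariant-kernel szV ord ne ne′) (trans (iter-map Φ equi k one) e))

  -- Injectivity of Φ comes out of the argument. The first N iterates of one are distinct and
  -- nonzero because their images are, so with z they fill V; the next iterate repeats an earlier
  -- one, and comparing images shows that it repeats one itself.
  cyclic-backward : Size V (suc N) → Φ z ≡ z′ → {one : V} → HasOrder (Φ one) x′ N → Φ one ≢ z′ → Cyclic z x N
  cyclic-backward sz Φz {one} ord ne′ = order⇒cyclic 0<N xz ord₀ _≟V_ sz ne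
    where
    ne : one ≢ z
    ne e = ne′ (trans (cong Φ e) Φz)
    small : ∀ k → 0 < k → k < N → iter x k one ≢ one
    small k 0<k k<N e = proj₂ ord k 0<k k<N (trans (sym (iter-map Φ equi k one)) (cong Φ e))
    image : ∀ k → Φ (iter x k one) ≡ iter x′ k (Φ one)
    image k = iter-map Φ equi k one
    orbit : List V
    orbit = List.applyUpTo (λ k → iter x k one) N
    distinct : ∀ {i j} → i < j → j < N → iter x i one ≢ iter x j one
    distinct {i} {j} i<j j<N e = ℕ.<⇒≢ i<j (orbit-injective 0<N xz′ ord (ℕ.<-trans i<j j<N) j<N
      (trans (sym (image i)) (trans (cong Φ e) (image j))))
    orbit≢z : ∀ k → iter x k one ≢ z
    orbit≢z k e = orbit-≢ 0<N xz′ ord ne′ k (trans (sym (image k)) (trans (cong Φ e) Φz))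
    z∉ : ∀ {y} → y ∈ orbit → z ≢ y
    z∉ p e with ∈-applyUpTo⁻ (λ k → iter x k one) p
    ... | k , _ , q = orbit≢z k (trans (sym q) (sym e))
    covered : ∃[ k ] (k < N) × (iter x N one ≡ iter x k one)
    covered with unique-full _≟V_ {xs = z ∷ orbit} (All.tabulate z∉ ∷ Unique.applyUpTo⁺₁ _ N distinct)
          (λ {y} _ → proj₂ (proj₂ (proj₂ (proj₂ sz))) y tt)
          (ℕ.≤-reflexive (trans (proj₁ (proj₂ sz)) (cong suc (sym (length-applyUpTo (λ k → iter x k one) N)))))
          (proj₂ (proj₂ (proj₂ (proj₂ sz))) (iter x N one) tt)
    ... | here e = ⊥-elim (orbit≢z N e)
    ... | there p = ∈-applyUpTo⁻ (λ k → iter x k one) p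
    ord₀ : HasOrder one x N
    ord₀ with covered
    ... | k , k<N , e = trans e (cong (λ i → iter x i one) k≡0) , small
      where
      k≡0 : k ≡ 0
      k≡0 = orbit-injective 0<N xz′ ord k<N 0<N
        (trans (sym (image k)) (trans (cong Φ (sym e)) (trans (image N) (proj₁ ord))))

-- Rings and modules of characteristic 2

record IsGroup₂ {A : Set} (0g : A) (_⊞_ : A → A → A) : Set where
  field
    assoc : ∀ x y z → (x ⊞ y) ⊞ z ≡ x ⊞ (y ⊞ z)
    comm : ∀ x y → x ⊞ y ≡ y ⊞ x
    idˡ : ∀ x → 0g ⊞ x ≡ x
    self : ∀ x → x ⊞ x ≡ 0g

  idʳ : ∀ x → x ⊞ 0g ≡ x
  idʳ x = trans (comm x 0g) (idˡ x)

  cancelˡ : ∀ x y → x ⊞ (x ⊞ y) ≡ y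
  cancelˡ x y = trans (sym (assoc x x y)) (trans (cong (_⊞ y) (self x)) (idˡ y))

  zero⇒≡ : ∀ {x y} → x ⊞ y ≡ 0g → x ≡ y
  zero⇒≡ {x} {y} e = trans (sym (idʳ x)) (trans (cong (x ⊞_) (sym e)) (cancelˡ x y))

  ≡⇒zero : ∀ {x y} → x ≡ y → x ⊞ y ≡ 0g
  ≡⇒zero refl = self _

  interchange : ∀ a b c d → (a ⊞ b) ⊞ (c ⊞ d) ≡ (a ⊞ c) ⊞ (b ⊞ d)
  interchange a b c d = begin
    (a ⊞ b) ⊞ (c ⊞ d) ≡⟨ assoc a b _ ⟩
    a ⊞ (b ⊞ (c ⊞ d)) ≡⟨ cong (a ⊞_) (trans (sym (assoc b c d)) (trans (cong (_⊞ d) (comm b c)) (assoc c b d))) ⟩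
    a ⊞ (c ⊞ (b ⊞ d)) ≡⟨ assoc a c _ ⟨
    (a ⊞ c) ⊞ (b ⊞ d) ∎
    where open ≡-Reasoning

module _ {A B : Set} {0a : A} {_+a_ : A → A → A} {0b : B} {_+b_ : B → B → B}
  (GA : IsGroup₂ 0a _+a_) (GB : IsGroup₂ 0b _+b_)
  {f : A → B} (add : ∀ v w → f (v +a w) ≡ f v +b f w) where
  private
    module GA = IsGroup₂ GA
    module GB = IsGroup₂ GB

  additive-zero : f 0a ≡ 0b
  additive-zero = trans (cong f (sym (GA.self 0a))) (trans (add 0a 0a) (GB.self _))

  additive-injective : (∀ v → f v ≡ 0b → v ≡ 0a) → ∀ {a b} → f a ≡ f b → a ≡ b
  additive-injective ker {a} {b} e = GA.zero⇒≡ (ker _ (trans (add a b) (GB.≡⇒zero e)))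

record IsRing₂ (R : Ops) : Set where
  open Ops R using () renaming (C to K; 0# to 0r; 1# to 1r; _⊕_ to _+r_; _⊗_ to _*r_; ⊖_ to -r_)
  field
    group : IsGroup₂ 0r _+r_
    ⊖-id : ∀ x → -r x ≡ x
    *-assoc : ∀ x y z → (x *r y) *r z ≡ x *r (y *r z)
    *-comm : ∀ x y → x *r y ≡ y *r x
    *-idˡ : ∀ x → 1r *r x ≡ x
    distribˡ : ∀ x y z → x *r (y +r z) ≡ (x *r y) +r (x *r z)
  open IsGroup₂ group public

  distribʳ : ∀ x y z → (x +r y) *r z ≡ (x *r z) +r (y *r z)
  distribʳ x y z = trans (*-comm _ z) (trans (distribˡ z x y) (cong₂ _+r_ (*-comm z x) (*-comm z y)))

  *-idʳ : ∀ x → x *r 1r ≡ x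
  *-idʳ x = trans (*-comm x 1r) (*-idˡ x)

  *-zeroʳ : ∀ x → x *r 0r ≡ 0r
  *-zeroʳ x = trans (cong (x *r_) (sym (self 0r))) (trans (distribˡ x 0r 0r) (self _))

  *-zeroˡ : ∀ x → 0r *r x ≡ 0r
  *-zeroˡ x = trans (*-comm 0r x) (*-zeroʳ x)

  *-interchange : ∀ a b c d → (a *r b) *r (c *r d) ≡ (a *r c) *r (b *r d)
  *-interchange a b c d = trans (*-assoc a b _) (trans (cong (a *r_)
    (trans (sym (*-assoc b c d)) (trans (cong (_*r d) (*-comm b c)) (*-assoc c b d)))) (sym (*-assoc a c _)))

F2-ring : IsRing₂ F2
F2-ring = record
  { group = record { assoc = Bool.xor-assoc ; comm = Bool.xor-comm ; idˡ = λ _ → refl ; self = Bool.xor-same }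
  ; ⊖-id = λ _ → refl
  ; *-assoc = Bool.∧-assoc ; *-comm = Bool.∧-comm ; *-idˡ = λ _ → refl
  ; distribˡ = Bool.∧-distribˡ-xor }

record Module₂ (R : Ops) : Set₁ where
  open Ops R using () renaming (C to K; 0# to 0r; 1# to 1r; _⊕_ to _+r_; _⊗_ to _*r_)
  infixr 7 _•_
  infixl 6 _+v_
  field
    V : Set
    0v : V
    _+v_ : V → V → V
    _•_ : K → V → V
    group : IsGroup₂ 0v _+v_
    •-+v : ∀ a v w → a • (v +v w) ≡ a • v +v a • w
    •-+r : ∀ a b v → (a +r b) • v ≡ a • v +v b • v
    •-* : ∀ a b v → (a *r b) • v ≡ a • (b • v)
    •-1 : ∀ v → 1r • v ≡ v
  open IsGroup₂ group public

  •-0v : ∀ a → a • 0v ≡ 0v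
  •-0v a = trans (cong (a •_) (sym (self 0v))) (trans (•-+v a 0v 0v) (self _))

module _ {R : Ops} (ring : IsRing₂ R) where
  open Ops R using () renaming (C to K; 0# to 0r; 1# to 1r; _⊕_ to _+r_; _⊗_ to _*r_)
  private module R = IsRing₂ ring

  0•-zero : (M : Module₂ R) → let open Module₂ M in ∀ v → 0r • v ≡ 0v
  0•-zero M v = trans (cong (_• v) (sym (R.self 0r))) (trans (•-+r 0r 0r v) (self _))
    where open Module₂ M

  vecModule : ℕ → Module₂ R
  vecModule n = record
    { V = Vec K n ; 0v = replicate n 0r ; _+v_ = zipWith _+r_ ; _•_ = λ a → Vec.map (a *r_)
    ; group = record
      { assoc = Vec.zipWith-assoc R.assoc ; comm = Vec.zipWith-comm R.comm
      ; idˡ = Vec.zipWith-identityˡ R.idˡ ; self = self }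
    ; •-+v = •-+v ; •-+r = •-+r ; •-* = •-* ; •-1 = •-1 }
    where
    self : ∀ {n} (v : Vec K n) → zipWith _+r_ v v ≡ replicate n 0r
    self [] = refl
    self (x ∷ v) = cong₂ _∷_ (R.self x) (self v)
    •-+v : ∀ {n} a (v w : Vec K n) → Vec.map (a *r_) (zipWith _+r_ v w) ≡ zipWith _+r_ (Vec.map (a *r_) v) (Vec.map (a *r_) w)
    •-+v a [] [] = refl
    •-+v a (x ∷ v) (y ∷ w) = cong₂ _∷_ (R.distribˡ a x y) (•-+v a v w)
    •-+r : ∀ {n} a b (v : Vec K n) → Vec.map ((a +r b) *r_) v ≡ zipWith _+r_ (Vec.map (a *r_) v) (Vec.map (b *r_) v)
    •-+r a b [] = refl
    •-+r a b (x ∷ v) = cong₂ _∷_ (R.distribʳ a b x) (•-+r a b v)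
    •-* : ∀ {n} a b (v : Vec K n) → Vec.map ((a *r b) *r_) v ≡ Vec.map (a *r_) (Vec.map (b *r_) v)
    •-* a b [] = refl
    •-* a b (x ∷ v) = cong₂ _∷_ (R.*-assoc a b x) (•-* a b v)
    •-1 : ∀ {n} (v : Vec K n) → Vec.map (1r *r_) v ≡ v
    •-1 [] = refl
    •-1 (x ∷ v) = cong₂ _∷_ (R.*-idˡ x) (•-1 v)

record IsLinear {R : Ops} (M N : Module₂ R) (f : Module₂.V M → Module₂.V N) : Set where
  private
    module M = Module₂ M
    module N = Module₂ N
  field
    add : ∀ v w → f (v M.+v w) ≡ f v N.+v f w
    scale : ∀ a v → f (a M.• v) ≡ a N.• f v

  zero-map : f M.0v ≡ N.0v
  zero-map = additive-zero M.group N.group add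

  kernel⇒injective : (∀ v → f v ≡ N.0v → v ≡ M.0v) → ∀ {a b} → f a ≡ f b → a ≡ b
  kernel⇒injective = additive-injective M.group N.group add

-- Polynomials in a linear operator

module Horner {R : Ops} (M : Module₂ R) (X : Module₂.V M → Module₂.V M) where
  open Ops R using () renaming (C to K)
  open Module₂ M

  -- a₀w + X(a₁w + X(… + X b)): b = 0v gives a polynomial of degree < k in X
  -- acting on w, and b = w the monic polynomial with these lower coefficients.
  horner : V → ∀ {k} → Vec K k → V → V
  horner b as w = foldr′ (λ a acc → (a • w) +v X acc) b as

  low : ∀ {k} → Vec K k → V → V
  low = horner 0v

  monic : ∀ {k} → Vec K k → V → V
  monic as w = horner w as w

module HornerProperties {R : Ops} (ring : IsRing₂ R) where
  open Ops R using () renaming (C to K; 0# to 0r; 1# to 1r; _⊕_ to _+r_; _⊗_ to _*r_)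
  private module R = IsRing₂ ring

  -- The common source of the commutation rules below: taking f to be X, a scalar or another
  -- polynomial in X gives that polynomials in X commute with each of these.
  horner-map : (M N : Module₂ R) {X : Module₂.V M → Module₂.V M} {X′ : Module₂.V N → Module₂.V N}
    {f : Module₂.V M → Module₂.V N} → IsLinear M N f → (∀ v → f (X v) ≡ X′ (f v)) →
    ∀ {k} (as : Vec K k) b w → f (Horner.horner M X b as w) ≡ Horner.horner N X′ (f b) as (f w)
  horner-map M N lin e [] b w = refl
  horner-map M N {X′ = X′} lin e (a ∷ as) b w = trans (IsLinear.add lin _ _)
    (cong₂ (Module₂._+v_ N) (IsLinear.scale lin a w) (trans (e _) (cong X′ (horner-map M N lin e as b w))))

  low-map : (M N : Module₂ R) {X : Module₂.V M → Module₂.V M} {X′ : Module₂.V N → Module₂.V N}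
    {f : Module₂.V M → Module₂.V N} → IsLinear M N f → (∀ v → f (X v) ≡ X′ (f v)) →
    ∀ {k} (as : Vec K k) w → f (Horner.low M X as w) ≡ Horner.low N X′ as (f w)
  low-map M N {X′ = X′} {f} lin e as w = trans (horner-map M N lin e as _ w)
    (cong (λ b → Horner.horner N X′ b as (f w)) (IsLinear.zero-map lin))

  module _ (M : Module₂ R) {X : Module₂.V M → Module₂.V M} (linX : IsLinear M M X) where
    open Module₂ M
    open Horner M X
    open ≡-Reasoning

    scale-linear : ∀ c → IsLinear M M (c •_)
    scale-linear c = record { add = •-+v c ; scale = λ a v → begin
      c • (a • v) ≡⟨ •-* c a v ⟨
      (c *r a) • v ≡⟨ cong (_• v) (R.*-comm c a) ⟩
      (a *r c) • v ≡⟨ •-* a c v ⟩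
      a • (c • v) ∎ }

    low-linear : ∀ {k} (as : Vec K k) → IsLinear M M (low as)
    low-linear as = record { add = add as ; scale = λ c v → sym (low-map M M (scale-linear c) (λ w → sym (IsLinear.scale linX c w)) as v) }
      where
      add : ∀ {k} (as : Vec K k) v w → low as (v +v w) ≡ low as v +v low as w
      add [] v w = sym (idˡ 0v)
      add (a ∷ as) v w = begin
        a • (v +v w) +v X (low as (v +v w)) ≡⟨ cong₂ _+v_ (•-+v a v w) (trans (cong X (add as v w)) (IsLinear.add linX _ _)) ⟩
        (a • v +v a • w) +v (X (low as v) +v X (low as w)) ≡⟨ interchange _ _ _ _ ⟩
        (a • v +v X (low as v)) +v (a • w +v X (low as w)) ∎

    low-coef-linear : ∀ k w → IsLinear (vecModule ring k) M (λ as → low {k} as w)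
    low-coef-linear k w = record { add = add ; scale = scale }
      where
      add : ∀ {k} (as bs : Vec K k) → low (zipWith _+r_ as bs) w ≡ low as w +v low bs w
      add [] [] = sym (idˡ 0v)
      add (a ∷ as) (b ∷ bs) = begin
        (a +r b) • w +v X (low (zipWith _+r_ as bs) w) ≡⟨ cong₂ _+v_ (•-+r a b w) (trans (cong X (add as bs)) (IsLinear.add linX _ _)) ⟩
        (a • w +v b • w) +v (X (low as w) +v X (low bs w)) ≡⟨ interchange _ _ _ _ ⟩
        (a • w +v X (low as w)) +v (b • w +v X (low bs w)) ∎
      scale : ∀ {k} c (as : Vec K k) → low (Vec.map (c *r_) as) w ≡ c • low as w
      scale c [] = sym (•-0v c)
      scale c (a ∷ as) = begin
        (c *r a) • w +v X (low (Vec.map (c *r_) as) w) ≡⟨ cong₂ _+v_ (•-* c a w) (trans (cong X (scale c as)) (IsLinear.scale linX c _)) ⟩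
        c • (a • w) +v c • X (low as w) ≡⟨ •-+v c _ _ ⟨
        c • (a • w +v X (low as w)) ∎

    low-comm : ∀ {k l} (as : Vec K k) (bs : Vec K l) w → low as (low bs w) ≡ low bs (low as w)
    low-comm as bs w = sym (low-map M M (low-linear bs) (λ v → sym (low-map M M linX (λ _ → refl) bs v)) as w)

    low-X : ∀ {k} (as : Vec K k) w → low as (X w) ≡ X (low as w)
    low-X as w = sym (low-map M M linX (λ _ → refl) as w)

    low-zero : ∀ {k} w → low (replicate k 0r) w ≡ 0v
    low-zero {k} w = IsLinear.zero-map (low-coef-linear k w)

    horner-split : ∀ {k} (as : Vec K k) b w → horner b as w ≡ low as w +v iter X k b
    horner-split [] b w = sym (idˡ b)
    horner-split {suc k} (a ∷ as) b w = begin
      a • w +v X (horner b as w) ≡⟨ cong (λ v → a • w +v X v) (horner-split as b w) ⟩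
      a • w +v X (low as w +v iter X k b) ≡⟨ cong (a • w +v_) (IsLinear.add linX _ _) ⟩
      a • w +v (X (low as w) +v X (iter X k b)) ≡⟨ assoc (a • w) (X (low as w)) (X (iter X k b)) ⟨
      (a • w +v X (low as w)) +v X (iter X k b) ∎

    -- Polynomials in X commute, so what annihilates w annihilates everything that w generates.
    monic-low : ∀ {k l} (as : Vec K k) (bs : Vec K l) w → monic as w ≡ 0v → monic as (low bs w) ≡ 0v
    monic-low as bs w e = begin
      monic as (low bs w) ≡⟨ horner-map M M {X} {X} {low bs} (low-linear bs) (low-X bs) as w w ⟨
      low bs (monic as w) ≡⟨ cong (low bs) e ⟩
      low bs 0v ≡⟨ IsLinear.zero-map (low-linear bs) ⟩
      0v ∎

    low-init-last : ∀ {d} (z : Vec K (suc d)) w → low z w ≡ low (init z) w +v last z • iter X d w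
    low-init-last (a ∷ []) w = begin
      a • w +v X 0v ≡⟨ cong (a • w +v_) (IsLinear.zero-map linX) ⟩
      a • w +v 0v ≡⟨ comm _ _ ⟩
      0v +v a • w ∎
    low-init-last {suc d} (a ∷ z@(_ ∷ _)) w = begin
      a • w +v X (low z w) ≡⟨ cong (λ v → a • w +v X v) (low-init-last z w) ⟩
      a • w +v X (low (init z) w +v last z • iter X d w) ≡⟨ cong (a • w +v_) (trans (IsLinear.add linX _ _) (cong (X (low (init z) w) +v_) (IsLinear.scale linX _ _))) ⟩
      a • w +v (X (low (init z) w) +v last z • X (iter X d w)) ≡⟨ assoc (a • w) (X (low (init z) w)) (last z • X (iter X d w)) ⟨
      (a • w +v X (low (init z) w)) +v last z • X (iter X d w) ∎

    -- Since f annihilates w, the reduction modulo f inside `xmul` is invisible on w. Thus z ↦ z(X)w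
    -- is a well-defined equivariant map from R[X]/(f), the map from which all later isomorphisms
    -- are built.
    xmul-low : (∀ x → Ops.⊖_ R x ≡ x) → ∀ {n} (fl : Vec K n) w → monic fl w ≡ 0v →
      ∀ z → low (xmul R fl z) w ≡ X (low z w)
    xmul-low ⊖-id {zero} fl w e [] = sym (IsLinear.zero-map linX)
    xmul-low ⊖-id {suc d} fl w e z = begin
      low (zipWith _+r_ (0r ∷ init z) (Vec.map (λ f → Ops.⊖_ R (last z *r f)) fl)) w
        ≡⟨ IsLinear.add (low-coef-linear (suc d) w) (0r ∷ init z) (Vec.map (λ f → Ops.⊖_ R (last z *r f)) fl) ⟩
      low (0r ∷ init z) w +v low (Vec.map (λ f → Ops.⊖_ R (last z *r f)) fl) w
        ≡⟨ cong₂ _+v_ (trans (cong (_+v X (low (init z) w)) (0•-zero ring M w)) (idˡ _))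
             (trans (cong (λ u → low u w) (Vec.map-cong (λ f → ⊖-id (last z *r f)) fl)) (IsLinear.scale (low-coef-linear (suc d) w) (last z) fl)) ⟩
      X (low (init z) w) +v last z • low fl w
        ≡⟨ cong (λ v → X (low (init z) w) +v last z • v) (zero⇒≡ (trans (sym (horner-split fl w w)) e)) ⟩
      X (low (init z) w) +v last z • X (iter X d w)
        ≡⟨ cong (X (low (init z) w) +v_) (IsLinear.scale linX _ _) ⟨
      X (low (init z) w) +v X (last z • iter X d w) ≡⟨ IsLinear.add linX _ _ ⟨
      X (low (init z) w +v last z • iter X d w) ≡⟨ cong X (low-init-last z w) ⟨
      X (low z w) ∎

  low-one : (M : Module₂ R) {X : Module₂.V M → Module₂.V M} (linX : IsLinear M M X) → let open Module₂ M in
    ∀ {n} (fl : Vec K n) w → Horner.monic M X fl w ≡ 0v → Horner.low M X (oneVec R n) w ≡ w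
  low-one M linX [] w e = sym e
  low-one M {X} linX {suc d} fl w e = begin
    1r • w +v X (low (tabulate {n = d} (λ _ → 0r)) w) ≡⟨ cong₂ _+v_ (•-1 w) (trans (cong X (trans (cong (λ u → low u w) zeros) (low-zero M linX {d} w))) (IsLinear.zero-map linX)) ⟩
    w +v 0v ≡⟨ idʳ w ⟩
    w ∎
    where
    open Module₂ M
    open Horner M X
    open ≡-Reasoning
    zeros : tabulate {n = d} (λ _ → 0r) ≡ replicate d 0r
    zeros = tabulate-const d
      where
      tabulate-const : ∀ d → tabulate {n = d} (λ _ → 0r) ≡ replicate d 0r
      tabulate-const zero = refl
      tabulate-const (suc d) = cong (0r ∷_) (tabulate-const d)

-- Quotient rings R[X]/(f) by a monic polynomial

lookup-ext : {A : Set} {n : ℕ} {v w : Vec A n} → (∀ i → lookup v i ≡ lookup w i) → v ≡ w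
lookup-ext {v = v} {w} e = trans (sym (Vec.tabulate∘lookup v)) (trans (Vec.tabulate-cong e) (Vec.tabulate∘lookup w))

lookup-init : {A : Set} {d : ℕ} (v : Vec A (suc d)) (i : Fin d) → lookup (init v) i ≡ lookup v (inject₁ i)
lookup-init (x ∷ y ∷ v) zero = refl
lookup-init (x ∷ y ∷ v) (suc i) = lookup-init (y ∷ v) i

last-lookup : {A : Set} {d : ℕ} (v : Vec A (suc d)) → last v ≡ lookup v (fromℕ d)
last-lookup (x ∷ []) = refl
last-lookup (x ∷ y ∷ v) = last-lookup (y ∷ v)

-- At `R = F2` this computes to `GF`, so results about it hold for `GF m p` as they stand. The
-- general base serves the extensions of `GF m p` and of F₂[X]/(ψ).
Quot : (R : Ops) (n : ℕ) → Vec (C R) n → Ops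
Quot R n fl = record
  { C = Vec (C R) n
  ; 0# = replicate n (0# R)
  ; 1# = oneVec R n
  ; _⊕_ = zipWith (_⊕_ R)
  ; _⊗_ = λ a b → foldr′ (λ ai acc → zipWith (_⊕_ R) (Vec.map (_⊗_ R ai) b) (xmul R fl acc)) (replicate n (0# R)) a
  ; ⊖_ = λ x → x }

module QuotProperties {R : Ops} (ring : IsRing₂ R) (n : ℕ) (fl : Vec (C R) n) where
  open Ops R using () renaming (C to K; 0# to 0r; 1# to 1r; _⊕_ to _+r_; _⊗_ to _*r_)
  private module R = IsRing₂ ring
  open HornerProperties ring

  M : Module₂ R
  M = vecModule ring n
  open Module₂ M
  open ≡-Reasoning

  X : V → V
  X = xmul R fl

  one : V
  one = oneVec R n

  xmul-linear : IsLinear M M X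
  xmul-linear = record { add = add fl ; scale = scale fl }
    where
    initadd : ∀ {d} (v w : Vec K (suc d)) → init (zipWith _+r_ v w) ≡ zipWith _+r_ (init v) (init w)
    initadd (x ∷ []) (y ∷ []) = refl
    initadd (x ∷ v@(_ ∷ _)) (y ∷ w@(_ ∷ _)) = cong (_ ∷_) (initadd v w)
    lastadd : ∀ {d} (v w : Vec K (suc d)) → last (zipWith _+r_ v w) ≡ last v +r last w
    lastadd (x ∷ []) (y ∷ []) = refl
    lastadd (x ∷ v@(_ ∷ _)) (y ∷ w@(_ ∷ _)) = lastadd v w
    initscale : ∀ {d} a (v : Vec K (suc d)) → init (Vec.map (a *r_) v) ≡ Vec.map (a *r_) (init v)
    initscale a (x ∷ []) = refl
    initscale a (x ∷ v@(_ ∷ _)) = cong (_ ∷_) (initscale a v)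
    lastscale : ∀ {d} a (v : Vec K (suc d)) → last (Vec.map (a *r_) v) ≡ a *r last v
    lastscale a (x ∷ []) = refl
    lastscale a (x ∷ v@(_ ∷ _)) = lastscale a v
    xmul-split : ∀ {d} (fl : Vec K (suc d)) r → xmul R fl r ≡ zipWith _+r_ (0r ∷ init r) (Vec.map (last r *r_) fl)
    xmul-split fl r = cong (zipWith _+r_ (0r ∷ init r)) (Vec.map-cong (λ f → R.⊖-id (last r *r f)) fl)
    add : ∀ {n} (fl : Vec K n) v w → xmul R fl (zipWith _+r_ v w) ≡ zipWith _+r_ (xmul R fl v) (xmul R fl w)
    add [] v w = refl
    add {suc d} fl v w = begin
      xmul R fl (zipWith _+r_ v w) ≡⟨ xmul-split fl _ ⟩
      zipWith _+r_ (0r ∷ init (zipWith _+r_ v w)) (Vec.map (last (zipWith _+r_ v w) *r_) fl)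
        ≡⟨ cong₂ (zipWith _+r_) (cong₂ _∷_ (sym (R.idˡ 0r)) (initadd v w))
              (trans (cong (λ l → Vec.map (l *r_) fl) (lastadd v w)) (N.•-+r (last v) (last w) fl)) ⟩
      zipWith _+r_ (zipWith _+r_ (0r ∷ init v) (0r ∷ init w)) (zipWith _+r_ (Vec.map (last v *r_) fl) (Vec.map (last w *r_) fl))
        ≡⟨ N.interchange (0r ∷ init v) (0r ∷ init w) _ _ ⟩
      zipWith _+r_ (zipWith _+r_ (0r ∷ init v) (Vec.map (last v *r_) fl)) (zipWith _+r_ (0r ∷ init w) (Vec.map (last w *r_) fl))
        ≡⟨ cong₂ (zipWith _+r_) (xmul-split fl v) (xmul-split fl w) ⟨
      zipWith _+r_ (xmul R fl v) (xmul R fl w) ∎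
      where module N = Module₂ (vecModule ring (suc d))
    scale : ∀ {n} (fl : Vec K n) a v → xmul R fl (Vec.map (a *r_) v) ≡ Vec.map (a *r_) (xmul R fl v)
    scale [] a v = refl
    scale {suc d} fl a v = begin
      xmul R fl (Vec.map (a *r_) v) ≡⟨ xmul-split fl _ ⟩
      zipWith _+r_ (0r ∷ init (Vec.map (a *r_) v)) (Vec.map (last (Vec.map (a *r_) v) *r_) fl)
        ≡⟨ cong₂ (zipWith _+r_) (cong₂ _∷_ (sym (R.*-zeroʳ a)) (initscale a v))
              (trans (cong (λ l → Vec.map (l *r_) fl) (lastscale a v)) (N.•-* a (last v) fl)) ⟩
      zipWith _+r_ (Vec.map (a *r_) (0r ∷ init v)) (Vec.map (a *r_) (Vec.map (last v *r_) fl)) ≡⟨ N.•-+v a (0r ∷ init v) _ ⟨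
      Vec.map (a *r_) (zipWith _+r_ (0r ∷ init v) (Vec.map (last v *r_) fl)) ≡⟨ cong (Vec.map (a *r_)) (xmul-split fl v) ⟨
      Vec.map (a *r_) (xmul R fl v) ∎
      where module N = Module₂ (vecModule ring (suc d))

  open Horner M X

  private
    -- Coefficients of the polynomial with low coefficients as and leading coefficient t.
    coef : K → ∀ {k} → Vec K k → ℕ → K
    coef t [] zero = t
    coef t [] (suc i) = 0r
    coef t (a ∷ as) zero = a
    coef t (a ∷ as) (suc i) = coef t as i

    coef-lookup : ∀ t {k} (as : Vec K k) i → coef t as (toℕ i) ≡ lookup as i
    coef-lookup t (a ∷ as) zero = refl
    coef-lookup t (a ∷ as) (suc i) = coef-lookup t as i

    coef-end : ∀ t {k} (as : Vec K k) → coef t as k ≡ t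
    coef-end t [] = refl
    coef-end t (a ∷ as) = coef-end t as

    coef-beyond : ∀ t {k} (as : Vec K k) i → k < i → coef t as i ≡ 0r
    coef-beyond t [] (suc i) _ = refl
    coef-beyond t (a ∷ as) (suc i) (s≤s lt) = coef-beyond t as i lt

    coef-beyond₀ : ∀ {k} (as : Vec K k) i → k ≤ i → coef 0r as i ≡ 0r
    coef-beyond₀ [] zero _ = refl
    coef-beyond₀ [] (suc i) _ = refl
    coef-beyond₀ (a ∷ as) (suc i) (s≤s lt) = coef-beyond₀ as i lt

  private
    lookup-scaled-one-zero : ∀ {d} a → lookup (Vec.map (a *r_) (oneVec R (suc d))) zero ≡ a
    lookup-scaled-one-zero a = R.*-idʳ a

    lookup-scaled-one-suc : ∀ {d} a (i : Fin d) → lookup (Vec.map (a *r_) (oneVec R (suc d))) (suc i) ≡ 0r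
    lookup-scaled-one-suc {d} a i = trans (Vec.lookup-map i (a *r_) (tabulate (λ _ → 0r)))
      (trans (cong (a *r_) (Vec.lookup∘tabulate (λ _ → 0r) i)) (R.*-zeroʳ a))

    module _ {d : ℕ} (fl : Vec K (suc d)) (r : Vec K (suc d)) (a : K) where
      step : Vec K (suc d)
      step = zipWith _+r_ (Vec.map (a *r_) (oneVec R (suc d))) (xmul R fl r)

      lookup-xmul : ∀ i → lookup (xmul R fl r) i ≡ lookup (0r ∷ init r) i +r (last r *r lookup fl i)
      lookup-xmul i = trans (Vec.lookup-zipWith _+r_ i (0r ∷ init r) (Vec.map (λ f → Ops.⊖_ R (last r *r f)) fl))
        (cong (lookup (0r ∷ init r) i +r_) (trans (Vec.lookup-map i (λ f → Ops.⊖_ R (last r *r f)) fl) (R.⊖-id (last r *r lookup fl i))))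

      lookup-step-zero : lookup step zero ≡ a +r (last r *r lookup fl zero)
      lookup-step-zero = trans (Vec.lookup-zipWith _+r_ zero (Vec.map (a *r_) (oneVec R (suc d))) (xmul R fl r))
        (cong₂ _+r_ (lookup-scaled-one-zero {d} a) (trans (lookup-xmul zero) (R.idˡ _)))

      lookup-step-suc : ∀ i → lookup step (suc i) ≡ lookup r (inject₁ i) +r (last r *r lookup fl (suc i))
      lookup-step-suc i = trans (Vec.lookup-zipWith _+r_ (suc i) (Vec.map (a *r_) (oneVec R (suc d))) (xmul R fl r))
        (trans (cong₂ _+r_ (lookup-scaled-one-suc a i) (trans (lookup-xmul (suc i)) (cong (_+r (last r *r lookup fl (suc i))) (lookup-init r i)))) (R.idˡ _))

    -- As long as the degree stays below n, the last coordinate is 0 before each multiplication by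
    -- X, so nothing is reduced and Horner's scheme writes down the coefficients. The start t · 1
    -- covers low (t = 0) and monic (t = 1) polynomials together.
    horner-coef : ∀ {n} (fl : Vec K n) t {k} (as : Vec K k) → (∀ i → n ≤ i → coef t as i ≡ 0r) →
      ∀ i → lookup (Horner.horner (vecModule ring n) (xmul R fl) (Vec.map (t *r_) (oneVec R n)) as (oneVec R n)) i ≡ coef t as (toℕ i)
    horner-coef {suc d} fl t [] small zero = lookup-scaled-one-zero {d} t
    horner-coef {suc d} fl t [] small (suc i) = lookup-scaled-one-suc t i
    horner-coef {suc d} fl t (a ∷ as) small i = go i
      where
      r : Vec K (suc d)
      r = Horner.horner (vecModule ring (suc d)) (xmul R fl) (Vec.map (t *r_) (oneVec R (suc d))) as (oneVec R (suc d))
      ih : ∀ i → lookup r i ≡ coef t as (toℕ i)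
      ih = horner-coef fl t as (λ i le → small (suc i) (ℕ.m≤n⇒m≤1+n le))
      last0 : last r ≡ 0r
      last0 = trans (last-lookup r) (trans (ih (fromℕ d)) (trans (cong (coef t as) (Fin.toℕ-fromℕ d)) (small (suc d) ℕ.≤-refl)))
      vanish : ∀ x → last r *r x ≡ 0r
      vanish x = trans (cong (_*r x) last0) (R.*-zeroˡ x)
      go : ∀ i → lookup (step fl r a) i ≡ coef t (a ∷ as) (toℕ i)
      go zero = trans (lookup-step-zero fl r a) (trans (cong (a +r_) (vanish _)) (R.idʳ a))
      go (suc i) = trans (lookup-step-suc fl r a i) (trans (cong₂ _+r_ (trans (ih (inject₁ i)) (cong (coef t as) (Fin.toℕ-inject₁ i))) (vanish _)) (R.idʳ _))

    -- Only the last multiplication by X reduces. Its argument has top coordinate 1, so the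
    -- reduction adds one copy of `fl`, which cancels the coefficients of f already present.
    monic-root : ∀ {n} (fl : Vec K n) → Horner.monic (vecModule ring n) (xmul R fl) fl (oneVec R n) ≡ replicate n 0r
    monic-root [] = refl
    monic-root {suc d} fl@(a ∷ as) = lookup-ext (λ i → trans (go i) (sym (Vec.lookup-replicate i 0r)))
      where
      r : Vec K (suc d)
      r = Horner.monic (vecModule ring (suc d)) (xmul R fl) as (oneVec R (suc d))
      ih : ∀ i → lookup r i ≡ coef 1r as (toℕ i)
      ih i = trans (cong (λ b → lookup (Horner.horner (vecModule ring (suc d)) (xmul R fl) b as (oneVec R (suc d))) i)
               (sym (Module₂.•-1 (vecModule ring (suc d)) (oneVec R (suc d)))))
               (horner-coef fl 1r as (λ i le → coef-beyond 1r as i le) i)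
      last1 : last r ≡ 1r
      last1 = trans (last-lookup r) (trans (ih (fromℕ d)) (trans (cong (coef 1r as) (Fin.toℕ-fromℕ d)) (coef-end 1r as)))
      unit : ∀ x → last r *r x ≡ x
      unit x = trans (cong (_*r x) last1) (R.*-idˡ x)
      go : ∀ i → lookup (step fl r a) i ≡ 0r
      go zero = trans (lookup-step-zero fl r a) (trans (cong (a +r_) (unit _)) (R.self a))
      go (suc i) = trans (lookup-step-suc fl r a i) (trans (cong₂ _+r_
        (trans (ih (inject₁ i)) (trans (cong (coef 1r as) (Fin.toℕ-inject₁ i)) (coef-lookup 1r as i))) (unit _)) (R.self _))

  -- The powers 1, X, ..., X^(n-1) are the standard basis; hence identities between polynomials in X
  -- need only be checked at `one`.
  low-basis : ∀ (as : Vec K n) → low as one ≡ as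
  low-basis as = lookup-ext (λ i → trans (cong (λ b → lookup (horner b as one) i) (sym (0•-zero ring M one)))
    (trans (horner-coef fl 0r as (λ i le → coef-beyond₀ as i le) i) (coef-lookup 0r as i)))

  monic-one : monic fl one ≡ 0v
  monic-one = monic-root fl

  monic-zero : ∀ w → monic fl w ≡ 0v
  monic-zero w = subst (λ v → monic fl v ≡ 0v) (low-basis w) (monic-low M xmul-linear fl w one monic-one)

  _*q_ : V → V → V
  a *q b = low a b

  quot-comm : ∀ a b → a *q b ≡ b *q a
  quot-comm a b = begin
    low a b ≡⟨ cong (low a) (low-basis b) ⟨
    low a (low b one) ≡⟨ low-comm M xmul-linear a b one ⟩
    low b (low a one) ≡⟨ cong (low b) (low-basis a) ⟩
    low b a ∎

  -- Multiplication by c is linear and commutes with X, so it commutes with the polynomial a in X.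
  quot-assoc : ∀ a b c → (a *q b) *q c ≡ a *q (b *q c)
  quot-assoc a b c = low-map M M (low-coef-linear M xmul-linear n c)
    (xmul-low M xmul-linear R.⊖-id fl c (monic-zero c)) a b

  quot-ring : IsRing₂ (Quot R n fl)
  quot-ring = record
    { group = group ; ⊖-id = λ _ → refl
    ; *-assoc = quot-assoc ; *-comm = quot-comm
    ; *-idˡ = λ b → low-one M xmul-linear fl b (monic-zero b)
    ; distribˡ = λ a → IsLinear.add (low-linear M xmul-linear a) }

  root : V
  root = X one

  root-mul : ∀ z → root *q z ≡ X z
  root-mul z = trans (quot-comm root z) (trans (low-X M xmul-linear z one) (cong X (low-basis z)))

  scale-mul : ∀ c a b → (c • a) *q b ≡ c • (a *q b)
  scale-mul c a b = IsLinear.scale (low-coef-linear M xmul-linear n b) c a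

private module B = IsRing₂ F2-ring

-- Determinants and the Cayley–Hamilton theorem

≡ᵇ-refl : ∀ n → (n ≡ᵇ n) ≡ true
≡ᵇ-refl zero = refl
≡ᵇ-refl (suc n) = ≡ᵇ-refl n

sumFin-cong : (R : Ops) → ∀ {k} {f g : Fin k → C R} → (∀ j → f j ≡ g j) → sumFin R f ≡ sumFin R g
sumFin-cong R {zero} e = refl
sumFin-cong R {suc k} e = cong₂ (_⊕_ R) (e zero) (sumFin-cong R (λ j → e (suc j)))

ΣB : ∀ {k} → (Fin k → Bool) → Bool
ΣB = sumFin F2

ΣB-zero : ∀ {k} {f : Fin k → Bool} → (∀ j → f j ≡ false) → ΣB f ≡ false
ΣB-zero {zero} e = refl
ΣB-zero {suc k} e = cong₂ _xor_ (e zero) (ΣB-zero (λ j → e (suc j)))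

ΣB-xor : ∀ {k} (f g : Fin k → Bool) → ΣB (λ j → f j xor g j) ≡ ΣB f xor ΣB g
ΣB-xor {zero} f g = refl
ΣB-xor {suc k} f g = trans (cong ((f zero xor g zero) xor_) (ΣB-xor (f ∘ suc) (g ∘ suc)))
  (B.interchange (f zero) (g zero) _ _)

ΣB-∧ : ∀ {k} a (f : Fin k → Bool) → ΣB (λ j → a ∧ f j) ≡ a ∧ ΣB f
ΣB-∧ {zero} a f = sym (Bool.∧-zeroʳ a)
ΣB-∧ {suc k} a f = trans (cong ((a ∧ f zero) xor_) (ΣB-∧ a (f ∘ suc))) (sym (B.distribˡ a (f zero) _))

ΣB-δ : ∀ {k} (i : Fin k) (f : Fin k → Bool) → ΣB (λ j → (toℕ i ≡ᵇ toℕ j) ∧ f j) ≡ f i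
ΣB-δ {suc k} zero f = trans (cong (f zero xor_) (ΣB-zero {k} (λ _ → refl))) (Bool.xor-identityʳ _)
ΣB-δ (suc i) f = ΣB-δ i (f ∘ suc)

sumFin-poly : ∀ {k} (f : Fin k → Poly F2) t → sumFin (PolyRing F2) f t ≡ ΣB (λ j → f j t)
sumFin-poly {zero} f t = refl
sumFin-poly {suc k} f t = cong (f zero t xor_) (sumFin-poly (f ∘ suc) t)

-- The cofactor sign of det is a private function of Defs; the metas in the
-- signatures below let unification refer to it. It is the identity since −x = x.
module _ (R : Ops) (⊖-id : ∀ x → ⊖_ R x ≡ x) where
  mutual
    det-expand : ∀ {k} (M : Fin (suc k) → Fin (suc k) → C R) →
      det R M ≡ sumFin R (λ j → _⊗_ R (M zero j) (det R (λ r s → M (suc r) (punchIn j s))))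
    det-expand {k} M = cong (_⊕_ R _) (sumFin-cong R {k} (cofactor M))

    cofactor : ∀ {k} (M : Fin (suc k) → Fin (suc k) → C R) (j : Fin k) → _ ≡
      _⊗_ R (M zero (suc j)) (det R (λ r s → M (suc r) (punchIn (suc j) s)))
    cofactor M j with toℕ j | M zero (suc j)
    ... | i | x = cong (λ y → _⊗_ R y (det R (λ r s → M (suc r) (punchIn (suc j) s)))) (sign M i x)

    sign : ∀ {k} (M : Fin (suc k) → Fin (suc k) → C R) (i : ℕ) (x : C R) → _ ≡ x
    sign M zero x = ⊖-id x
    sign M (suc zero) x = refl
    sign M (suc (suc i)) x = sign M i x

-- (a , b) stands for the linear polynomial a + bX.
Lin : Set
Lin = Bool × Bool

lin : Lin → Poly F2
lin (a , b) zero = a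
lin (a , b) (suc zero) = b
lin (a , b) (suc (suc k)) = false

linMul : Lin → Poly F2 → Poly F2
linMul (a , b) g zero = a ∧ g zero
linMul (a , b) g (suc k) = (a ∧ g (suc k)) xor (b ∧ g k)

mulP-lin : ∀ {g h h′ : Poly F2} l → (∀ k → g k ≡ lin l k) → (∀ k → h k ≡ h′ k) → ∀ k → mulP F2 g h k ≡ linMul l h′ k
mulP-lin (a , b) eg eh zero = cong₂ _∧_ (eg zero) (eh zero)
mulP-lin {g} {h} l@(a , b) eg eh (suc k) = trans (go k) (cong₂ _xor_ (cong₂ _∧_ (eg 0) (eh (suc k))) (cong₂ _∧_ (eg 1) (eh k)))
  where
  go : ∀ j → sumUpTo F2 (suc j) (λ i → g i ∧ h (suc k ∸ i)) ≡ (g 0 ∧ h (suc k)) xor (g 1 ∧ h k)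
  go zero = refl
  go (suc j) = trans (cong₂ _xor_ (go j) (cong (_∧ h (suc k ∸ suc (suc j))) (eg (suc (suc j))))) (Bool.xor-identityʳ _)

linMul-cong : ∀ l {g h} → (∀ k → g k ≡ h k) → ∀ k → linMul l g k ≡ linMul l h k
linMul-cong (a , b) e zero = cong (a ∧_) (e zero)
linMul-cong (a , b) e (suc k) = cong₂ _xor_ (cong (a ∧_) (e (suc k))) (cong (b ∧_) (e k))

linMul-xor : ∀ l g h k → linMul l (λ k → g k xor h k) k ≡ linMul l g k xor linMul l h k
linMul-xor (a , b) g h zero = B.distribˡ a _ _
linMul-xor (a , b) g h (suc k) = trans (cong₂ _xor_ (B.distribˡ a (g (suc k)) (h (suc k))) (B.distribˡ b (g k) (h k)))
  (B.interchange (a ∧ g (suc k)) _ _ _)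

linMul-zero : ∀ l k → linMul l (λ _ → false) k ≡ false
linMul-zero (a , b) zero = Bool.∧-zeroʳ a
linMul-zero (a , b) (suc k) = cong₂ _xor_ (Bool.∧-zeroʳ a) (Bool.∧-zeroʳ b)

private
  ∧-swap : ∀ a b c → a ∧ (b ∧ c) ≡ b ∧ (a ∧ c)
  ∧-swap a b c = trans (sym (Bool.∧-assoc a b c)) (trans (cong (_∧ c) (Bool.∧-comm a b)) (Bool.∧-assoc b a c))

linMul-comm : ∀ l l′ g k → linMul l (linMul l′ g) k ≡ linMul l′ (linMul l g) k
linMul-comm (a , b) (c , d) g zero = ∧-swap a c (g 0)
linMul-comm (a , b) (c , d) g (suc zero) = begin
  (a ∧ ((c ∧ g 1) xor (d ∧ g 0))) xor (b ∧ (c ∧ g 0)) ≡⟨ cong₂ _xor_ (B.distribˡ a (c ∧ g 1) (d ∧ g 0)) (∧-swap b c (g 0)) ⟩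
  ((a ∧ (c ∧ g 1)) xor (a ∧ (d ∧ g 0))) xor (c ∧ (b ∧ g 0))
    ≡⟨ cong (_xor (c ∧ (b ∧ g 0))) (cong₂ _xor_ (∧-swap a c (g 1)) (∧-swap a d (g 0))) ⟩
  ((c ∧ (a ∧ g 1)) xor (d ∧ (a ∧ g 0))) xor (c ∧ (b ∧ g 0)) ≡⟨ B.assoc (c ∧ (a ∧ g 1)) _ _ ⟩
  (c ∧ (a ∧ g 1)) xor ((d ∧ (a ∧ g 0)) xor (c ∧ (b ∧ g 0))) ≡⟨ cong ((c ∧ (a ∧ g 1)) xor_) (B.comm (d ∧ (a ∧ g 0)) _) ⟩
  (c ∧ (a ∧ g 1)) xor ((c ∧ (b ∧ g 0)) xor (d ∧ (a ∧ g 0))) ≡⟨ B.assoc (c ∧ (a ∧ g 1)) _ _ ⟨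
  ((c ∧ (a ∧ g 1)) xor (c ∧ (b ∧ g 0))) xor (d ∧ (a ∧ g 0)) ≡⟨ cong (_xor (d ∧ (a ∧ g 0))) (B.distribˡ c (a ∧ g 1) (b ∧ g 0)) ⟨
  (c ∧ ((a ∧ g 1) xor (b ∧ g 0))) xor (d ∧ (a ∧ g 0)) ∎
  where open ≡-Reasoning
linMul-comm (a , b) (c , d) g (suc (suc k)) = begin
  (a ∧ ((c ∧ x) xor (d ∧ y))) xor (b ∧ ((c ∧ y) xor (d ∧ z)))
    ≡⟨ cong₂ _xor_ (trans (B.distribˡ a (c ∧ x) (d ∧ y)) (cong₂ _xor_ (∧-swap a c x) (∧-swap a d y)))
                   (trans (B.distribˡ b (c ∧ y) (d ∧ z)) (cong₂ _xor_ (∧-swap b c y) (∧-swap b d z))) ⟩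
  ((c ∧ (a ∧ x)) xor (d ∧ (a ∧ y))) xor ((c ∧ (b ∧ y)) xor (d ∧ (b ∧ z))) ≡⟨ B.interchange (c ∧ (a ∧ x)) _ _ _ ⟩
  ((c ∧ (a ∧ x)) xor (c ∧ (b ∧ y))) xor ((d ∧ (a ∧ y)) xor (d ∧ (b ∧ z)))
    ≡⟨ cong₂ _xor_ (B.distribˡ c (a ∧ x) (b ∧ y)) (B.distribˡ d (a ∧ y) (b ∧ z)) ⟨
  (c ∧ ((a ∧ x) xor (b ∧ y))) xor (d ∧ ((a ∧ y) xor (b ∧ z))) ∎
  where
  open ≡-Reasoning
  x = g (suc (suc k))
  y = g (suc k)
  z = g k

-- An element of the exterior algebra on n generators over F₂[X], by its
-- coefficients at the subsets of the generators. Characteristic 2 makes the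
-- algebra commutative, so no signs occur.
Ext : ℕ → Set
Ext n = Vec Bool n → Poly F2

-- Multiplication by the vector Σ rᵢeᵢ: the coefficient at S is the sum over i in S of rᵢ times the
-- coefficient of F at S without i.
wedge : ∀ {n} → (Fin n → Lin) → Ext n → Ext n
wedge r F [] k = false
wedge r F (false ∷ S) k = wedge (r ∘ suc) (F ∘ (false ∷_)) S k
wedge r F (true ∷ S) k = wedge (r ∘ suc) (F ∘ (true ∷_)) S k xor linMul (r zero) (F (false ∷ S)) k

wedge-cong : ∀ {n} (r : Fin n → Lin) {F G : Ext n} → (∀ S k → F S k ≡ G S k) → ∀ S k → wedge r F S k ≡ wedge r G S k
wedge-cong r e [] k = refl
wedge-cong r e (false ∷ S) k = wedge-cong (r ∘ suc) (λ S → e (false ∷ S)) S k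
wedge-cong r e (true ∷ S) k = cong₂ _xor_ (wedge-cong (r ∘ suc) (λ S → e (true ∷ S)) S k) (linMul-cong (r zero) (e (false ∷ S)) k)

wedge-xor : ∀ {n} (r : Fin n → Lin) (F G : Ext n) S k →
  wedge r (λ S k → F S k xor G S k) S k ≡ wedge r F S k xor wedge r G S k
wedge-xor r F G [] k = refl
wedge-xor r F G (false ∷ S) k = wedge-xor (r ∘ suc) (F ∘ (false ∷_)) (G ∘ (false ∷_)) S k
wedge-xor r F G (true ∷ S) k = trans
  (cong₂ _xor_ (wedge-xor (r ∘ suc) (F ∘ (true ∷_)) (G ∘ (true ∷_)) S k) (linMul-xor (r zero) (F (false ∷ S)) (G (false ∷ S)) k))
  (B.interchange (wedge (r ∘ suc) (F ∘ (true ∷_)) S k) _ _ _)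

wedge-linMul : ∀ {n} (r : Fin n → Lin) l (F : Ext n) S k →
  wedge r (λ S → linMul l (F S)) S k ≡ linMul l (wedge r F S) k
wedge-linMul r l F [] k = sym (linMul-zero l k)
wedge-linMul r l F (false ∷ S) k = wedge-linMul (r ∘ suc) l (F ∘ (false ∷_)) S k
wedge-linMul r l F (true ∷ S) k = trans
  (cong₂ _xor_ (wedge-linMul (r ∘ suc) l (F ∘ (true ∷_)) S k) (linMul-comm (r zero) l (F (false ∷ S)) k))
  (sym (linMul-xor l (wedge (r ∘ suc) (F ∘ (true ∷_)) S) (linMul (r zero) (F (false ∷ S))) k))

-- Written so that the two mixed terms are visible: exchanging r and s swaps them, and for r = s
-- they cancel. This yields commutativity and vanishing squares.
wedge-wedge-true : ∀ {n} (r s : Fin (suc n) → Lin) (F : Ext (suc n)) S k → wedge r (wedge s F) (true ∷ S) k ≡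
  wedge (r ∘ suc) (wedge (s ∘ suc) (F ∘ (true ∷_))) S k xor
  (linMul (s zero) (wedge (r ∘ suc) (F ∘ (false ∷_)) S) k xor linMul (r zero) (wedge (s ∘ suc) (F ∘ (false ∷_)) S) k)
wedge-wedge-true r s F S k = trans
  (cong (_xor linMul (r zero) (wedge (s ∘ suc) (F ∘ (false ∷_)) S) k)
    (trans (wedge-xor (r ∘ suc) (wedge (s ∘ suc) (F ∘ (true ∷_))) (λ S → linMul (s zero) (F (false ∷ S))) S k)
           (cong (wedge (r ∘ suc) (wedge (s ∘ suc) (F ∘ (true ∷_))) S k xor_) (wedge-linMul (r ∘ suc) (s zero) (F ∘ (false ∷_)) S k))))
  (B.assoc (wedge (r ∘ suc) (wedge (s ∘ suc) (F ∘ (true ∷_))) S k) _ _)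

wedge-comm : ∀ {n} (r s : Fin n → Lin) (F : Ext n) S k → wedge r (wedge s F) S k ≡ wedge s (wedge r F) S k
wedge-comm r s F [] k = refl
wedge-comm r s F (false ∷ S) k = wedge-comm (r ∘ suc) (s ∘ suc) (F ∘ (false ∷_)) S k
wedge-comm r s F (true ∷ S) k = trans (wedge-wedge-true r s F S k) (trans
  (cong₂ _xor_ (wedge-comm (r ∘ suc) (s ∘ suc) (F ∘ (true ∷_)) S k)
               (B.comm (linMul (s zero) (wedge (r ∘ suc) (F ∘ (false ∷_)) S) k) _))
  (sym (wedge-wedge-true s r F S k)))

wedge-square : ∀ {n} (r : Fin n → Lin) (F : Ext n) S k → wedge r (wedge r F) S k ≡ false
wedge-square r F [] k = refl
wedge-square r F (false ∷ S) k = wedge-square (r ∘ suc) (F ∘ (false ∷_)) S k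
wedge-square r F (true ∷ S) k = trans (wedge-wedge-true r r F S k)
  (cong₂ _xor_ (wedge-square (r ∘ suc) (F ∘ (true ∷_)) S k) (Bool.xor-same (linMul (r zero) (wedge (r ∘ suc) (F ∘ (false ∷_)) S) k)))

wedge-zero : ∀ {n} (r : Fin n → Lin) S k → wedge r (λ _ _ → false) S k ≡ false
wedge-zero r [] k = refl
wedge-zero r (false ∷ S) k = wedge-zero (r ∘ suc) S k
wedge-zero r (true ∷ S) k = cong₂ _xor_ (wedge-zero (r ∘ suc) S k) (linMul-zero (r zero) k)

unitE : ∀ {n} → Ext n
unitE [] k = if k ≡ᵇ 0 then true else false
unitE (false ∷ S) k = unitE S k
unitE (true ∷ S) k = false

wedges : ∀ {k n} → (Fin k → Fin n → Lin) → Ext n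
wedges {zero} L = unitE
wedges {suc k} L = wedge (L zero) (wedges (L ∘ suc))

full : ∀ n → Vec Bool n
full n = replicate n true

-- `insertAt S j false` ranges over the subsets that avoid generator j. On them the coefficient of r
-- at j is never consulted, which is deletion of column j.
wedge-delete : ∀ {n} (j : Fin (suc n)) (r : Fin (suc n) → Lin) (F : Ext (suc n)) S k →
  wedge r F (insertAt S j false) k ≡ wedge (r ∘ punchIn j) (λ S → F (insertAt S j false)) S k
wedge-delete zero r F S k = refl
wedge-delete (suc j) r F (false ∷ S) k = wedge-delete j (r ∘ suc) (F ∘ (false ∷_)) S k
wedge-delete (suc j) r F (true ∷ S) k = cong (_xor linMul (r zero) (F (false ∷ insertAt S j false)) k)
  (wedge-delete j (r ∘ suc) (F ∘ (true ∷_)) S k)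

wedges-delete : ∀ {k n} (j : Fin (suc n)) (L : Fin k → Fin (suc n) → Lin) S t →
  wedges L (insertAt S j false) t ≡ wedges (λ i → L i ∘ punchIn j) S t
wedges-delete {zero} zero L S t = refl
wedges-delete {zero} (suc j) L (false ∷ S) t = wedges-delete {zero} j (λ ()) S t
wedges-delete {zero} (suc j) L (true ∷ S) t = refl
wedges-delete {suc k} j L S t = trans (wedge-delete j (L zero) (wedges (L ∘ suc)) S t)
  (wedge-cong (L zero ∘ punchIn j) (wedges-delete j (L ∘ suc)) S t)

-- Laplace expansion: r supplies generator j and F all the others.
wedge-full : ∀ {n} (r : Fin (suc n) → Lin) (F : Ext (suc n)) k →
  wedge r F (full (suc n)) k ≡ ΣB (λ j → linMul (r j) (F (insertAt (full n) j false)) k)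
wedge-full {zero} r F k = sym (Bool.xor-identityʳ _)
wedge-full {suc n} r F k = trans (cong (_xor linMul (r zero) (F (false ∷ full (suc n))) k)
  (wedge-full (r ∘ suc) (F ∘ (true ∷_)) k)) (Bool.xor-comm _ (linMul (r zero) (F (false ∷ full (suc n))) k))

-- `det` expands along its first row, as `wedges` does by `wedge-full`, and deleting a generator
-- produces the minors. Polynomials are functions, so equality is kept pointwise.
det-wedges : ∀ {k} (E : Fin k → Fin k → Poly F2) (L : Fin k → Fin k → Lin) → (∀ i j t → E i j t ≡ lin (L i j) t) →
  ∀ t → det (PolyRing F2) E t ≡ wedges L (full k) t
det-wedges {zero} E L e t = refl
det-wedges {suc k} E L e t = begin
  det (PolyRing F2) E t ≡⟨ cong (λ f → f t) (det-expand (PolyRing F2) (λ _ → refl) E) ⟩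
  sumFin (PolyRing F2) (λ j → mulP F2 (E zero j) (det (PolyRing F2) (λ r s → E (suc r) (punchIn j s)))) t
    ≡⟨ sumFin-poly (λ j → mulP F2 (E zero j) (det (PolyRing F2) (λ r s → E (suc r) (punchIn j s)))) t ⟩
  ΣB (λ j → mulP F2 (E zero j) (det (PolyRing F2) (λ r s → E (suc r) (punchIn j s))) t)
    ≡⟨ sumFin-cong F2 (λ j → mulP-lin (L zero j) (e zero j) (minor j) t) ⟩
  ΣB (λ j → linMul (L zero j) (wedges (L ∘ suc) (insertAt (full k) j false)) t) ≡⟨ wedge-full (L zero) (wedges (L ∘ suc)) t ⟨
  wedges L (full (suc k)) t ∎
  where
  open ≡-Reasoning
  minor : ∀ j t → det (PolyRing F2) (λ r s → E (suc r) (punchIn j s)) t ≡ wedges (L ∘ suc) (insertAt (full k) j false) t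
  minor j t = trans (det-wedges (λ r s → E (suc r) (punchIn j s)) (λ r s → L (suc r) (punchIn j s)) (λ r s → e (suc r) (punchIn j s)) t)
    (sym (wedges-delete j (L ∘ suc) (full k) t))

-- Commutativity moves the extra row next to its twin, where the square vanishes.
wedges-repeat : ∀ {k n} (L : Fin k → Fin n → Lin) i S t → wedge (L i) (wedges L) S t ≡ false
wedges-repeat L zero S t = wedge-square (L zero) (wedges (L ∘ suc)) S t
wedges-repeat L (suc i) S t = trans (wedge-comm (L (suc i)) (L zero) (wedges (L ∘ suc)) S t)
  (trans (wedge-cong (L zero) (wedges-repeat (L ∘ suc) i) S t) (wedge-zero (L zero) S t))

linMul-degree : ∀ l {g : Poly F2} {d} → (∀ t → d < t → g t ≡ false) → ∀ t → suc d < t → linMul l g t ≡ false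
linMul-degree (a , b) z (suc t) (s≤s lt) = cong₂ _xor_
  (trans (cong (a ∧_) (z (suc t) (ℕ.m<n⇒m<1+n lt))) (Bool.∧-zeroʳ a)) (trans (cong (b ∧_) (z t lt)) (Bool.∧-zeroʳ b))

wedge-degree : ∀ {n} (r : Fin n → Lin) {F : Ext n} {d} → (∀ S t → d < t → F S t ≡ false) →
  ∀ S t → suc d < t → wedge r F S t ≡ false
wedge-degree r z [] t lt = refl
wedge-degree r z (false ∷ S) t lt = wedge-degree (r ∘ suc) (λ S → z (false ∷ S)) S t lt
wedge-degree r z (true ∷ S) t lt = cong₂ _xor_ (wedge-degree (r ∘ suc) (λ S → z (true ∷ S)) S t lt)
  (linMul-degree (r zero) (z (false ∷ S)) t lt)

wedges-degree : ∀ {k n} (L : Fin k → Fin n → Lin) S t → k < t → wedges L S t ≡ false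
wedges-degree {zero} L [] (suc t) lt = refl
wedges-degree {zero} L (false ∷ S) t lt = wedges-degree {zero} (λ ()) S t lt
wedges-degree {zero} L (true ∷ S) t lt = refl
wedges-degree {suc k} L S t lt = wedge-degree (L zero) (wedges-degree (L ∘ suc)) S t lt

matApply : ∀ {k} → Mat k → Vec Bool k → Vec Bool k
matApply M v = tabulate λ i → ΣB (λ j → lookup (lookup M i) j ∧ lookup v j)

F2Vec : ℕ → Module₂ F2
F2Vec = vecModule F2-ring

matApply-linear : ∀ {k} (M : Mat k) → IsLinear (F2Vec k) (F2Vec k) (matApply M)
matApply-linear {k} M = record
  { add = λ v w → lookup-ext λ i → begin
      lookup (matApply M (zipWith _xor_ v w)) i ≡⟨ Vec.lookup∘tabulate _ i ⟩
      ΣB (λ j → lookup (lookup M i) j ∧ lookup (zipWith _xor_ v w) j)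
        ≡⟨ sumFin-cong F2 (λ j → trans (cong (lookup (lookup M i) j ∧_) (Vec.lookup-zipWith _xor_ j v w)) (B.distribˡ (lookup (lookup M i) j) _ _)) ⟩
      ΣB (λ j → (lookup (lookup M i) j ∧ lookup v j) xor (lookup (lookup M i) j ∧ lookup w j)) ≡⟨ ΣB-xor {k} _ _ ⟩
      ΣB (λ j → lookup (lookup M i) j ∧ lookup v j) xor ΣB (λ j → lookup (lookup M i) j ∧ lookup w j)
        ≡⟨ cong₂ _xor_ (Vec.lookup∘tabulate _ i) (Vec.lookup∘tabulate _ i) ⟨
      lookup (matApply M v) i xor lookup (matApply M w) i ≡⟨ Vec.lookup-zipWith _xor_ i (matApply M v) (matApply M w) ⟨
      lookup (zipWith _xor_ (matApply M v) (matApply M w)) i ∎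
  ; scale = λ a v → lookup-ext λ i → begin
      lookup (matApply M (Vec.map (a ∧_) v)) i ≡⟨ Vec.lookup∘tabulate _ i ⟩
      ΣB (λ j → lookup (lookup M i) j ∧ lookup (Vec.map (a ∧_) v) j)
        ≡⟨ sumFin-cong F2 (λ j → trans (cong (lookup (lookup M i) j ∧_) (Vec.lookup-map j (a ∧_) v)) (∧-swap (lookup (lookup M i) j) a _)) ⟩
      ΣB (λ j → a ∧ (lookup (lookup M i) j ∧ lookup v j)) ≡⟨ ΣB-∧ {k} a _ ⟩
      a ∧ ΣB (λ j → lookup (lookup M i) j ∧ lookup v j) ≡⟨ cong (a ∧_) (Vec.lookup∘tabulate _ i) ⟨
      a ∧ lookup (matApply M v) i ≡⟨ Vec.lookup-map i (a ∧_) (matApply M v) ⟨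
      lookup (Vec.map (a ∧_) (matApply M v)) i ∎ }
  where open ≡-Reasoning

module CharPoly {k : ℕ} (M : Mat k) where

  entry : Fin k → Fin k → Lin
  entry i j = lookup (lookup M i) j , (toℕ i ≡ᵇ toℕ j)

  charPoly-wedges : ∀ t → charPoly M t ≡ wedges entry (full k) t
  charPoly-wedges = det-wedges _ entry entry-eq
    where
    entry-eq : ∀ i j t → (if toℕ i ≡ᵇ toℕ j then varX F2 else (λ _ → false)) t xor constP F2 (lookup (lookup M i) j) t ≡ lin (entry i j) t
    entry-eq i j t with toℕ i ≡ᵇ toℕ j | t
    ... | true | zero = refl
    ... | true | suc zero = refl
    ... | true | suc (suc _) = refl
    ... | false | zero = refl
    ... | false | suc zero = refl
    ... | false | suc (suc _) = refl

-- The first-row cofactors have degree at most k, so X^(k+1) needs the factor X from the first row;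
-- that occurs only on the diagonal, and its cofactor is again of this form.
wedges-monic : ∀ {k} (T : Fin k → Fin k → Bool) → wedges (λ i j → T i j , (toℕ i ≡ᵇ toℕ j)) (full k) k ≡ true
wedges-monic {zero} T = refl
wedges-monic {suc k} T = begin
  wedge (L zero) (wedges (L ∘ suc)) (full (suc k)) (suc k) ≡⟨ wedge-full (L zero) (wedges (L ∘ suc)) (suc k) ⟩
  ΣB (λ j → linMul (L zero j) (D j) (suc k))
    ≡⟨ sumFin-cong F2 (λ j → cong (_xor ((0 ≡ᵇ toℕ j) ∧ D j k))
         (trans (cong (T zero j ∧_) (wedges-degree (L ∘ suc) (insertAt (full k) j false) (suc k) ℕ.≤-refl)) (Bool.∧-zeroʳ (T zero j)))) ⟩
  ΣB (λ j → (0 ≡ᵇ toℕ j) ∧ D j k) ≡⟨ ΣB-δ {suc k} zero (λ j → D j k) ⟩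
  D zero k ≡⟨ wedges-delete zero (L ∘ suc) (full k) k ⟩
  wedges (λ i j → T (suc i) (suc j) , (toℕ i ≡ᵇ toℕ j)) (full k) k ≡⟨ wedges-monic (λ i j → T (suc i) (suc j)) ⟩
  true ∎
  where
  open ≡-Reasoning
  L : Fin (suc k) → Fin (suc k) → Lin
  L i j = T i j , (toℕ i ≡ᵇ toℕ j)
  D : Fin (suc k) → Poly F2
  D j = wedges (L ∘ suc) (insertAt (full k) j false)

charPoly-monic : ∀ {k} (M : Mat k) → Monic F2 k (charPoly M)
charPoly-monic M = trans (charPoly-wedges _) (wedges-monic (λ i j → lookup (lookup M i) j)) , λ t lt → trans (charPoly-wedges t) (wedges-degree entry _ t lt)
  where open CharPoly M

-- The cofactors D_j of the first row satisfy (X − M) D = χ e₀ (the other rows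
-- give determinants with a repeated row); comparing coefficients of powers of X
-- telescopes to χ(M) e₀ = 0.
cayley-hamilton-e₀ : ∀ {k} (M : Mat k) →
  Horner.monic (F2Vec k) (matApply M) (lowCoeffs F2 k (charPoly M)) (oneVec F2 k) ≡ replicate k false
cayley-hamilton-e₀ {zero} M = refl
cayley-hamilton-e₀ {suc k} M = trans (cong (zipWith _xor_ (Vec.map (χ 0 ∧_) e₀)) (cong (matApply M) (tail-value k 0 refl))) base
  where
  open CharPoly M
  open ≡-Reasoning
  χ : Poly F2
  χ = charPoly M
  e₀ : Vec Bool (suc k)
  e₀ = oneVec F2 (suc k)
  D : Fin (suc k) → Poly F2
  D j = wedges (entry ∘ suc) (insertAt (full k) j false)
  Dv : ℕ → Vec Bool (suc k)
  Dv t = tabulate (λ j → D j t)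
  row : ∀ i t → ΣB (λ j → linMul (entry i j) (D j) t) ≡ χ t ∧ lookup e₀ i
  row zero t = begin
    ΣB (λ j → linMul (entry zero j) (D j) t) ≡⟨ wedge-full (entry zero) (wedges (entry ∘ suc)) t ⟨
    wedges entry (full (suc k)) t ≡⟨ charPoly-wedges t ⟨
    χ t ≡⟨ Bool.∧-identityʳ (χ t) ⟨
    χ t ∧ true ∎
  row (suc i) t = begin
    ΣB (λ j → linMul (entry (suc i) j) (D j) t) ≡⟨ wedge-full (entry (suc i)) (wedges (entry ∘ suc)) t ⟨
    wedge (entry (suc i)) (wedges (entry ∘ suc)) (full (suc k)) t ≡⟨ wedges-repeat (entry ∘ suc) i (full (suc k)) t ⟩
    false ≡⟨ Bool.∧-zeroʳ (χ t) ⟨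
    χ t ∧ false ≡⟨ cong (χ t ∧_) (Vec.lookup∘tabulate (λ _ → false) i) ⟨
    χ t ∧ lookup e₀ (suc i) ∎
  apply-D : ∀ t i → lookup (matApply M (Dv t)) i ≡ ΣB (λ j → lookup (lookup M i) j ∧ D j t)
  apply-D t i = trans (Vec.lookup∘tabulate (λ i → ΣB (λ j → lookup (lookup M i) j ∧ lookup (Dv t) j)) i) (sumFin-cong F2 (λ j → cong (lookup (lookup M i) j ∧_) (Vec.lookup∘tabulate (λ j → D j t) j)))
  base : zipWith _xor_ (Vec.map (χ 0 ∧_) e₀) (matApply M (Dv 0)) ≡ replicate (suc k) false
  base = lookup-ext λ i → begin
    lookup (zipWith _xor_ (Vec.map (χ 0 ∧_) e₀) (matApply M (Dv 0))) i ≡⟨ Vec.lookup-zipWith _xor_ i (Vec.map (χ 0 ∧_) e₀) (matApply M (Dv 0)) ⟩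
    lookup (Vec.map (χ 0 ∧_) e₀) i xor lookup (matApply M (Dv 0)) i ≡⟨ cong₂ _xor_ (Vec.lookup-map i (χ 0 ∧_) e₀) (trans (apply-D 0 i) (row i 0)) ⟩
    (χ 0 ∧ lookup e₀ i) xor (χ 0 ∧ lookup e₀ i) ≡⟨ Bool.xor-same (χ 0 ∧ lookup e₀ i) ⟩
    false ≡⟨ Vec.lookup-replicate i false ⟨
    lookup (replicate (suc k) false) i ∎
  step : ∀ t → zipWith _xor_ (Vec.map (χ (suc t) ∧_) e₀) (matApply M (Dv (suc t))) ≡ Dv t
  step t = lookup-ext λ i → begin
    lookup (zipWith _xor_ (Vec.map (χ (suc t) ∧_) e₀) (matApply M (Dv (suc t)))) i
      ≡⟨ Vec.lookup-zipWith _xor_ i (Vec.map (χ (suc t) ∧_) e₀) (matApply M (Dv (suc t))) ⟩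
    lookup (Vec.map (χ (suc t) ∧_) e₀) i xor lookup (matApply M (Dv (suc t))) i
      ≡⟨ cong₂ _xor_ (trans (Vec.lookup-map i (χ (suc t) ∧_) e₀) (trans (sym (row i (suc t))) (ΣB-xor (λ j → lookup (lookup M i) j ∧ D j (suc t)) (λ j → (toℕ i ≡ᵇ toℕ j) ∧ D j t)))) (apply-D (suc t) i) ⟩
    (ΣB (λ j → lookup (lookup M i) j ∧ D j (suc t)) xor ΣB (λ j → (toℕ i ≡ᵇ toℕ j) ∧ D j t)) xor ΣB (λ j → lookup (lookup M i) j ∧ D j (suc t))
      ≡⟨ B.comm (ΣB (λ j → lookup (lookup M i) j ∧ D j (suc t)) xor ΣB (λ j → (toℕ i ≡ᵇ toℕ j) ∧ D j t)) _ ⟩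
    ΣB (λ j → lookup (lookup M i) j ∧ D j (suc t)) xor (ΣB (λ j → lookup (lookup M i) j ∧ D j (suc t)) xor ΣB (λ j → (toℕ i ≡ᵇ toℕ j) ∧ D j t))
      ≡⟨ B.cancelˡ (ΣB (λ j → lookup (lookup M i) j ∧ D j (suc t))) _ ⟩
    ΣB (λ j → (toℕ i ≡ᵇ toℕ j) ∧ D j t) ≡⟨ ΣB-δ i (λ j → D j t) ⟩
    D i t ≡⟨ Vec.lookup∘tabulate (λ j → D j t) i ⟨
    lookup (Dv t) i ∎
  Dv-top : Dv (suc k) ≡ replicate (suc k) false
  Dv-top = lookup-ext λ i → trans (Vec.lookup∘tabulate (λ j → D j (suc k)) i)
    (trans (wedges-degree (entry ∘ suc) (insertAt (full k) i false) (suc k) ℕ.≤-refl) (sym (Vec.lookup-replicate i false)))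
  lead : e₀ ≡ Dv k
  lead = begin
    e₀ ≡⟨ Module₂.idʳ (F2Vec (suc k)) e₀ ⟨
    zipWith _xor_ e₀ (replicate (suc k) false) ≡⟨ cong₂ (zipWith _xor_)
      (sym (trans (cong (λ c → Vec.map (c ∧_) e₀) (proj₁ (charPoly-monic M))) (Module₂.•-1 (F2Vec (suc k)) e₀)))
      (sym (trans (cong (matApply M) Dv-top) (IsLinear.zero-map (matApply-linear M)))) ⟩
    zipWith _xor_ (Vec.map (χ (suc k) ∧_) e₀) (matApply M (Dv (suc k))) ≡⟨ step k ⟩
    Dv k ∎
  -- Horner's scheme, run from the leading coefficient down, passes through the coefficient vectors
  -- `Dv k`, ..., `Dv 0`: it starts at `lead` and each stage is `step`. What remains after `Dv 0` is
  -- `base`.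
  tail-value : ∀ l s → s + l ≡ k →
    Horner.monic (F2Vec (suc k)) (matApply M) (tabulate {n = l} (λ i → χ (suc (s + toℕ i)))) e₀ ≡ Dv s
  tail-value zero s e = trans lead (cong Dv (trans (sym e) (ℕ.+-identityʳ s)))
  tail-value (suc l) s e = begin
    zipWith _xor_ (Vec.map (χ (suc (s + 0)) ∧_) e₀) (matApply M (Horner.monic (F2Vec (suc k)) (matApply M) (tabulate {n = l} (λ i → χ (suc (s + suc (toℕ i))))) e₀))
      ≡⟨ cong₂ (λ c v → zipWith _xor_ (Vec.map (χ (suc c) ∧_) e₀) (matApply M v)) (ℕ.+-identityʳ s)
           (trans (cong (λ u → Horner.monic (F2Vec (suc k)) (matApply M) u e₀) (Vec.tabulate-cong {n = l} (λ i → cong (χ ∘ suc) (ℕ.+-suc s (toℕ i)))))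
                  (tail-value l (suc s) (trans (sym (ℕ.+-suc s l)) e))) ⟩
    zipWith _xor_ (Vec.map (χ (suc s) ∧_) e₀) (matApply M (Dv (suc s))) ≡⟨ step s ⟩
    Dv s ∎

-- Irreducibility from the order of X

module ProductAction {R : Ops} (ring : IsRing₂ R) where
  open Ops R using () renaming (C to K; 0# to 0r; 1# to 1r; _⊕_ to _+r_; _⊗_ to _*r_)
  private module R = IsRing₂ ring
  open HornerProperties ring

  sumUpTo-cong : ∀ k {f g : ℕ → K} → (∀ i → i ≤ k → f i ≡ g i) → sumUpTo R k f ≡ sumUpTo R k g
  sumUpTo-cong zero e = e 0 z≤n
  sumUpTo-cong (suc k) e = cong₂ _+r_ (sumUpTo-cong k (λ i le → e i (ℕ.m≤n⇒m≤1+n le))) (e (suc k) ℕ.≤-refl)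

  -- This is gh = h₀g + X · g · (h - h₀)/X, the recursion on the second factor that the convolution
  -- sum hides.
  mulP-suc : ∀ g h k → mulP R g h (suc k) ≡ mulP R g (h ∘ suc) k +r (g (suc k) *r h 0)
  mulP-suc g h k = cong₂ _+r_ (sumUpTo-cong k (λ i le → cong (λ j → g i *r h j) (ℕ.+-∸-assoc 1 le)))
    (cong (λ j → g (suc k) *r h j) (ℕ.n∸n≡0 k))

  mulP-zeroʳ : ∀ g h → (∀ i → h i ≡ 0r) → ∀ k → mulP R g h k ≡ 0r
  mulP-zeroʳ g h z zero = trans (cong (g 0 *r_) (z 0)) (R.*-zeroʳ _)
  mulP-zeroʳ g h z (suc k) = trans (mulP-suc g h k) (trans (cong₂ _+r_ (mulP-zeroʳ g (h ∘ suc) (λ i → z (suc i)) k)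
    (trans (cong (g (suc k) *r_) (z 0)) (R.*-zeroʳ _))) (R.idˡ 0r))

  mulP-lead : ∀ a b g h → (∀ i → a < i → g i ≡ 0r) → (∀ i → b < i → h i ≡ 0r) → mulP R g h (a + b) ≡ g a *r h b
  mulP-lead zero zero g h zg zh = refl
  mulP-lead (suc a) zero g h zg zh rewrite ℕ.+-identityʳ a = trans (mulP-suc g h a)
    (trans (cong (_+r (g (suc a) *r h 0)) (mulP-zeroʳ g (h ∘ suc) (λ i → zh (suc i) (s≤s z≤n)) a)) (R.idˡ _))
  mulP-lead a (suc b) g h zg zh rewrite ℕ.+-suc a b = trans (mulP-suc g h (a + b))
    (trans (cong₂ _+r_ (mulP-lead a b g (h ∘ suc) zg (λ i lt → zh (suc i) (s≤s lt)))
      (trans (cong (_*r h 0) (zg (suc (a + b)) (s≤s (ℕ.m≤m+n a b)))) (R.*-zeroˡ _))) (R.idʳ _))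

  module _ (M : Module₂ R) {X : Module₂.V M → Module₂.V M} (linX : IsLinear M M X) where
    open Module₂ M
    open Horner M X
    open ≡-Reasoning

    low-vanish : ∀ k g w → (∀ i → g i ≡ 0r) → low (lowCoeffs R k g) w ≡ 0v
    low-vanish zero g w z = refl
    low-vanish (suc k) g w z = trans (cong₂ _+v_ (trans (cong (_• w) (z 0)) (0•-zero ring M w))
      (trans (cong X (low-vanish k (g ∘ suc) w (λ i → z (suc i)))) (IsLinear.zero-map linX))) (idˡ 0v)

    low-extend : ∀ k j g w → (∀ i → k ≤ i → g i ≡ 0r) → low (lowCoeffs R (k + j) g) w ≡ low (lowCoeffs R k g) w
    low-extend zero j g w z = low-vanish j g w (λ i → z i z≤n)
    low-extend (suc k) j g w z = cong (λ v → g 0 • w +v X v) (low-extend k j (g ∘ suc) w (λ i le → z (suc i) (s≤s le)))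

    -- Coefficient d is the leading 1, and the j after it are zeros.
    low-monic : ∀ d j f w → Monic R d f → low (lowCoeffs R (d + suc j) f) w ≡ monic (lowCoeffs R d f) w
    low-monic zero j f w (l , z) = begin
      f 0 • w +v X (low (lowCoeffs R j (f ∘ suc)) w) ≡⟨ cong₂ _+v_ (trans (cong (_• w) l) (•-1 w))
        (trans (cong X (low-vanish j (f ∘ suc) w (λ i → z (suc i) (s≤s z≤n)))) (IsLinear.zero-map linX)) ⟩
      w +v 0v ≡⟨ idʳ w ⟩
      w ∎
    low-monic (suc d) j f w (l , z) = cong (λ v → f 0 • w +v X v)
      (low-monic d j (f ∘ suc) w (l , λ i lt → z (suc i) (s≤s lt)))

    -- Induction on the second factor by `mulP-suc`, with the scalar h₀ and X commuting past g. The
    -- lengths a and b only bound the degrees, which allows padding with zeros.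
    low-mulP : ∀ b a g h w → (∀ i → a ≤ i → g i ≡ 0r) → (∀ i → b ≤ i → h i ≡ 0r) →
      low (lowCoeffs R (a + b) (mulP R g h)) w ≡ low (lowCoeffs R a g) (low (lowCoeffs R b h) w)
    low-mulP zero a g h w zg zh = trans (low-vanish (a + 0) (mulP R g h) w (mulP-zeroʳ g h (λ i → zh i z≤n)))
      (sym (IsLinear.zero-map (low-linear M linX (lowCoeffs R a g))))
    low-mulP (suc b) a g h w zg zh = begin
      low (lowCoeffs R (a + suc b) (mulP R g h)) w ≡⟨ cong (λ k → low (lowCoeffs R k (mulP R g h)) w) (ℕ.+-suc a b) ⟩
      (g 0 *r h 0) • w +v X (low (lowCoeffs R (a + b) (mulP R g h ∘ suc)) w)
        ≡⟨ cong₂ (λ u v → u +v X v) (trans (cong (_• w) (R.*-comm (g 0) (h 0))) (•-* (h 0) (g 0) w)) shifted ⟩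
      h 0 • (g 0 • w) +v X (P +v h 0 • Q) ≡⟨ cong (h 0 • (g 0 • w) +v_) (trans (IsLinear.add linX _ _) (trans (comm _ _) (cong (_+v X P) (IsLinear.scale linX _ _)))) ⟩
      h 0 • (g 0 • w) +v (h 0 • X Q +v X P) ≡⟨ assoc _ _ _ ⟨
      (h 0 • (g 0 • w) +v h 0 • X Q) +v X P ≡⟨ cong₂ _+v_ (sym (•-+v (h 0) _ _)) (cong X (low-mulP b a g (h ∘ suc) w zg (λ i le → zh (suc i) (s≤s le)))) ⟩
      h 0 • low (lowCoeffs R (suc (a + b)) g) w +v X (low G (low H w))
        ≡⟨ cong₂ _+v_ (cong (h 0 •_) (trans (cong (λ k → low (lowCoeffs R k g) w) (sym (ℕ.+-suc a b))) (low-extend a (suc b) g w zg))) (sym (low-X M linX G (low H w))) ⟩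
      h 0 • low G w +v low G (X (low H w)) ≡⟨ cong (_+v low G (X (low H w))) (IsLinear.scale (low-linear M linX G) (h 0) w) ⟨
      low G (h 0 • w) +v low G (X (low H w)) ≡⟨ IsLinear.add (low-linear M linX G) _ _ ⟨
      low G (h 0 • w +v X (low H w)) ∎
      where
      G = lowCoeffs R a g
      H = lowCoeffs R b (h ∘ suc)
      P = low (lowCoeffs R (a + b) (mulP R g (h ∘ suc))) w
      Q = low (lowCoeffs R (a + b) (g ∘ suc)) w
      coefs : lowCoeffs R (a + b) (mulP R g h ∘ suc) ≡
        zipWith _+r_ (lowCoeffs R (a + b) (mulP R g (h ∘ suc))) (Vec.map (h 0 *r_) (lowCoeffs R (a + b) (g ∘ suc)))
      coefs = lookup-ext λ i → begin
        lookup (lowCoeffs R (a + b) (mulP R g h ∘ suc)) i ≡⟨ Vec.lookup∘tabulate (mulP R g h ∘ suc ∘ toℕ) i ⟩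
        mulP R g h (suc (toℕ i)) ≡⟨ mulP-suc g h (toℕ i) ⟩
        mulP R g (h ∘ suc) (toℕ i) +r (g (suc (toℕ i)) *r h 0) ≡⟨ cong (mulP R g (h ∘ suc) (toℕ i) +r_) (R.*-comm _ _) ⟩
        mulP R g (h ∘ suc) (toℕ i) +r (h 0 *r g (suc (toℕ i)))
          ≡⟨ cong₂ _+r_ (Vec.lookup∘tabulate (mulP R g (h ∘ suc) ∘ toℕ) i)
               (trans (Vec.lookup-map i (h 0 *r_) (lowCoeffs R (a + b) (g ∘ suc))) (cong (h 0 *r_) (Vec.lookup∘tabulate (g ∘ suc ∘ toℕ) i))) ⟨
        lookup (lowCoeffs R (a + b) (mulP R g (h ∘ suc))) i +r lookup (Vec.map (h 0 *r_) (lowCoeffs R (a + b) (g ∘ suc))) i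
          ≡⟨ Vec.lookup-zipWith _+r_ i (lowCoeffs R (a + b) (mulP R g (h ∘ suc))) _ ⟨
        lookup (zipWith _+r_ (lowCoeffs R (a + b) (mulP R g (h ∘ suc))) (Vec.map (h 0 *r_) (lowCoeffs R (a + b) (g ∘ suc)))) i ∎
      shifted : low (lowCoeffs R (a + b) (mulP R g h ∘ suc)) w ≡ P +v h 0 • Q
      shifted = begin
        low (lowCoeffs R (a + b) (mulP R g h ∘ suc)) w
          ≡⟨ cong (λ u → low u w) coefs ⟩
        low (zipWith _+r_ (lowCoeffs R (a + b) (mulP R g (h ∘ suc))) (Vec.map (h 0 *r_) (lowCoeffs R (a + b) (g ∘ suc)))) w
          ≡⟨ IsLinear.add (low-coef-linear M linX (a + b) w) (lowCoeffs R (a + b) (mulP R g (h ∘ suc))) _ ⟩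
        P +v low (Vec.map (h 0 *r_) (lowCoeffs R (a + b) (g ∘ suc))) w
          ≡⟨ cong (P +v_) (IsLinear.scale (low-coef-linear M linX (a + b) w) (h 0) (lowCoeffs R (a + b) (g ∘ suc))) ⟩
        P +v h 0 • Q ∎

Domain : Ops → Set
Domain R = ∀ {a b} → _⊗_ R a b ≡ 0# R → (a ≡ 0# R) ⊎ (b ≡ 0# R)

oneVec≢0 : (R : Ops) → 1# R ≢ 0# R → ∀ {d} → 1 ≤ d → oneVec R d ≢ replicate d (0# R)
oneVec≢0 R ne {suc d} _ e = ne (cong Vec.head e)

-- In a factorisation f = gh with both degrees positive, h is a power of X modulo
-- f, so g annihilates a power of X although g is nonzero modulo f.
order⇒irreducible : {R : Ops} → IsRing₂ R → DecidableEquality (C R) → Domain R → 1# R ≢ 0# R →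
  ∀ {d N} f → 1 ≤ d → 0 < N → Size (Vec (C R) d) (suc N) → Monic R d f →
  HasOrder (oneVec R d) (xmul R (lowCoeffs R d f)) N → Irreducible R d f
order⇒irreducible {R} ring _≟_ dom 1≢0 {d} {N} f 1≤d 0<N size mon ord = 1≤d , split
  where
  open ProductAction ring
  open HornerProperties ring
  open QuotProperties ring d (lowCoeffs R d f)
  open Module₂ M using (V; 0v)
  open Horner M X
  one≢0 : one ≢ 0v
  one≢0 = oneVec≢0 R 1≢0 1≤d
  X0 : X 0v ≡ 0v
  X0 = IsLinear.zero-map xmul-linear
  cover : ∀ v → v ≢ 0v → ∃[ k ] (k < N) × (v ≡ iter X k one)
  cover = orbit-cover 0<N X0 ord (Vec.≡-dec _≟_) size one≢0
  nonzero : ∀ g e → g e ≢ 0# R → e < d → lowCoeffs R d g ≢ 0v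
  nonzero g e ne lt z = ne (begin
    g e ≡⟨ cong g (Fin.toℕ-fromℕ< lt) ⟨
    g (toℕ (fromℕ< lt)) ≡⟨ Vec.lookup∘tabulate (g ∘ toℕ) (fromℕ< lt) ⟨
    lookup (lowCoeffs R d g) (fromℕ< lt) ≡⟨ cong (λ v → lookup v (fromℕ< lt)) z ⟩
    lookup 0v (fromℕ< lt) ≡⟨ Vec.lookup-replicate (fromℕ< lt) (0# R) ⟩
    0# R ∎)
    where open ≡-Reasoning
  low-iter : ∀ {l} (as : Vec (C R) l) k w → low as (iter X k w) ≡ iter X k (low as w)
  low-iter as k w = iter-map (low as) (low-X M xmul-linear as) k w
  degrees : ∀ g h e₁ e₂ → IsDeg R g (suc e₁) → IsDeg R h (suc e₂) → (∀ k → f k ≡ mulP R g h k) → (suc e₁ < d) × (suc e₂ < d)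
  degrees g h e₁ e₂ (g≢ , zg) (h≢ , zh) eq =
    ℕ.≤-trans (ℕ.m<m+n (suc e₁) (s≤s z≤n)) sum≤ , ℕ.≤-trans (ℕ.m<n+m (suc e₂) (s≤s z≤n)) sum≤
    where
    lead≢0 : f (suc e₁ + suc e₂) ≢ 0# R
    lead≢0 z with dom (trans (sym (mulP-lead (suc e₁) (suc e₂) g h zg zh)) (trans (sym (eq _)) z))
    ... | inj₁ q = g≢ q
    ... | inj₂ q = h≢ q
    sum≤ : suc e₁ + suc e₂ ≤ d
    sum≤ = ℕ.≮⇒≥ (λ lt → lead≢0 (proj₂ mon _ lt))
  proper : ∀ g h e₁ e₂ → IsDeg R g (suc e₁) → IsDeg R h (suc e₂) → (∀ k → f k ≡ mulP R g h k) → ⊥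
  proper g h e₁ e₂ dg@(g≢ , zg) dh@(h≢ , zh) eq with degrees g h e₁ e₂ dg dh eq
  ... | g<d , h<d with cover _ (nonzero g (suc e₁) g≢ g<d) | cover _ (nonzero h (suc e₂) h≢ h<d)
  ... | k , _ , gk | l , _ , hl = orbit-≢ 0<N X0 ord one≢0 (l + k) (begin
    iter X (l + k) one ≡⟨ iter-+ X l k one ⟩
    iter X l (iter X k one) ≡⟨ cong (iter X l) (sym gk) ⟩
    iter X l G ≡⟨ cong (iter X l) (low-basis G) ⟨
    iter X l (low G one) ≡⟨ low-iter G l one ⟨
    low G (iter X l one) ≡⟨ cong (low G) (trans (sym hl) (sym (low-basis H))) ⟩
    low G (low H one) ≡⟨ low-mulP M xmul-linear d d g h one (λ i le → zg i (ℕ.<-≤-trans g<d le)) (λ i le → zh i (ℕ.<-≤-trans h<d le)) ⟨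
    low (lowCoeffs R (d + d) (mulP R g h)) one ≡⟨ cong (λ u → low u one) (Vec.tabulate-cong {n = d + d} (λ i → sym (eq (toℕ i)))) ⟩
    low (lowCoeffs R (d + d) f) one ≡⟨ cong (λ j → low (lowCoeffs R (d + j) f) one) (sym (ℕ.m+[n∸m]≡n 1≤d)) ⟩
    low (lowCoeffs R (d + suc (d ∸ 1)) f) one ≡⟨ low-monic M xmul-linear d (d ∸ 1) f one mon ⟩
    monic (lowCoeffs R d f) one ≡⟨ monic-one ⟩
    0v ∎)
    where
    open ≡-Reasoning
    G = lowCoeffs R d g
    H = lowCoeffs R d h
  split : ∀ g h e₁ e₂ → IsDeg R g e₁ → IsDeg R h e₂ → (∀ k → f k ≡ mulP R g h k) → (e₁ ≡ 0) ⊎ (e₂ ≡ 0)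
  split g h zero e₂ _ _ _ = inj₁ refl
  split g h (suc e₁) zero _ _ _ = inj₂ refl
  split g h (suc e₁) (suc e₂) dg dh eq = ⊥-elim (proper g h e₁ e₂ dg dh eq)

-- Primitive characteristic polynomials and cyclic matrices

F2-domain : Domain F2
F2-domain {true} e = inj₂ e
F2-domain {false} e = inj₁ refl

Bool-Size : Size Bool 2
Bool-Size = (true ∷ false ∷ []) , refl , (((λ ()) ∷ []) ∷ ([] ∷ [])) , (λ _ _ → tt) ,
  λ { true _ → here refl ; false _ → there (here refl) }

suc-pred-2^ : ∀ n → suc (2 ^ n ∸ 1) ≡ 2 ^ n
suc-pred-2^ n = ℕ.m+[n∸m]≡n (ℕ.m^n>0 2 n)

abstract
  -- Written as N + 1 with N = 2^n - 1, the form in which the orbit lemmas count the zero vector and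
  -- one cycle.
  BoolVec-Size : ∀ n → Size (Vec Bool n) (suc (2 ^ n ∸ 1))
  BoolVec-Size n = subst (Size (Vec Bool n)) (sym (suc-pred-2^ n)) (Vec-Size Bool-Size n)

0<2^n∸1 : ∀ {n} → 1 ≤ n → 0 < 2 ^ n ∸ 1
0<2^n∸1 {n} le = ℕ.m<n⇒0<n∸m (ℕ.≤-trans (ℕ.≤-reflexive refl) (ℕ.^-monoʳ-≤ 2 le))

_≟v_ : ∀ {n} → DecidableEquality (Vec Bool n)
_≟v_ = Vec.≡-dec Bool._≟_

module _ {N : ℕ} (1≤N : 1 ≤ N) (M : Mat N) where
  private
    open HornerProperties F2-ring
    χ : Vec Bool N
    χ = lowCoeffs F2 N (charPoly M)
    module Q = QuotProperties F2-ring N χ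
    T : Vec Bool N → Vec Bool N
    T = matApply M
    e₀ : Vec Bool N
    e₀ = oneVec F2 N
    zv : Vec Bool N
    zv = replicate N false
    Φ : Vec Bool N → Vec Bool N
    Φ z = Horner.low (F2Vec N) T z e₀
    ΦX : ∀ z → Φ (xmul F2 χ z) ≡ T (Φ z)
    ΦX = xmul-low (F2Vec N) (matApply-linear M) (λ _ → refl) χ e₀ (cayley-hamilton-e₀ M)
    Φ1 : Φ e₀ ≡ e₀
    Φ1 = low-one (F2Vec N) (matApply-linear M) χ e₀ (cayley-hamilton-e₀ M)
    Φ-linear : IsLinear (F2Vec N) (F2Vec N) Φ
    Φ-linear = low-coef-linear (F2Vec N) (matApply-linear M) N e₀
    0<ord = 0<2^n∸1 1≤N
    e₀≢0 : e₀ ≢ zv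
    e₀≢0 = oneVec≢0 F2 (λ ()) 1≤N

  -- Evaluation z ↦ z(M)e₀ sends 1 to e₀ and is equivariant on F₂[X]/(χ) by Cayley-Hamilton at e₀.
  -- It carries the cycle of X to M.
  charPoly-primitive⇒cyclic : PrimitivePoly F2 2 N (charPoly M) → Cyclic zv T (2 ^ N ∸ 1)
  charPoly-primitive⇒cyclic (_ , _ , ord) = cyclic-forward _≟v_ _≟v_ 0<ord
    (IsLinear.zero-map Q.xmul-linear) (IsLinear.zero-map (matApply-linear M)) Φ ΦX
    (BoolVec-Size N) (BoolVec-Size N) (IsLinear.kernel⇒injective Φ-linear) ord e₀≢0 (λ e → e₀≢0 (trans (sym Φ1) e))

  -- The same evaluation pulls the order of e₀ under M back to the order of X modulo χ, and this
  -- order forces χ to be irreducible.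
  cyclic⇒charPoly-primitive : Cyclic zv T (2 ^ N ∸ 1) → PrimitivePoly F2 2 N (charPoly M)
  cyclic⇒charPoly-primitive cyc = charPoly-monic M ,
    order⇒irreducible F2-ring Bool._≟_ F2-domain (λ ()) (charPoly M) 1≤N 0<ord (BoolVec-Size N) (charPoly-monic M) ord , ord
    where
    ord : HasOrder e₀ (xmul F2 χ) (2 ^ N ∸ 1)
    ord = cyclic-backward _≟v_ _≟v_ 0<ord (IsLinear.zero-map Q.xmul-linear) (IsLinear.zero-map (matApply-linear M)) Φ ΦX
      (BoolVec-Size N) (IsLinear.zero-map Φ-linear) {e₀} (cyc (Φ e₀) (λ e → e₀≢0 (trans (sym Φ1) e))) (λ e → e₀≢0 (trans (sym Φ1) e)) e₀ e₀≢0

open HornerProperties F2-ring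
open ProductAction F2-ring

-- Division over F₂

lowPoly : ∀ {d} → Vec Bool d → Poly F2
lowPoly [] t = false
lowPoly (a ∷ as) zero = a
lowPoly (a ∷ as) (suc t) = lowPoly as t

monicVec : ∀ {d} → Vec Bool d → Poly F2
monicVec [] zero = true
monicVec [] (suc t) = false
monicVec (a ∷ as) zero = a
monicVec (a ∷ as) (suc t) = monicVec as t

lowPoly-xor : ∀ {d} (a b : Vec Bool d) t → lowPoly (zipWith _xor_ a b) t ≡ lowPoly a t xor lowPoly b t
lowPoly-xor [] [] t = refl
lowPoly-xor (x ∷ a) (y ∷ b) zero = refl
lowPoly-xor (x ∷ a) (y ∷ b) (suc t) = lowPoly-xor a b t

lowPoly-scale : ∀ {d} c (a : Vec Bool d) t → lowPoly (Vec.map (c ∧_) a) t ≡ c ∧ lowPoly a t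
lowPoly-scale c [] t = sym (Bool.∧-zeroʳ c)
lowPoly-scale c (x ∷ a) zero = refl
lowPoly-scale c (x ∷ a) (suc t) = lowPoly-scale c a t

monicVec-split : ∀ {d} (a : Vec Bool d) t → monicVec a t ≡ lowPoly a t xor (t ≡ᵇ d)
monicVec-split [] zero = refl
monicVec-split [] (suc t) = refl
monicVec-split (x ∷ a) zero = sym (Bool.xor-identityʳ x)
monicVec-split (x ∷ a) (suc t) = monicVec-split a t

lowPoly-init-last : ∀ {d} (z : Vec Bool (suc d)) t → lowPoly z t ≡ lowPoly (init z) t xor (last z ∧ (t ≡ᵇ d))
lowPoly-init-last (a ∷ []) zero = sym (Bool.∧-identityʳ a)
lowPoly-init-last (a ∷ []) (suc t) = sym (Bool.∧-zeroʳ a)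
lowPoly-init-last (a ∷ z@(b ∷ _)) zero = sym (trans (cong (a xor_) (Bool.∧-zeroʳ (last z))) (Bool.xor-identityʳ a))
lowPoly-init-last (a ∷ z@(_ ∷ _)) (suc t) = lowPoly-init-last z t

monicVec-degree : ∀ {d} (a : Vec Bool d) → IsDeg F2 (monicVec a) d
monicVec-degree [] = (λ ()) , λ { (suc k) _ → refl }
monicVec-degree (x ∷ a) = proj₁ (monicVec-degree a) , λ { (suc k) (s≤s lt) → proj₂ (monicVec-degree a) k lt }

monicVec-coeffs : ∀ d p → Monic F2 d p → ∀ t → p t ≡ monicVec (lowCoeffs F2 d p) t
monicVec-coeffs zero p (l , z) zero = l
monicVec-coeffs zero p (l , z) (suc t) = z (suc t) (s≤s z≤n)
monicVec-coeffs (suc d) p (l , z) zero = refl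
monicVec-coeffs (suc d) p (l , z) (suc t) = monicVec-coeffs d (p ∘ suc) (l , λ i lt → z (suc i) (s≤s lt)) t

-- Division is recorded twice. `acts`, on all modules at once, serves annihilators and the
-- substitution of field elements; `product` is the coefficient identity, since `Irreducible` speaks
-- of coefficient functions.
record Division {k e : ℕ} (h : Vec Bool (k + e)) (d : Vec Bool e) : Set₁ where
  field
    quotient : Vec Bool k
    remainder : Vec Bool e
    acts : (M : Module₂ F2) (let open Module₂ M) {X : V → V} (linX : IsLinear M M X) → ∀ w →
      Horner.monic M X h w ≡ Horner.monic M X quotient (Horner.monic M X d w) +v Horner.low M X remainder w
    product : ∀ t → monicVec h t ≡ mulP F2 (monicVec d) (monicVec quotient) t xor lowPoly remainder t

-- Long division by induction on the degree of the quotient: from h = ud + r′ one passes to a + Xh =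
-- Xud + (a + Xr′) and reduces once more. At equal degrees the quotient is 1 and the remainder h +
-- d.
divide : ∀ k {e} (h : Vec Bool (k + suc e)) (d : Vec Bool (suc e)) → Division {k} h d
divide zero {e} h d = record { quotient = [] ; remainder = zipWith _xor_ h d ; acts = acts ; product = product }
  where
  acts : (M : Module₂ F2) (let open Module₂ M) {X : V → V} (linX : IsLinear M M X) → ∀ w →
    Horner.monic M X h w ≡ Horner.monic M X d w +v Horner.low M X (zipWith _xor_ h d) w
  acts M {X} linX w = begin
    monic h w ≡⟨ horner-split M linX h w w ⟩
    low h w +v P ≡⟨ comm _ _ ⟩
    P +v low h w ≡⟨ cong (_+v low h w) (cancelˡ (low d w) P) ⟨
    (low d w +v (low d w +v P)) +v low h w ≡⟨ cong (λ u → (low d w +v u) +v low h w) (horner-split M linX d w w) ⟨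
    (low d w +v monic d w) +v low h w ≡⟨ cong (_+v low h w) (comm _ _) ⟩
    (monic d w +v low d w) +v low h w ≡⟨ assoc _ _ _ ⟩
    monic d w +v (low d w +v low h w) ≡⟨ cong (monic d w +v_) (trans (comm _ _) (sym (IsLinear.add (low-coef-linear M linX (suc e) w) h d))) ⟩
    monic d w +v low (zipWith _xor_ h d) w ∎
    where
    open Module₂ M
    open Horner M X
    open ≡-Reasoning
    P = iter X (suc e) w
  mulP-one : ∀ g t → mulP F2 g (monicVec []) t ≡ g t
  mulP-one g zero = Bool.∧-identityʳ (g 0)
  mulP-one g (suc t) = trans (mulP-suc g (monicVec []) t) (cong₂ _xor_ (mulP-zeroʳ g (λ _ → false) (λ _ → refl) t) (Bool.∧-identityʳ (g (suc t))))
  product : ∀ t → monicVec h t ≡ mulP F2 (monicVec d) (monicVec []) t xor lowPoly (zipWith _xor_ h d) t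
  product t = begin
    monicVec h t ≡⟨ monicVec-split h t ⟩
    H xor δ ≡⟨ B.comm H δ ⟩
    δ xor H ≡⟨ cong (_xor H) (B.cancelˡ D δ) ⟨
    (D xor (D xor δ)) xor H ≡⟨ cong (_xor H) (B.comm D (D xor δ)) ⟩
    ((D xor δ) xor D) xor H ≡⟨ B.assoc (D xor δ) D H ⟩
    (D xor δ) xor (D xor H) ≡⟨ cong₂ _xor_ (trans (sym (monicVec-split d t)) (sym (mulP-one (monicVec d) t))) (trans (B.comm D H) (sym (lowPoly-xor h d t))) ⟩
    mulP F2 (monicVec d) (monicVec []) t xor lowPoly (zipWith _xor_ h d) t ∎
    where
    open ≡-Reasoning
    H = lowPoly h t
    D = lowPoly d t
    δ = t ≡ᵇ suc e
divide (suc k) {e} (a ∷ h) d = record { quotient = l ∷ u ; remainder = r ; acts = acts ; product = product }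
  where
  module D = Division (divide k h d)
  u = D.quotient
  r′ = D.remainder
  l = last r′
  r : Vec Bool (suc e)
  -- X r′ overflows into `l` X^(e+1). In characteristic 2, X^(e+1) is the monic d plus its lower
  -- part, so `l` joins the quotient and `l` times the lower part joins the remainder.
  r = zipWith _xor_ (a ∷ init r′) (Vec.map (l ∧_) d)
  acts : (M : Module₂ F2) (let open Module₂ M) {X : V → V} (linX : IsLinear M M X) → ∀ w →
    Horner.monic M X (a ∷ h) w ≡ Horner.monic M X (l ∷ u) (Horner.monic M X d w) +v Horner.low M X r w
  acts M {X} linX w = begin
    a • w +v X (monic h w) ≡⟨ cong (λ v → a • w +v X v) (D.acts M linX w) ⟩
    a • w +v X (U +v low r′ w) ≡⟨ cong (a • w +v_) (trans (IsLinear.add linX U _) (cong (X U +v_) (trans (cong X (low-init-last M linX r′ w)) (trans (IsLinear.add linX _ _) (cong (X (low (init r′) w) +v_) (IsLinear.scale linX l _)))))) ⟩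
    a • w +v (X U +v (I +v l • P)) ≡⟨ trans (sym (assoc _ _ _)) (trans (cong (_+v (I +v l • P)) (comm _ _)) (assoc _ _ _)) ⟩
    X U +v (a • w +v (I +v l • P)) ≡⟨ cong (X U +v_) (sym (assoc _ _ _)) ⟩
    X U +v ((a • w +v I) +v l • P) ≡⟨ cong (X U +v_) (comm _ _) ⟩
    X U +v (l • P +v (a • w +v I)) ≡⟨ cong (λ v → X U +v (v +v (a • w +v I))) (trans (sym (cancelˡ (l • low d w) (l • P))) (trans (cong (l • low d w +v_) (trans (sym (•-+v l _ _)) (cong (l •_) (sym (horner-split M linX d w w))))) (comm _ _))) ⟩
    X U +v ((l • Dw +v l • low d w) +v (a • w +v I)) ≡⟨ cong (X U +v_) (assoc _ _ _) ⟩
    X U +v (l • Dw +v (l • low d w +v (a • w +v I))) ≡⟨ trans (sym (assoc _ _ _)) (cong₂ _+v_ (comm _ _) (comm _ _)) ⟩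
    (l • Dw +v X U) +v ((a • w +v I) +v l • low d w)
      ≡⟨ cong ((l • Dw +v X U) +v_) (trans (cong (low (a ∷ init r′) w +v_) (sym (IsLinear.scale (low-coef-linear M linX (suc e) w) l d)))
           (sym (IsLinear.add (low-coef-linear M linX (suc e) w) (a ∷ init r′) (Vec.map (l ∧_) d)))) ⟩
    monic (l ∷ u) Dw +v low r w ∎
    where
    open Module₂ M
    open Horner M X
    open ≡-Reasoning
    Dw = monic d w
    U = monic u Dw
    I = X (low (init r′) w)
    P = iter X (suc e) w
  product : ∀ t → monicVec (a ∷ h) t ≡ mulP F2 (monicVec d) (monicVec (l ∷ u)) t xor lowPoly r t
  product zero = begin
    a ≡⟨ B.cancelˡ (l ∧ d₀) a ⟨
    (l ∧ d₀) xor ((l ∧ d₀) xor a) ≡⟨ cong₂ _xor_ (trans (cong (l ∧_) (head-poly d)) (Bool.∧-comm l _)) (trans (B.comm (l ∧ d₀) a) (cong (a xor_) (sym (lowPoly-scale l d 0)))) ⟩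
    (monicVec d 0 ∧ l) xor (a xor lowPoly (Vec.map (l ∧_) d) 0) ≡⟨ cong ((monicVec d 0 ∧ l) xor_) (sym (lowPoly-xor (a ∷ init r′) (Vec.map (l ∧_) d) 0)) ⟩
    (monicVec d 0 ∧ l) xor lowPoly r 0 ∎
    where
    open ≡-Reasoning
    d₀ = lowPoly d 0
    head-poly : ∀ {e} (d : Vec Bool (suc e)) → lowPoly d 0 ≡ monicVec d 0
    head-poly (x ∷ _) = refl
  product (suc t) = begin
    monicVec h t ≡⟨ D.product t ⟩
    P xor lowPoly r′ t ≡⟨ cong (P xor_) (lowPoly-init-last r′ t) ⟩
    P xor (I xor (l ∧ δ)) ≡⟨ cong (λ x → P xor (I xor x)) (trans (sym (B.cancelˡ (l ∧ dl) (l ∧ δ))) (cong ((l ∧ dl) xor_) (trans (sym (B.distribˡ l dl δ)) (cong (l ∧_) (sym (monicVec-split d (suc t))))))) ⟩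
    P xor (I xor ((l ∧ dl) xor (l ∧ dm))) ≡⟨ cong (P xor_) (trans (sym (B.assoc I (l ∧ dl) (l ∧ dm))) (B.comm (I xor (l ∧ dl)) (l ∧ dm))) ⟩
    P xor ((l ∧ dm) xor (I xor (l ∧ dl))) ≡⟨ B.assoc P (l ∧ dm) _ ⟨
    (P xor (l ∧ dm)) xor (I xor (l ∧ dl)) ≡⟨ cong₂ _xor_ (trans (cong (P xor_) (Bool.∧-comm l dm)) (sym (mulP-suc (monicVec d) (monicVec (l ∷ u)) t)))
         (trans (cong (I xor_) (sym (lowPoly-scale l d (suc t)))) (sym (lowPoly-xor (a ∷ init r′) (Vec.map (l ∧_) d) (suc t)))) ⟩
    mulP F2 (monicVec d) (monicVec (l ∷ u)) (suc t) xor lowPoly r (suc t) ∎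
    where
    open ≡-Reasoning
    P = mulP F2 (monicVec d) (monicVec u) t
    I = lowPoly (init r′) t
    dl = lowPoly d (suc t)
    dm = monicVec d (suc t)
    δ = t ≡ᵇ e

vec-any? : {k : ℕ} {P : Vec Bool k → Set} → (∀ v → Dec (P v)) → Dec (∃ P)
vec-any? {k} {P} P? with Vec-Size Bool-Size k
... | L , _ , _ , _ , all with Any.any? P? L
... | yes p = yes (proj₁ (find p) , proj₂ (proj₂ (find p)))
... | no ¬p = no λ (v , q) → ¬p (lose (all v tt) q)

least : {P : ℕ → Set} → (∀ k → Dec (P k)) → ∀ n → P n → ∃[ k ] (k ≤ n) × P k × (∀ j → j < k → ¬ P j)
least P? zero p = 0 , z≤n , p , λ _ ()
least {P} P? (suc n) p with P? 0
... | yes p₀ = 0 , z≤n , p₀ , λ _ ()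
... | no ¬p₀ with least {P ∘ suc} (P? ∘ suc) n p
... | k , le , q , min = suc k , s≤s le , q , λ { zero _ → ¬p₀ ; (suc j) (s≤s lt) → min j lt }

module _ (M : Module₂ F2) {X : Module₂.V M → Module₂.V M} (linX : IsLinear M M X) where
  open Module₂ M
  open Horner M X

  -- Over F₂ the highest nonzero coefficient is 1, so dropping the zeros above it leaves a monic
  -- annihilator.
  normalize-annihilator : ∀ {k} (r : Vec Bool k) w → low r w ≡ 0v →
    (r ≡ replicate k false) ⊎ (∃[ j ] (j < k) × Σ (Vec Bool j) λ d → monic d w ≡ 0v)
  normalize-annihilator {zero} [] w e = inj₁ refl
  normalize-annihilator {suc k} r w e with last r in lastr | low-init-last M linX r w
  ... | true | s = inj₂ (k , ℕ.≤-refl , init r , trans (horner-split M linX (init r) w w)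
          (trans (cong (low (init r) w +v_) (sym (•-1 (iter X k w)))) (trans (sym s) e)))
  ... | false | s with normalize-annihilator (init r) w
          (trans (sym (idʳ _)) (trans (cong (low (init r) w +v_) (sym (0•-zero F2-ring M (iter X k w)))) (trans (sym s) e)))
  ... | inj₂ (j , lt , d , p) = inj₂ (j , ℕ.m<n⇒m<1+n lt , d , p)
  ... | inj₁ z = inj₁ (all-false r z lastr)
    where
    all-false : ∀ {k} (r : Vec Bool (suc k)) → init r ≡ replicate k false → last r ≡ false → r ≡ replicate (suc k) false
    all-false (x ∷ []) _ refl = refl
    all-false (x ∷ r@(_ ∷ _)) z l = cong₂ _∷_ (cong Vec.head z) (all-false r (cong Vec.tail z) l)

-- The monic polynomial of least degree annihilating a nonzero element of F₂[X]/(p)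
-- divides p, hence is p itself when p is irreducible.
irreducible⇒domain : ∀ {m p} → Monic F2 m p → Irreducible F2 m p → Domain (GF m p)
irreducible⇒domain {m} {p} mon irr {a} {b} ab≡0 with b ≟v replicate m false
... | yes b≡0 = inj₂ b≡0
... | no b≢0 = inj₁ (nonzero⇒ (minimal m p mon irr b b≢0))
  where
  Annihilated : ∀ m (p : Poly F2) → Vec Bool m → ℕ → Set
  Annihilated m p b e = Σ (Vec Bool e) λ d → Horner.monic (F2Vec m) (xmul F2 (lowCoeffs F2 m p)) d b ≡ replicate m false
  minimal : ∀ m p → Monic F2 m p → Irreducible F2 m p → (b : Vec Bool m) → b ≢ replicate m false → ∀ j → j < m → ¬ Annihilated m p b j
  minimal m p mon irr b b≢0 with least {Annihilated m p b} (λ e → vec-any? (λ d → _ ≟v _)) m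
      (lowCoeffs F2 m p , QuotProperties.monic-zero F2-ring m (lowCoeffs F2 m p) b)
  ... | zero , _ , ([] , b≡0) , _ = ⊥-elim (b≢0 b≡0)
  -- m is rewritten as k + (e + 1), the shape required for dividing p by the minimal annihilator d
  -- with a quotient of degree k. Irreducibility will then give k = 0, as d has positive degree.
  ... | suc e , le , (d , db) , min with m ∸ suc e | ℕ.m∸n+n≡m le
  ... | k | refl = λ j lt → min j (subst (j <_) k≡0 lt)
    where
    open QuotProperties F2-ring (k + suc e) (lowCoeffs F2 (k + suc e) p) using (xmul-linear; monic-zero)
    M : Module₂ F2
    M = F2Vec (k + suc e)
    open Module₂ M using (0v; _+v_; idˡ)
    open Horner M (xmul F2 (lowCoeffs F2 (k + suc e) p))
    module D = Division (divide k (lowCoeffs F2 (k + suc e) p) d)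
    rb : low D.remainder b ≡ 0v
    rb = begin
      low D.remainder b ≡⟨ idˡ _ ⟨
      0v +v low D.remainder b ≡⟨ cong (_+v low D.remainder b) (trans (horner-split M xmul-linear D.quotient 0v 0v)
             (trans (cong₂ _+v_ (IsLinear.zero-map (low-linear M xmul-linear D.quotient)) (iter-fixed _ k (IsLinear.zero-map xmul-linear))) (idˡ 0v))) ⟨
      monic D.quotient 0v +v low D.remainder b ≡⟨ cong (λ v → monic D.quotient v +v low D.remainder b) db ⟨
      monic D.quotient (monic d b) +v low D.remainder b ≡⟨ D.acts M xmul-linear b ⟨
      monic (lowCoeffs F2 (k + suc e) p) b ≡⟨ monic-zero b ⟩
      0v ∎
      where open ≡-Reasoning
    r≡0 : D.remainder ≡ replicate (suc e) false
    r≡0 with normalize-annihilator M xmul-linear D.remainder b rb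
    ... | inj₁ z = z
    ... | inj₂ (j , lt , q) = ⊥-elim (min j lt q)
    lowPoly-zero : ∀ e t → lowPoly (replicate e false) t ≡ false
    lowPoly-zero zero t = refl
    lowPoly-zero (suc e) zero = refl
    lowPoly-zero (suc e) (suc t) = lowPoly-zero e t
    factors : ∀ t → p t ≡ mulP F2 (monicVec d) (monicVec D.quotient) t
    factors t = trans (monicVec-coeffs _ p mon t) (trans (D.product t)
      (trans (cong (mulP F2 (monicVec d) (monicVec D.quotient) t xor_) (trans (cong (λ r → lowPoly r t) r≡0) (lowPoly-zero (suc e) t))) (Bool.xor-identityʳ _)))
    k≡0 : k + suc e ≡ suc e
    k≡0 with proj₂ irr (monicVec d) (monicVec D.quotient) (suc e) k (monicVec-degree d) (monicVec-degree D.quotient) factors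
    ... | inj₂ refl = refl
  nonzero⇒ : (∀ j → j < m → ¬ Annihilated m p b j) → a ≡ replicate m false
  -- The product ab is the polynomial a in X applied to b, so a is an annihilator of degree below m,
  -- hence zero.
  nonzero⇒ min with normalize-annihilator (F2Vec m) (QuotProperties.xmul-linear F2-ring m (lowCoeffs F2 m p)) a b ab≡0
  ... | inj₁ z = z
  ... | inj₂ (j , lt , q) = ⊥-elim (min j lt q)

-- Finite domains

module DomainTheory {R : Ops} (ring : IsRing₂ R) (dom : Domain R) (1≢0 : 1# R ≢ 0# R) where
  open Ops R using () renaming (C to K; 0# to 0r; 1# to 1r; _⊕_ to _+r_; _⊗_ to _*r_)
  private module R = IsRing₂ ring
  open ≡-Reasoning

  prodL : List K → K
  prodL = List.foldr _*r_ 1r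

  *-cancelˡ : ∀ {a b c} → a ≢ 0r → a *r b ≡ a *r c → b ≡ c
  *-cancelˡ {a} {b} {c} ne e with dom {a} {b +r c} (trans (R.distribˡ a b c) (R.≡⇒zero e))
  ... | inj₁ z = ⊥-elim (ne z)
  ... | inj₂ z = R.zero⇒≡ z

  prodL-++ : ∀ as x bs → prodL (as ++ x ∷ bs) ≡ x *r prodL (as ++ bs)
  prodL-++ [] x bs = refl
  prodL-++ (a ∷ as) x bs = trans (cong (a *r_) (prodL-++ as x bs))
    (trans (sym (R.*-assoc a x _)) (trans (cong (_*r prodL (as ++ bs)) (R.*-comm a x)) (R.*-assoc x a _)))

  prodL-unique : ∀ {xs ys} → Unique xs → (∀ {x} → x ∈ xs → x ∈ ys) → length ys ≤ length xs → prodL xs ≡ prodL ys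
  prodL-unique {[]} {[]} _ _ _ = refl
  prodL-unique {x ∷ xs} {ys} (x∉ ∷ u) sub le with ∈-∃++ (sub (here refl))
  ... | as , bs , refl = trans (cong (x *r_) (prodL-unique u sub′ le′)) (sym (prodL-++ as x bs))
    where
    le′ : length (as ++ bs) ≤ length xs
    le′ = ℕ.≤-pred (subst (_≤ suc (length xs)) (trans (length-++ as) (trans (ℕ.+-suc _ _) (cong suc (sym (length-++ as))))) le)
    sub′ : ∀ {y} → y ∈ xs → y ∈ as ++ bs
    sub′ y∈ with ∈-++⁻ as (sub (there y∈))
    ... | inj₁ p = ∈-++⁺ˡ p
    ... | inj₂ (here refl) = ⊥-elim (All.lookup x∉ y∈ refl)
    ... | inj₂ (there p) = ∈-++⁺ʳ as p

  prodL-map : ∀ a L → prodL (List.map (a *r_) L) ≡ iter (a *r_) (length L) 1r *r prodL L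
  prodL-map a [] = sym (R.*-idˡ 1r)
  prodL-map a (x ∷ L) = trans (cong ((a *r x) *r_) (prodL-map a L)) (R.*-interchange a x _ _)

  prodL-≢0 : ∀ L → (∀ {x} → x ∈ L → x ≢ 0r) → prodL L ≢ 0r
  prodL-≢0 [] _ e = 1≢0 e
  prodL-≢0 (x ∷ L) ne e with dom e
  ... | inj₁ z = ne (here refl) z
  ... | inj₂ z = prodL-≢0 L (λ p → ne (there p)) z

  -- Multiplication by a permutes the nonzero elements, so their product P satisfies a^N P = P, and
  -- P ≠ 0 cancels.
  fermat : DecidableEquality K → ∀ {N} → Size K (suc N) → ∀ a → a ≢ 0r → iter (a *r_) N 1r ≡ 1r
  fermat _≟_ {N} size a a≢0 with HasSize-remove _≟_ 0r size
  ... | L , refl , u , s , c = *-cancelˡ (prodL-≢0 L (λ p → s _ p)) (begin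
    prodL L *r iter (a *r_) N 1r ≡⟨ R.*-comm _ _ ⟩
    iter (a *r_) N 1r *r prodL L ≡⟨ prodL-map a L ⟨
    prodL (List.map (a *r_) L) ≡⟨ prodL-unique (Unique.map⁺ (*-cancelˡ a≢0) u) sub (ℕ.≤-reflexive (sym (length-map (a *r_) L))) ⟩
    prodL L ≡⟨ R.*-idʳ _ ⟨
    prodL L *r 1r ∎)
    where
    sub : ∀ {x} → x ∈ List.map (a *r_) L → x ∈ L
    sub p with ∈-map⁻ (a *r_) p
    ... | y , y∈ , refl = c (a *r y) λ e → case dom e of λ { (inj₁ z) → a≢0 z ; (inj₂ z) → s y y∈ z }

  fermat′ : DecidableEquality K → ∀ {N} → Size K (suc N) → ∀ a → iter (a *r_) (suc N) 1r ≡ a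
  fermat′ _≟_ {N} size a with a ≟ 0r
  ... | yes refl = R.*-zeroˡ _
  ... | no ne = trans (cong (a *r_) (fermat _≟_ size a ne)) (R.*-idʳ a)

  eval : ∀ {d} → Vec K d → K → K
  eval [] y = 1r
  eval (a ∷ as) y = a +r (y *r eval as y)

  divide-root : ∀ {d} (f : Vec K (suc d)) r → Σ (Vec K d) λ g → ∀ y → eval f y ≡ ((y +r r) *r eval g y) +r eval f r
  divide-root (a ∷ []) r = [] , λ y → begin
    a +r (y *r 1r) ≡⟨ cong (a +r_) (trans (R.*-idʳ y) (trans (sym (R.cancelˡ r y)) (cong (r +r_) (R.comm r y)))) ⟩
    a +r (r +r (y +r r)) ≡⟨ R.assoc a r _ ⟨
    (a +r r) +r (y +r r) ≡⟨ R.comm _ _ ⟩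
    (y +r r) +r (a +r r) ≡⟨ cong₂ _+r_ (R.*-idʳ _) (cong (a +r_) (R.*-idʳ r)) ⟨
    ((y +r r) *r 1r) +r (a +r (r *r 1r)) ∎
  divide-root (a ∷ as@(_ ∷ _)) r with divide-root as r
  -- Synthetic division: the coefficients of the quotient are the partial Horner values of f at r.
  ... | g , e = eval as r ∷ g , λ y → begin
    a +r (y *r eval as y) ≡⟨ cong (λ v → a +r (y *r v)) (e y) ⟩
    a +r (y *r (((y +r r) *r eval g y) +r eval as r)) ≡⟨ cong (a +r_) (R.distribˡ y _ _) ⟩
    a +r ((y *r ((y +r r) *r eval g y)) +r (y *r eval as r))
      ≡⟨ cong (a +r_) (cong₂ _+r_ (trans (sym (R.*-assoc y _ _)) (trans (cong (_*r eval g y) (R.*-comm y _)) (R.*-assoc _ y _))) (split y)) ⟩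
    a +r (((y +r r) *r (y *r eval g y)) +r (((y +r r) *r eval as r) +r (r *r eval as r)))
      ≡⟨ cong (a +r_) (trans (sym (R.assoc _ _ _)) (cong (_+r (r *r eval as r)) (trans (R.comm _ _) (sym (R.distribˡ _ _ _))))) ⟩
    a +r (((y +r r) *r (eval as r +r (y *r eval g y))) +r (r *r eval as r)) ≡⟨ R.assoc a _ _ ⟨
    (a +r ((y +r r) *r (eval as r +r (y *r eval g y)))) +r (r *r eval as r) ≡⟨ cong (_+r (r *r eval as r)) (R.comm a _) ⟩
    (((y +r r) *r (eval as r +r (y *r eval g y))) +r a) +r (r *r eval as r) ≡⟨ R.assoc _ a _ ⟩
    ((y +r r) *r (eval as r +r (y *r eval g y))) +r (a +r (r *r eval as r)) ∎
    where
    split : ∀ y → y *r eval as r ≡ ((y +r r) *r eval as r) +r (r *r eval as r)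
    split y = sym (trans (sym (R.distribʳ (y +r r) r (eval as r))) (cong (_*r eval as r)
      (trans (R.assoc y r r) (trans (cong (y +r_) (R.self r)) (R.idʳ y)))))

  divided-roots : ∀ {d} (f : Vec K (suc d)) r (g : Vec K d) → (∀ y → eval f y ≡ ((y +r r) *r eval g y) +r eval f r) →
    eval f r ≡ 0r → ∀ {rs} → All (r ≢_) rs → All (λ y → eval f y ≡ 0r) rs → All (λ y → eval g y ≡ 0r) rs
  divided-roots f r g e z [] [] = []
  divided-roots f r g e z {y ∷ _} (ne ∷ nes) (z′ ∷ zs) with dom (trans (sym (R.idʳ ((y +r r) *r eval g y))) (trans (cong (((y +r r) *r eval g y) +r_) (sym z)) (trans (sym (e y)) z′)))
  ... | inj₁ p = ⊥-elim (ne (sym (R.zero⇒≡ p)))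
  ... | inj₂ p = p ∷ divided-roots f r g e z nes zs

  roots-bound : ∀ {d} (f : Vec K d) {rs} → Unique rs → All (λ y → eval f y ≡ 0r) rs → length rs ≤ d
  roots-bound f [] [] = z≤n
  roots-bound [] (_ ∷ _) (z ∷ _) = ⊥-elim (1≢0 z)
  roots-bound f@(_ ∷ _) {r ∷ rs} (ne ∷ u) (z ∷ zs) with divide-root f r
  ... | g , e = s≤s (roots-bound g u (divided-roots f r g e z ne zs))

  -- Vieta's formula for the constant term, without the sign (-1)^d: splitting off a root r at y = 0
  -- gives f(0) = r g(0).
  roots-product : ∀ {d} (f : Vec K d) {rs} → Unique rs → All (λ y → eval f y ≡ 0r) rs → length rs ≡ d → eval f 0r ≡ prodL rs
  roots-product [] [] [] refl = refl
  roots-product f@(_ ∷ _) {r ∷ rs} (ne ∷ u) (z ∷ zs) len with divide-root f r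
  ... | g , e = begin
    eval f 0r ≡⟨ e 0r ⟩
    ((0r +r r) *r eval g 0r) +r eval f r ≡⟨ cong₂ (λ x w → (x *r eval g 0r) +r w) (R.idˡ r) z ⟩
    (r *r eval g 0r) +r 0r ≡⟨ R.idʳ _ ⟩
    r *r eval g 0r ≡⟨ cong (r *r_) (roots-product g u (divided-roots f r g e z ne zs) (ℕ.suc-injective len)) ⟩
    prodL (r ∷ rs) ∎

-- Roots of ψ in the field

n<2^n : ∀ n → n < 2 ^ n
n<2^n zero = s≤s z≤n
n<2^n (suc n) = ℕ.≤-trans (ℕ.≤-reflexive (cong suc (sym (ℕ.+-comm n 1)))) (ℕ.+-mono-≤ (n<2^n n) (ℕ.≤-trans (ℕ.m^n>0 2 n) (ℕ.m≤m+n _ 0)))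

-- The lower coefficients of X^d + X.
frobVec : ∀ d → Vec Bool d
frobVec d = tabulate (λ i → toℕ i ≡ᵇ 1)

frobVec-acts : (M : Module₂ F2) (let open Module₂ M) {X : V → V} (linX : IsLinear M M X) → ∀ {d} → 2 ≤ d → ∀ w →
  Horner.monic M X (frobVec d) w ≡ X w +v iter X d w
frobVec-acts M {X} linX {suc (suc d)} (s≤s (s≤s _)) w = begin
  false • w +v X (true • w +v X (monic (tabulate {n = d} (λ _ → false)) w)) ≡⟨ trans (cong (_+v X (true • w +v X (monic (tabulate {n = d} (λ _ → false)) w))) (0•-zero F2-ring M w)) (idˡ _) ⟩
  X (true • w +v X (monic (tabulate {n = d} (λ _ → false)) w)) ≡⟨ cong X (cong₂ _+v_ (•-1 w) (cong X (zeros d))) ⟩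
  X (w +v X (iter X d w)) ≡⟨ IsLinear.add linX _ _ ⟩
  X w +v iter X (suc (suc d)) w ∎
  where
  open Module₂ M
  open Horner M X
  open ≡-Reasoning
  zeros : ∀ d → monic (tabulate {n = d} (λ _ → false)) w ≡ iter X d w
  zeros zero = refl
  zeros (suc d) = trans (cong (_+v X (monic (tabulate {n = d} (λ _ → false)) w)) (0•-zero F2-ring M w)) (trans (idˡ _) (cong X (zeros d)))

module BinaryQuot (m : ℕ) (pl : Vec Bool m) where
  open QuotProperties F2-ring m pl public
  open Module₂ M public using (V; 0v; _+v_; _•_)

  mul-linear : ∀ y → IsLinear M M (y *q_)
  mul-linear y = low-linear M xmul-linear y

  mulʳ-linear : ∀ w → IsLinear M M (_*q w)
  mulʳ-linear w = low-coef-linear M xmul-linear m w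

  valueAt : ∀ {d} → Vec Bool d → V → V
  valueAt as y = Horner.monic M (y *q_) as one

  -- Turns the composition of operators in `acts` into a product of ring elements, where the absence
  -- of zero divisors applies.
  monic-mul : ∀ {d} (as : Vec Bool d) y w → Horner.monic M (y *q_) as w ≡ valueAt as y *q w
  monic-mul as y w = trans (cong (λ v → Horner.monic M (y *q_) as v) (sym (one*q w)))
    (sym (horner-map M M (mulʳ-linear w) (λ v → quot-assoc y v w) as one one))
    where
    one*q : ∀ w → one *q w ≡ w
    one*q = IsRing₂.*-idˡ quot-ring

module _ {m : ℕ} (1≤m : 1 ≤ m) (pl : Vec Bool m) (dom : Domain (Quot F2 m pl)) where
  open BinaryQuot m pl
  open DomainTheory quot-ring dom (oneVec≢0 F2 (λ ()) 1≤m)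

  valueAt-eval : ∀ {d} (as : Vec Bool d) y → valueAt as y ≡ eval (Vec.map (_• one) as) y
  valueAt-eval [] y = refl
  valueAt-eval (a ∷ as) y = cong (λ v → (a • one) +v (y *q v)) (valueAt-eval as y)

  valueAt-roots : ∀ {d} (as : Vec Bool d) {rs} → Unique rs → (∀ y → y ∈ rs → valueAt as y ≡ 0v) → length rs ≤ d
  valueAt-roots as u z = roots-bound (Vec.map (_• one) as) u (All.tabulate (λ {y} p → trans (sym (valueAt-eval as y)) (z y p)))

-- If X has order dividing 2^m − 1 modulo ψ then ψ divides X^(2^m) − X, which vanishes
-- on all of the field; the cofactor of ψ has too few roots to account for all of them.
roots-count : ∀ {m} → 2 ≤ m → (pl ψ : Vec Bool m) → Domain (Quot F2 m pl) →
  iter (xmul F2 ψ) (2 ^ m ∸ 1) (oneVec F2 m) ≡ oneVec F2 m →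
  (λ y → BinaryQuot.valueAt m pl ψ y ≡ replicate m false) HasSize m
-- With 2^m = k + m, dividing X^(2^m) + X by ψ leaves a cofactor of degree k.
roots-count {suc e} 2≤m pl ψ dom period with 2 ^ suc e ∸ suc e | ℕ.m∸n+n≡m (ℕ.<⇒≤ (n<2^n (suc e)))
... | k | q≡ = HasSize-resp (λ _ → proj₂) (λ _ p → tt , p) (subst ((λ y → ⊤ × (valueAt ψ y ≡ 0v)) HasSize_) count ψ-size)
  where
  m = suc e
  open BinaryQuot m pl
  1≤m : 1 ≤ m
  1≤m = s≤s z≤n
  module Ψ = QuotProperties F2-ring m ψ
  open Module₂ M using (idˡ; idʳ; ≡⇒zero)
  module D = Division (divide k (frobVec (k + m)) ψ)
  open ≡-Reasoning
  2≤q : 2 ≤ k + m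
  2≤q = ℕ.≤-trans 2≤m (ℕ.m≤n+m m k)
  q-suc : k + m ≡ suc (2 ^ m ∸ 1)
  q-suc = trans q≡ (sym (suc-pred-2^ m))
  monic-0v : (X : V → V) → IsLinear M M X → ∀ {d} (as : Vec Bool d) → Horner.monic M X as 0v ≡ 0v
  monic-0v X linX {d} as = trans (horner-split M linX as 0v 0v)
    (trans (cong₂ _+v_ (IsLinear.zero-map (low-linear M linX as)) (iter-fixed X d (IsLinear.zero-map linX))) (idˡ 0v))
  remainder-zero : D.remainder ≡ 0v
  remainder-zero = begin
    D.remainder ≡⟨ Ψ.low-basis D.remainder ⟨
    Horner.low M Ψ.X D.remainder one ≡⟨ idˡ _ ⟨
    0v +v Horner.low M Ψ.X D.remainder one ≡⟨ cong (_+v Horner.low M Ψ.X D.remainder one) (monic-0v Ψ.X Ψ.xmul-linear D.quotient) ⟨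
    Horner.monic M Ψ.X D.quotient 0v +v Horner.low M Ψ.X D.remainder one
      ≡⟨ cong (λ v → Horner.monic M Ψ.X D.quotient v +v Horner.low M Ψ.X D.remainder one) Ψ.monic-one ⟨
    Horner.monic M Ψ.X D.quotient (Horner.monic M Ψ.X ψ one) +v Horner.low M Ψ.X D.remainder one ≡⟨ D.acts M Ψ.xmul-linear one ⟨
    Horner.monic M Ψ.X (frobVec (k + m)) one ≡⟨ frobVec-acts M Ψ.xmul-linear 2≤q one ⟩
    Ψ.X one +v iter Ψ.X (k + m) one ≡⟨ cong (λ j → Ψ.X one +v iter Ψ.X j one) q-suc ⟩
    Ψ.X one +v Ψ.X (iter Ψ.X (2 ^ m ∸ 1) one) ≡⟨ ≡⇒zero (cong Ψ.X (sym period)) ⟩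
    0v ∎
  module KD = DomainTheory quot-ring dom (oneVec≢0 F2 (λ ()) 1≤m)
  root-or-root : ∀ y → (valueAt D.quotient y ≡ 0v) ⊎ (valueAt ψ y ≡ 0v)
  root-or-root y = dom (begin
    valueAt D.quotient y *q valueAt ψ y ≡⟨ monic-mul D.quotient y (valueAt ψ y) ⟨
    Horner.monic M (y *q_) D.quotient (valueAt ψ y) ≡⟨ idʳ _ ⟨
    Horner.monic M (y *q_) D.quotient (valueAt ψ y) +v 0v
      ≡⟨ cong (Horner.monic M (y *q_) D.quotient (valueAt ψ y) +v_)
           (trans (cong (λ r → Horner.low M (y *q_) r one) remainder-zero) (low-zero M (mul-linear y) {m} one)) ⟨
    Horner.monic M (y *q_) D.quotient (valueAt ψ y) +v Horner.low M (y *q_) D.remainder one ≡⟨ D.acts M (mul-linear y) one ⟨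
    Horner.monic M (y *q_) (frobVec (k + m)) one ≡⟨ frobVec-acts M (mul-linear y) 2≤q one ⟩
    (y *q one) +v iter (y *q_) (k + m) one ≡⟨ ≡⇒zero (trans (IsRing₂.*-idʳ quot-ring y)
         (sym (trans (cong (λ j → iter (y *q_) j one) q-suc) (KD.fermat′ _≟v_ (BoolVec-Size m) y)))) ⟩
    0v ∎)
  ψ-filter = HasSize-filter {Q = λ y → valueAt ψ y ≡ 0v} (λ y → valueAt ψ y ≟v 0v) (BoolVec-Size m)
  u-filter = HasSize-filter {Q = λ y → valueAt D.quotient y ≡ 0v} (λ y → valueAt D.quotient y ≟v 0v) (BoolVec-Size m)
  ψ-size = proj₂ ψ-filter
  u-size = proj₂ u-filter
  bound : ∀ {d l} (as : Vec Bool d) → (λ y → ⊤ × (valueAt as y ≡ 0v)) HasSize l → l ≤ d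
  bound as (L , refl , u , s , _) = valueAt-roots 1≤m pl dom as u (λ y p → proj₂ (s y p))
  total : k + m ≤ proj₁ ψ-filter + proj₁ u-filter
  total = subst (_≤ proj₁ ψ-filter + proj₁ u-filter) (sym q-suc) (HasSize-cover (BoolVec-Size m) ψ-size u-size (λ y → case root-or-root y of λ
    { (inj₁ z) → inj₂ (tt , z) ; (inj₂ z) → inj₁ (tt , z) }))
  count : proj₁ ψ-filter ≡ m
  count = ℕ.≤-antisym (bound ψ ψ-size) (ℕ.+-cancelʳ-≤ k m _ (ℕ.≤-trans (ℕ.≤-reflexive (ℕ.+-comm m k))
    (ℕ.≤-trans total (ℕ.+-monoʳ-≤ (proj₁ ψ-filter) (bound D.quotient u-size)))))

-- The norm of a generator

module PowerTheory {R : Ops} (ring : IsRing₂ R) where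
  open Ops R using () renaming (C to K; 0# to 0r; 1# to 1r; _⊕_ to _+r_; _⊗_ to _*r_)
  private module R = IsRing₂ ring

  power : K → ℕ → K
  power y k = iter (y *r_) k 1r

  power-+ : ∀ y a b → power y (a + b) ≡ power y a *r power y b
  power-+ y zero b = sym (R.*-idˡ _)
  power-+ y (suc a) b = trans (cong (y *r_) (power-+ y a b)) (sym (R.*-assoc y _ _))

  power-* : ∀ y k e → power (power y e) k ≡ power y (k * e)
  power-* y zero e = refl
  power-* y (suc k) e = trans (cong (power y e *r_) (power-* y k e)) (sym (power-+ y e (k * e)))

  square : K → K
  square y = y *r y

  frob : ℕ → K → K
  frob j = iter square j

  frob-power : ∀ j y → frob j y ≡ power y (2 ^ j)
  frob-power zero y = sym (R.*-idʳ y)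
  frob-power (suc j) y = trans (cong square (frob-power j y)) (trans (sym (power-+ y (2 ^ j) (2 ^ j)))
    (cong (power y) (cong (2 ^ j +_) (sym (ℕ.+-identityʳ (2 ^ j))))))

  square-+ : ∀ x y → square (x +r y) ≡ square x +r square y
  square-+ x y = begin
    (x +r y) *r (x +r y) ≡⟨ R.distribˡ _ x y ⟩
    ((x +r y) *r x) +r ((x +r y) *r y) ≡⟨ cong₂ _+r_ (R.distribʳ x y x) (trans (R.distribʳ x y y) (R.comm _ _)) ⟩
    ((x *r x) +r (y *r x)) +r ((y *r y) +r (x *r y)) ≡⟨ R.interchange _ _ _ _ ⟩
    ((x *r x) +r (y *r y)) +r ((y *r x) +r (x *r y)) ≡⟨ cong ((square x +r square y) +r_) (R.≡⇒zero (R.*-comm y x)) ⟩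
    (square x +r square y) +r 0r ≡⟨ R.idʳ _ ⟩
    square x +r square y ∎
    where open ≡-Reasoning

  frob-+ : ∀ j x y → frob j (x +r y) ≡ frob j x +r frob j y
  frob-+ zero x y = refl
  frob-+ (suc j) x y = trans (cong square (frob-+ j x y)) (square-+ _ _)

  frob-* : ∀ j x y → frob j (x *r y) ≡ frob j x *r frob j y
  frob-* zero x y = refl
  frob-* (suc j) x y = trans (cong square (frob-* j x y)) (R.*-interchange _ _ _ _)

  frob-0 : ∀ j → frob j 0r ≡ 0r
  frob-0 j = iter-fixed square j (R.*-zeroˡ 0r)

  frob-1 : ∀ j → frob j 1r ≡ 1r
  frob-1 j = iter-fixed square j (R.*-idˡ 1r)

geometric : ℕ → ℕ → ℕ
geometric q zero = 0
geometric q (suc n) = q ^ n + geometric q n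

geometric-sum : ∀ Q n → suc (Q * geometric (suc Q) n) ≡ suc Q ^ n
geometric-sum Q zero = cong suc (ℕ.*-zeroʳ Q)
geometric-sum Q (suc n) = begin
  suc (Q * (q ^ n + geometric q n)) ≡⟨ cong suc (ℕ.*-distribˡ-+ Q (q ^ n) _) ⟩
  suc (Q * q ^ n + Q * geometric q n) ≡⟨ ℕ.+-suc (Q * q ^ n) _ ⟨
  Q * q ^ n + suc (Q * geometric q n) ≡⟨ cong (Q * q ^ n +_) (geometric-sum Q n) ⟩
  Q * q ^ n + q ^ n ≡⟨ ℕ.+-comm (Q * q ^ n) _ ⟩
  q ^ n + Q * q ^ n ∎
  where
  open ≡-Reasoning
  q = suc Q

-- Let α be the class of X in L = R[X]/(f), |R| = q = 2^m. As L∖0 consists of powers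
-- of α, R is a field, and f has in L the n distinct roots α^(q^i), 0 ≤ i < n. So its
-- constant term is the norm α^(1 + q + … + q^(n−1)), which has order q − 1.
module Norm {R : Ops} (ring : IsRing₂ R) (_≟_ : DecidableEquality (C R)) (1≢0 : 1# R ≢ 0# R)
  (m Q : ℕ) (q≡ : suc Q ≡ 2 ^ m) (2≤Q : 2 ≤ Q) (size : Size (C R) (suc Q))
  (d N : ℕ) (fl : Vec (C R) (suc d)) (N≡ : suc N ≡ suc Q ^ suc d)
  (cyc : Cyclic (replicate (suc d) (0# R)) (xmul R fl) N) where

  open Ops R using () renaming (C to K; 0# to 0r; 1# to 1r; _⊕_ to _+r_; _⊗_ to _*r_)
  private
    q = suc Q
    n = suc d
    module R = IsRing₂ ring
  open QuotProperties ring n fl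
  open Module₂ M using (V; 0v; _+v_; _•_; •-*; •-+r; •-1)
  private
    L : Ops
    L = Quot R n fl
    module L = IsRing₂ quot-ring
    module PR = PowerTheory ring
    module PL = PowerTheory quot-ring
  open ≡-Reasoning

  N≡product : N ≡ Q * geometric q n
  N≡product = ℕ.suc-injective (trans N≡ (sym (geometric-sum Q n)))

  geometric>0 : 0 < geometric q n
  geometric>0 = ℕ.≤-trans (ℕ.m^n>0 q d) (ℕ.m≤m+n _ _)

  -- Places all exponents q^i with i < n inside one period, so that the conjugates are distinct.
  -- Here q > 2 matters: q = 2 and n = 1 would give N = 1 = q^0.
  q^d<N : suc (q ^ d) ≤ N
  q^d<N = ℕ.≤-pred (ℕ.≤-trans (ℕ.≤-trans (ℕ.≤-trans (ℕ.≤-reflexive (ℕ.+-comm 2 (q ^ d)))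
      (ℕ.+-monoʳ-≤ (q ^ d) (ℕ.≤-trans 2≤Q (ℕ.≤-trans (ℕ.≤-reflexive (sym (ℕ.*-identityʳ Q))) (ℕ.*-monoʳ-≤ Q (ℕ.m^n>0 q d))))))
      ℕ.≤-refl) (ℕ.≤-reflexive (sym N≡)))

  0<N : 0 < N
  0<N = ℕ.≤-trans (s≤s z≤n) q^d<N

  one≢0 : one ≢ 0v
  one≢0 = oneVec≢0 R 1≢0 (s≤s z≤n)

  X0 : X 0v ≡ 0v
  X0 = IsLinear.zero-map xmul-linear

  ord : HasOrder one X N
  ord = cyc one one≢0

  cover : ∀ v → v ≢ 0v → ∃[ k ] (k < N) × (v ≡ iter X k one)
  cover = orbit-cover 0<N X0 ord (Vec.≡-dec _≟_) (subst (Size V) (sym N≡) (Vec-Size size n)) one≢0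

  L-domain : Domain L
  L-domain {a} {b} e with Vec.≡-dec _≟_ a 0v | Vec.≡-dec _≟_ b 0v
  ... | yes p | _ = inj₁ p
  ... | no _ | yes p = inj₂ p
  ... | no a≢ | no b≢ with cover a a≢ | cover b b≢
  ... | k , _ , refl | l , _ , refl = ⊥-elim (orbit-≢ 0<N X0 ord one≢0 (k + l) (begin
    iter X (k + l) one ≡⟨ iter-+ X k l one ⟩
    iter X k (iter X l one) ≡⟨ cong (iter X k) (L.*-idˡ _) ⟨
    iter X k (one *q iter X l one) ≡⟨ iter-map (_*q iter X l one) X-mul k one ⟨
    iter X k one *q iter X l one ≡⟨ e ⟩
    0v ∎))
    where
    X-mul : ∀ z → X z *q iter X l one ≡ X (z *q iter X l one)
    X-mul z = trans (cong (_*q iter X l one) (sym (root-mul z))) (trans (quot-assoc root z _) (root-mul _))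

  ι : K → V
  ι r = r • one

  ι-* : ∀ r s → ι (r *r s) ≡ ι r *q ι s
  ι-* r s = trans (•-* r s one) (sym (trans (scale-mul r one (ι s)) (cong (r •_) (L.*-idˡ _))))

  ι-injective : ∀ {r s} → ι r ≡ ι s → r ≡ s
  ι-injective {r} {s} e = trans (sym (R.*-idʳ r)) (trans (cong Vec.head e) (R.*-idʳ s))

  ι-zero : ι 0r ≡ 0v
  ι-zero = 0•-zero ring M one

  domain : Domain R
  domain {r} {s} e = Sum.map (λ z → ι-injective (trans z (sym ι-zero))) (λ z → ι-injective (trans z (sym ι-zero)))
    (L-domain (trans (sym (ι-* r s)) (trans (cong ι e) ι-zero)))

  private
    module RD = DomainTheory ring domain 1≢0
    module LD = DomainTheory quot-ring L-domain one≢0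

  -- The map y ↦ y^q as m squarings, hence additive and multiplicative. It fixes `ι r` by Fermat in
  -- R and therefore sends roots of f to roots of f.
  σ : V → V
  σ = PL.frob m

  σ-ι : ∀ r → σ (ι r) ≡ ι r
  σ-ι r = begin
    PL.frob m (ι r) ≡⟨ iter-map ι (λ s → ι-* s s) m r ⟨
    ι (PR.frob m r) ≡⟨ cong ι (trans (PR.frob-power m r) (cong (PR.power r) (sym q≡))) ⟩
    ι (PR.power r q) ≡⟨ cong ι (RD.fermat′ _≟_ size r) ⟩
    ι r ∎

  eval-σ : ∀ {k} (as : Vec K k) y → LD.eval (Vec.map ι as) (σ y) ≡ σ (LD.eval (Vec.map ι as) y)
  eval-σ [] y = sym (PL.frob-1 m)
  eval-σ (a ∷ as) y = trans (cong₂ (λ u v → u +v (σ y *q v)) (sym (σ-ι a)) (eval-σ as y))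
    (trans (cong (σ (ι a) +v_) (sym (PL.frob-* m y _))) (sym (PL.frob-+ m _ _)))

  eval-root : ∀ {k} (as : Vec K k) → LD.eval (Vec.map ι as) root ≡ Horner.monic M X as one
  eval-root [] = refl
  eval-root (a ∷ as) = cong (ι a +v_) (trans (cong (root *q_) (eval-root as)) (root-mul _))

  conjugate : ℕ → V
  conjugate i = PL.power root (q ^ i)

  conjugate-root : ∀ i → LD.eval (Vec.map ι fl) (conjugate i) ≡ 0v
  conjugate-root zero = trans (cong (LD.eval (Vec.map ι fl)) (L.*-idʳ root)) (trans (eval-root fl) monic-one)
  conjugate-root (suc i) = begin
    LD.eval (Vec.map ι fl) (conjugate (suc i)) ≡⟨ cong (LD.eval (Vec.map ι fl)) next ⟩
    LD.eval (Vec.map ι fl) (σ (conjugate i)) ≡⟨ eval-σ fl (conjugate i) ⟩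
    σ (LD.eval (Vec.map ι fl) (conjugate i)) ≡⟨ cong σ (conjugate-root i) ⟩
    σ 0v ≡⟨ PL.frob-0 m ⟩
    0v ∎
    where
    next : conjugate (suc i) ≡ σ (conjugate i)
    next = sym (trans (PL.frob-power m (conjugate i)) (trans (cong (PL.power (conjugate i)) (sym q≡)) (PL.power-* root q (q ^ i))))

  power-root : ∀ k → PL.power root k ≡ iter X k one
  power-root zero = refl
  power-root (suc k) = trans (root-mul _) (cong X (power-root k))

  conjugates : List V
  conjugates = List.applyDownFrom conjugate n

  conjugates-unique : Unique conjugates
  conjugates-unique = Unique.applyDownFrom⁺₁ conjugate n λ {i} {j} j<i i<n e →
    ℕ.<⇒≢ (ℕ.^-monoʳ-< q (s≤s (ℕ.≤-trans (s≤s z≤n) 2≤Q)) j<i)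
      (orbit-injective 0<N X0 ord (small j (ℕ.<-trans j<i i<n)) (small i i<n)
        (trans (sym (power-root (q ^ j))) (trans (sym e) (power-root (q ^ i)))))
    where
    small : ∀ i → i < n → q ^ i < N
    small i (s≤s i≤d) = ℕ.≤-<-trans (ℕ.^-monoʳ-≤ q i≤d) q^d<N

  prod-conjugates : ∀ k → LD.prodL (List.applyDownFrom conjugate k) ≡ PL.power root (geometric q k)
  prod-conjugates zero = refl
  prod-conjugates (suc k) = trans (cong (conjugate k *q_) (prod-conjugates k)) (sym (PL.power-+ root (q ^ k) (geometric q k)))

  constant-norm : ι (Vec.head fl) ≡ PL.power root (geometric q n)
  constant-norm = begin
    ι (Vec.head fl) ≡⟨ at-zero fl ⟨
    LD.eval (Vec.map ι fl) 0v ≡⟨ LD.roots-product (Vec.map ι fl) conjugates-unique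
      (All.tabulate (λ p → case-root p)) (length-applyDownFrom conjugate n) ⟩
    LD.prodL conjugates ≡⟨ prod-conjugates n ⟩
    PL.power root (geometric q n) ∎
    where
    at-zero : ∀ {k} (as : Vec K (suc k)) → LD.eval (Vec.map ι as) 0v ≡ ι (Vec.head as)
    at-zero (a ∷ as) = trans (cong (ι a +v_) (L.*-zeroˡ _)) (L.idʳ _)
    case-root : ∀ {y} → y ∈ conjugates → LD.eval (Vec.map ι fl) y ≡ 0v
    case-root p with ∈-applyDownFrom⁻ conjugate p
    ... | i , _ , refl = conjugate-root i

  constant-power : ∀ k → ι (PR.power (Vec.head fl) k) ≡ iter X (k * geometric q n) one
  constant-power k = begin
    ι (PR.power (Vec.head fl) k) ≡⟨ iter-map ι (ι-* (Vec.head fl)) k 1r ⟩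
    iter (ι (Vec.head fl) *q_) k (ι 1r) ≡⟨ cong₂ (λ u v → iter (u *q_) k v) constant-norm (•-1 one) ⟩
    PL.power (PL.power root (geometric q n)) k ≡⟨ PL.power-* root k (geometric q n) ⟩
    PL.power root (k * geometric q n) ≡⟨ power-root (k * geometric q n) ⟩
    iter X (k * geometric q n) one ∎

  -- Since N = Q (1 + q + ... + q^(n-1)), the k-th power of the norm is α^(k(1 + q + ... +
  -- q^(n-1))), which first returns to 1 at k = Q.
  constant-order : HasOrder 1r (Vec.head fl *r_) Q
  constant-order = ι-injective (trans (constant-power Q) (trans (cong (λ k → iter X k one) (sym N≡product)) (trans (proj₁ ord) (sym (•-1 one))))) ,
    λ k 0<k k<Q e → proj₂ ord (k * geometric q n) (positive k 0<k)
      (subst (k * geometric q n <_) (sym N≡product) (ℕ.*-monoˡ-< (geometric q n) {{>-nonZero geometric>0}} k<Q))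
      (trans (sym (constant-power k)) (trans (cong ι e) (•-1 one)))
    where
    positive : ∀ k → 0 < k → 0 < k * geometric q n
    positive (suc k) _ = ℕ.≤-trans geometric>0 (ℕ.m≤m+n _ _)

-- Matrices and TSR matrices

≡ᵇ-sym : ∀ a b → (a ≡ᵇ b) ≡ (b ≡ᵇ a)
≡ᵇ-sym zero zero = refl
≡ᵇ-sym zero (suc b) = refl
≡ᵇ-sym (suc a) zero = refl
≡ᵇ-sym (suc a) (suc b) = ≡ᵇ-sym a b

<⇒≡ᵇ-false : ∀ {a b} → a < b → (a ≡ᵇ b) ≡ false
<⇒≡ᵇ-false {zero} (s≤s _) = refl
<⇒≡ᵇ-false {suc a} (s≤s lt) = <⇒≡ᵇ-false lt

unit : ∀ {k} → Fin k → Vec Bool k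
unit j = tabulate (λ i → toℕ i ≡ᵇ toℕ j)

sumV : ∀ {l k} → (Fin l → Vec Bool k) → Vec Bool k
sumV {zero} {k} F = replicate k false
sumV {suc l} F = zipWith _xor_ (F zero) (sumV (F ∘ suc))

lookup-sumV : ∀ {l k} (F : Fin l → Vec Bool k) i → lookup (sumV F) i ≡ ΣB (λ j → lookup (F j) i)
lookup-sumV {zero} F i = Vec.lookup-replicate i false
lookup-sumV {suc l} F i = trans (Vec.lookup-zipWith _xor_ i (F zero) (sumV (F ∘ suc))) (cong (lookup (F zero) i xor_) (lookup-sumV (F ∘ suc) i))

sumV-cong : ∀ {l k} {F G : Fin l → Vec Bool k} → (∀ j → F j ≡ G j) → sumV F ≡ sumV G
sumV-cong {zero} e = refl
sumV-cong {suc l} e = cong₂ (zipWith _xor_) (e zero) (sumV-cong (e ∘ suc))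

unit-expansion : ∀ {k} (v : Vec Bool k) → v ≡ sumV (λ j → Vec.map (lookup v j ∧_) (unit j))
unit-expansion {k} v = lookup-ext λ i → sym (begin
  lookup (sumV (λ j → Vec.map (lookup v j ∧_) (unit j))) i ≡⟨ lookup-sumV (λ j → Vec.map (lookup v j ∧_) (unit j)) i ⟩
  ΣB (λ j → lookup (Vec.map (lookup v j ∧_) (unit j)) i)
    ≡⟨ sumFin-cong F2 (λ j → trans (Vec.lookup-map i (lookup v j ∧_) (unit j)) (trans (cong (lookup v j ∧_) (Vec.lookup∘tabulate (λ i → toℕ i ≡ᵇ toℕ j) i)) (Bool.∧-comm (lookup v j) _))) ⟩
  ΣB (λ j → (toℕ i ≡ᵇ toℕ j) ∧ lookup v j) ≡⟨ ΣB-δ i (lookup v) ⟩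
  lookup v i ∎)
  where open ≡-Reasoning

module _ {k k′ : ℕ} {f : Vec Bool k → Vec Bool k′} (lin : IsLinear (F2Vec k) (F2Vec k′) f) where

  linear-sumV : ∀ {l} (F : Fin l → Vec Bool k) → f (sumV F) ≡ sumV (f ∘ F)
  linear-sumV {zero} F = IsLinear.zero-map lin
  linear-sumV {suc l} F = trans (IsLinear.add lin _ _) (cong (zipWith _xor_ (f (F zero))) (linear-sumV (F ∘ suc)))

  linear-expansion : ∀ v → f v ≡ sumV (λ j → Vec.map (lookup v j ∧_) (f (unit j)))
  linear-expansion v = trans (cong f (unit-expansion v)) (trans (linear-sumV (λ j → Vec.map (lookup v j ∧_) (unit j)))
    (sumV-cong (λ j → IsLinear.scale lin (lookup v j) (unit j))))

linear-ext : ∀ {k k′} {f g : Vec Bool k → Vec Bool k′} → IsLinear (F2Vec k) (F2Vec k′) f → IsLinear (F2Vec k) (F2Vec k′) g →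
  (∀ j → f (unit j) ≡ g (unit j)) → ∀ v → f v ≡ g v
linear-ext lf lg e v = trans (linear-expansion lf v)
  (trans (sumV-cong (λ j → cong (Vec.map (lookup v j ∧_)) (e j))) (sym (linear-expansion lg v)))

linear-∘ : ∀ {R} {M N P : Module₂ R} {f g} → IsLinear N P f → IsLinear M N g → IsLinear M P (f ∘ g)
linear-∘ {f = f} lf lg = record
  { add = λ v w → trans (cong f (IsLinear.add lg v w)) (IsLinear.add lf _ _)
  ; scale = λ a v → trans (cong f (IsLinear.scale lg a v)) (IsLinear.scale lf a _) }

lookup-matApply : ∀ {k} (M : Mat k) v i → lookup (matApply M v) i ≡ ΣB (λ j → lookup (lookup M i) j ∧ lookup v j)
lookup-matApply M v i = Vec.lookup∘tabulate (λ i → ΣB (λ j → lookup (lookup M i) j ∧ lookup v j)) i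

matApply-unit : ∀ {k} (M : Mat k) i j → lookup (matApply M (unit j)) i ≡ lookup (lookup M i) j
matApply-unit M i j = begin
  lookup (matApply M (unit j)) i ≡⟨ lookup-matApply M (unit j) i ⟩
  ΣB (λ l → lookup (lookup M i) l ∧ lookup (unit j) l)
    ≡⟨ sumFin-cong F2 (λ l → trans (cong (lookup (lookup M i) l ∧_) (trans (Vec.lookup∘tabulate (λ i → toℕ i ≡ᵇ toℕ j) l) (≡ᵇ-sym (toℕ l) (toℕ j)))) (Bool.∧-comm (lookup (lookup M i) l) _)) ⟩
  ΣB (λ l → (toℕ j ≡ᵇ toℕ l) ∧ lookup (lookup M i) l) ≡⟨ ΣB-δ j (lookup (lookup M i)) ⟩
  lookup (lookup M i) j ∎
  where open ≡-Reasoning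

matrix-ext : ∀ {k} {A B : Mat k} → (∀ v → matApply A v ≡ matApply B v) → A ≡ B
matrix-ext {A = A} {B} e = lookup-ext λ i → lookup-ext λ j →
  trans (sym (matApply-unit A i j)) (trans (cong (λ v → lookup v i) (e (unit j))) (matApply-unit B i j))

matOf : ∀ {k} → (Vec Bool k → Vec Bool k) → Mat k
matOf f = tabulate λ i → tabulate λ j → lookup (f (unit j)) i

lookup₂-tabulate : ∀ {A : Set} {k l} (F : Fin k → Fin l → A) i j → lookup (lookup (tabulate λ i → tabulate λ j → F i j) i) j ≡ F i j
lookup₂-tabulate F i j = trans (cong (λ r → lookup r j) (Vec.lookup∘tabulate (λ i → tabulate (F i)) i)) (Vec.lookup∘tabulate (F i) j)

matApply-matOf : ∀ {k} {f : Vec Bool k → Vec Bool k} → IsLinear (F2Vec k) (F2Vec k) f → ∀ v → matApply (matOf f) v ≡ f v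
matApply-matOf {f = f} lin = linear-ext (matApply-linear (matOf f)) lin (λ j → lookup-ext λ i →
  trans (matApply-unit (matOf f) i j) (lookup₂-tabulate (λ i j → lookup (f (unit j)) i) i j))

matApply-matMul : ∀ {k} (A B : Mat k) v → matApply (matMul A B) v ≡ matApply A (matApply B v)
matApply-matMul A B = linear-ext (matApply-linear (matMul A B)) (linear-∘ (matApply-linear A) (matApply-linear B)) λ j → lookup-ext λ i →
  trans (matApply-unit (matMul A B) i j) (trans (lookup₂-tabulate (λ i j → ΣB (λ l → lookup (lookup A i) l ∧ lookup (lookup B l) j)) i j)
  (sym (trans (lookup-matApply A (matApply B (unit j)) i) (sumFin-cong F2 (λ l → cong (lookup (lookup A i) l ∧_) (matApply-unit B l j))))))

matApply-idMat : ∀ {k} (v : Vec Bool k) → matApply (idMat k) v ≡ v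
matApply-idMat {k} v = lookup-ext λ i → trans (lookup-matApply (idMat k) v i)
  (trans (sumFin-cong F2 (λ j → cong (_∧ lookup v j) (lookup₂-tabulate (λ i j → toℕ i ≡ᵇ toℕ j) i j))) (ΣB-δ i (lookup v)))

GL-inverse : ∀ {k} (B : Mat k) → GL k B → Σ (Mat k) λ C → (∀ v → matApply B (matApply C v) ≡ v) × (∀ v → matApply C (matApply B v) ≡ v)
GL-inverse {k} B (C , BC , CB) = C , inverse B C BC , inverse C B CB
  where
  inverse : ∀ X Y → matMul X Y ≡ idMat k → ∀ v → matApply X (matApply Y v) ≡ v
  inverse X Y e v = trans (sym (matApply-matMul X Y v)) (trans (cong (λ Z → matApply Z v) e) (matApply-idMat v))

GL-matOf : ∀ {k} {f g : Vec Bool k → Vec Bool k} → IsLinear (F2Vec k) (F2Vec k) f → IsLinear (F2Vec k) (F2Vec k) g →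
  (∀ v → f (g v) ≡ v) → (∀ v → g (f v) ≡ v) → GL k (matOf f)
GL-matOf {k} {f} {g} lf lg fg gf = matOf g , mul lf lg fg , mul lg lf gf
  where
  mul : ∀ {f g} → IsLinear (F2Vec k) (F2Vec k) f → IsLinear (F2Vec k) (F2Vec k) g → (∀ v → f (g v) ≡ v) → matMul (matOf f) (matOf g) ≡ idMat k
  mul {f} {g} lf lg e = matrix-ext λ v → trans (matApply-matMul (matOf f) (matOf g) v)
    (trans (matApply-matOf lf _) (trans (cong f (matApply-matOf lg v)) (trans (e v) (sym (matApply-idMat v)))))

ΣB-↑ : ∀ m {k} (f : Fin (m + k) → Bool) → ΣB f ≡ ΣB (λ j → f (j ↑ˡ k)) xor ΣB (λ j → f (m ↑ʳ j))
ΣB-↑ zero f = refl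
ΣB-↑ (suc m) f = trans (cong (f zero xor_) (ΣB-↑ m (f ∘ suc))) (sym (B.assoc (f zero) _ _))

ΣB-combine : ∀ n m (f : Fin (n * m) → Bool) → ΣB f ≡ ΣB (λ I → ΣB (λ i → f (combine {n} {m} I i)))
ΣB-combine zero m f = refl
ΣB-combine (suc n) m f = trans (ΣB-↑ m f) (cong (ΣB (λ j → f (j ↑ˡ (n * m))) xor_) (ΣB-combine n m (λ j → f (m ↑ʳ j))))

ΣB-last : ∀ {d} (f : Fin (suc d) → Bool) → ΣB f ≡ ΣB (f ∘ inject₁) xor f (fromℕ d)
ΣB-last {zero} f = Bool.xor-identityʳ (f zero)
ΣB-last {suc d} f = trans (cong (f zero xor_) (ΣB-last (f ∘ suc))) (sym (B.assoc (f zero) _ _))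

combine-ext : ∀ n m {v w : Vec Bool (n * m)} → (∀ (I : Fin n) (i : Fin m) → lookup v (combine I i) ≡ lookup w (combine I i)) → v ≡ w
combine-ext n m {v} {w} e = lookup-ext λ r → subst (λ r → lookup v r ≡ lookup w r) (Fin.combine-remQuot {n} m r)
  (e (proj₁ (remQuot {n} m r)) (proj₂ (remQuot {n} m r)))

module _ (m n : ℕ) (c : Vec Bool n) (A : Mat m) where
  tsrEntry : Fin n × Fin m → Fin n × Fin m → Bool
  tsrEntry (I , i) (J , j) =
    if toℕ J ≡ᵇ n ∸ 1 then lookup c I ∧ lookup (lookup A i) j else ((toℕ I ≡ᵇ suc (toℕ J)) ∧ (toℕ i ≡ᵇ toℕ j))

  mutual
    tsr-lookup : ∀ r s → lookup (lookup (tsr m n c A) r) s ≡ tsrEntry (remQuot {n} m r) (remQuot {n} m s)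
    tsr-lookup r s = trans (cong (λ row → lookup row s) (Vec.lookup∘tabulate _ r))
      (trans (Vec.lookup∘tabulate _ s) (unpack r s))

    -- As with the cofactor sign, the meta lets unification refer to the local `entry` of `tsr`,
    -- which `tsrEntry` restates.
    unpack : ∀ r s → _ ≡ tsrEntry (remQuot {n} m r) (remQuot {n} m s)
    unpack r s with remQuot {n} m r | remQuot {n} m s
    ... | I , i | J , j = refl

  tsr-entry : ∀ (I J : Fin n) (i j : Fin m) →
    lookup (lookup (tsr m n c A) (combine I i)) (combine J j) ≡ tsrEntry (I , i) (J , j)
  tsr-entry I J i j = trans (tsr-lookup (combine I i) (combine J j))
    (cong₂ tsrEntry (Fin.remQuot-combine {n} {m} I i) (Fin.remQuot-combine {n} {m} J j))

_⊞_ : ∀ {n m} → Vec (Vec Bool m) n → Vec (Vec Bool m) n → Vec (Vec Bool m) n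
_⊞_ = zipWith (zipWith _xor_)

zeros : ∀ m → Vec Bool m
zeros m = replicate m false

-- Written in the shape of `xmul`: a shift of the blocks plus a contribution of the last one.
tsr-apply : ∀ m d (c : Vec Bool (suc d)) (A : Mat m) (u : Vec (Vec Bool m) (suc d)) →
  matApply (tsr m (suc d) c A) (concat u) ≡ concat ((zeros m ∷ init u) ⊞ Vec.map (λ ci → Vec.map (ci ∧_) (matApply A (last u))) c)
tsr-apply m d c A u = combine-ext n m go
  where
  n = suc d
  open ≡-Reasoning
  u′ : Fin n → Fin m → Bool
  u′ J j = lookup (lookup u J) j
  T = tsr m n c A
  next : Vec (Vec Bool m) n
  next = (zeros m ∷ init u) ⊞ Vec.map (λ ci → Vec.map (ci ∧_) (matApply A (last u))) c
  shifted : ∀ (I : Fin n) i → ΣB (λ (J : Fin d) → (toℕ I ≡ᵇ suc (toℕ J)) ∧ u′ (inject₁ J) i) ≡ lookup (lookup (zeros m ∷ init u) I) i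
  shifted zero i = trans (ΣB-zero {d} (λ _ → refl)) (sym (Vec.lookup-replicate i false))
  shifted (suc I) i = trans (ΣB-δ I (λ J → u′ (inject₁ J) i)) (cong (λ w → lookup w i) (sym (lookup-init u I)))
  lower : ∀ I i J → ΣB (λ j → lookup (lookup T (combine I i)) (combine (inject₁ J) j) ∧ u′ (inject₁ J) j) ≡ (toℕ I ≡ᵇ suc (toℕ J)) ∧ u′ (inject₁ J) i
  lower I i J = trans (sumFin-cong F2 (λ j → trans (cong (_∧ u′ (inject₁ J) j) (trans (tsr-entry m n c A I (inject₁ J) i j)
        (trans (cong (λ b → if b then lookup c I ∧ lookup (lookup A i) j else ((toℕ I ≡ᵇ suc (toℕ (inject₁ J))) ∧ (toℕ i ≡ᵇ toℕ j)))
                 (trans (cong (_≡ᵇ d) (Fin.toℕ-inject₁ J)) (<⇒≡ᵇ-false (Fin.toℕ<n J))))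
               (cong (λ a → (toℕ I ≡ᵇ suc a) ∧ (toℕ i ≡ᵇ toℕ j)) (Fin.toℕ-inject₁ J)))))
        (Bool.∧-assoc (toℕ I ≡ᵇ suc (toℕ J)) _ _)))
    (trans (ΣB-∧ (toℕ I ≡ᵇ suc (toℕ J)) (λ j → (toℕ i ≡ᵇ toℕ j) ∧ u′ (inject₁ J) j)) (cong ((toℕ I ≡ᵇ suc (toℕ J)) ∧_) (ΣB-δ i (u′ (inject₁ J)))))
  final : ∀ I i → ΣB (λ j → lookup (lookup T (combine I i)) (combine (fromℕ d) j) ∧ u′ (fromℕ d) j) ≡ lookup c I ∧ lookup (matApply A (last u)) i
  final I i = trans (sumFin-cong F2 (λ j → trans (cong (_∧ u′ (fromℕ d) j) (trans (tsr-entry m n c A I (fromℕ d) i j)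
        (cong (λ b → if b then lookup c I ∧ lookup (lookup A i) j else ((toℕ I ≡ᵇ suc (toℕ (fromℕ d))) ∧ (toℕ i ≡ᵇ toℕ j)))
          (trans (cong (_≡ᵇ d) (Fin.toℕ-fromℕ d)) (≡ᵇ-refl d)))))
        (Bool.∧-assoc (lookup c I) _ _)))
    (trans (ΣB-∧ (lookup c I) (λ j → lookup (lookup A i) j ∧ u′ (fromℕ d) j))
      (cong (lookup c I ∧_) (sym (trans (lookup-matApply A (last u) i) (sumFin-cong F2 (λ j → cong (λ w → lookup (lookup A i) j ∧ lookup w j) (last-lookup u)))))))
  go : ∀ I i → lookup (matApply T (concat u)) (combine I i) ≡ lookup (concat next) (combine I i)
  go I i = begin
    lookup (matApply T (concat u)) (combine I i) ≡⟨ lookup-matApply T (concat u) (combine I i) ⟩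
    ΣB (λ s → lookup (lookup T (combine I i)) s ∧ lookup (concat u) s) ≡⟨ ΣB-combine n m (λ s → lookup (lookup T (combine I i)) s ∧ lookup (concat u) s) ⟩
    ΣB {n} (λ J → ΣB {m} (λ j → lookup (lookup T (combine I i)) (combine {n} {m} J j) ∧ lookup (concat u) (combine {n} {m} J j)))
      ≡⟨ sumFin-cong F2 {n} (λ J → sumFin-cong F2 {m} (λ j → cong (lookup (lookup T (combine I i)) (combine {n} {m} J j) ∧_) (Vec.lookup-concat u J j))) ⟩
    ΣB {n} (λ J → ΣB {m} (λ j → lookup (lookup T (combine I i)) (combine {n} {m} J j) ∧ u′ J j))
      ≡⟨ ΣB-last (λ J → ΣB (λ j → lookup (lookup T (combine I i)) (combine {n} {m} J j) ∧ u′ J j)) ⟩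
    ΣB {d} (λ J → ΣB {m} (λ j → lookup (lookup T (combine I i)) (combine (inject₁ J) j) ∧ u′ (inject₁ J) j)) xor ΣB (λ j → lookup (lookup T (combine I i)) (combine (fromℕ d) j) ∧ u′ (fromℕ d) j)
      ≡⟨ cong₂ _xor_ (trans (sumFin-cong F2 (lower I i)) (shifted I i)) (final I i) ⟩
    lookup (lookup (zeros m ∷ init u) I) i xor (lookup c I ∧ lookup (matApply A (last u)) i)
      ≡⟨ cong (lookup (lookup (zeros m ∷ init u) I) i xor_) (trans (cong (λ w → lookup w i) (Vec.lookup-map I (λ ci → Vec.map (ci ∧_) (matApply A (last u))) c)) (Vec.lookup-map i (lookup c I ∧_) (matApply A (last u)))) ⟨
    lookup (lookup (zeros m ∷ init u) I) i xor lookup (lookup (Vec.map (λ ci → Vec.map (ci ∧_) (matApply A (last u))) c) I) i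
      ≡⟨ trans (cong (λ w → lookup w i) (Vec.lookup-zipWith (zipWith _xor_) I (zeros m ∷ init u) (Vec.map (λ ci → Vec.map (ci ∧_) (matApply A (last u))) c)))
           (Vec.lookup-zipWith _xor_ i (lookup (zeros m ∷ init u) I) _) ⟨
    lookup (lookup next I) i ≡⟨ Vec.lookup-concat next I i ⟨
    lookup (concat next) (combine I i) ∎

tsr-head-zero : ∀ m d (c : Vec Bool (suc d)) (A : Mat m) → lookup c zero ≡ false → ∀ v i →
  lookup (matApply (tsr m (suc d) c A) v) (combine {suc d} zero i) ≡ false
tsr-head-zero m d c A c₀ v i = trans (lookup-matApply (tsr m (suc d) c A) v (combine {suc d} zero i))
  (trans (ΣB-combine (suc d) m _) (ΣB-zero {suc d} (λ J → ΣB-zero {m} (λ j → cong (_∧ lookup v (combine J j)) (trans (tsr-entry m (suc d) c A zero J i j) (vanish J j))))))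
  where
  vanish : ∀ (J : Fin (suc d)) j → (if toℕ J ≡ᵇ d then lookup c zero ∧ lookup (lookup A i) j else false) ≡ false
  vanish J j with toℕ J ≡ᵇ d
  ... | true = cong (_∧ lookup (lookup A i) j) c₀
  ... | false = refl

-- The last block column consists of the blocks c_I A. With c₀ = 1 its top block is A, and as A ≠ 0
-- the other blocks reveal the remaining c_I.
tsr-injective : ∀ m d (c c′ : Vec Bool (suc d)) (A A′ : Mat m) → lookup c zero ≡ true → lookup c′ zero ≡ true →
  (∃[ v ] matApply A v ≢ zeros m) → tsr m (suc d) c A ≡ tsr m (suc d) c′ A′ → (c ≡ c′) × (A ≡ A′)
tsr-injective m d c c′ A A′ c₀ c′₀ (v , Av≢0) e = lookup-ext same-c , A≡
  where
  last-column : ∀ c (A : Mat m) I i j → lookup (lookup (tsr m (suc d) c A) (combine I i)) (combine (fromℕ d) j) ≡ lookup c I ∧ lookup (lookup A i) j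
  last-column c A I i j = trans (tsr-entry m (suc d) c A I (fromℕ d) i j)
    (cong (λ b → if b then lookup c I ∧ lookup (lookup A i) j else ((toℕ I ≡ᵇ suc (toℕ (fromℕ d))) ∧ (toℕ i ≡ᵇ toℕ j)))
      (trans (cong (_≡ᵇ d) (Fin.toℕ-fromℕ d)) (≡ᵇ-refl d)))
  entries : ∀ I i j → lookup c I ∧ lookup (lookup A i) j ≡ lookup c′ I ∧ lookup (lookup A′ i) j
  entries I i j = trans (sym (last-column c A I i j)) (trans (cong (λ T → lookup (lookup T (combine I i)) (combine (fromℕ d) j)) e) (last-column c′ A′ I i j))
  A≡ : A ≡ A′
  A≡ = lookup-ext λ i → lookup-ext λ j → trans (cong (_∧ lookup (lookup A i) j) (sym c₀)) (trans (entries zero i j) (cong (_∧ lookup (lookup A′ i) j) c′₀))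
  differ : ∀ {x y : Bool} → x ≢ y → ∀ a → x ∧ a ≡ y ∧ a → a ≡ false
  differ {true} {true} ne _ _ = ⊥-elim (ne refl)
  differ {false} {false} ne _ _ = ⊥-elim (ne refl)
  differ {true} {false} ne a q = q
  differ {false} {true} ne a q = sym q
  same-c : ∀ I → lookup c I ≡ lookup c′ I
  same-c I with lookup c I Bool.≟ lookup c′ I
  ... | yes p = p
  ... | no ne = ⊥-elim (Av≢0 (lookup-ext λ i → trans (lookup-matApply A v i) (trans (ΣB-zero {m} (λ j →
      cong (_∧ lookup v j) (differ ne (lookup (lookup A i) j) (trans (entries I i j) (cong (λ X → lookup c′ I ∧ lookup (lookup X i) j) (sym A≡))))))
      (sym (Vec.lookup-replicate i false)))))

-- Block-diagonal maps and multiplication by X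

blockMap : ∀ {m n} → (Vec Bool m → Vec Bool m) → Vec (Vec Bool m) n → Vec Bool (n * m)
blockMap φ r = concat (Vec.map φ r)

concat-⊞ : ∀ {m n} (u w : Vec (Vec Bool m) n) → concat (u ⊞ w) ≡ zipWith _xor_ (concat u) (concat w)
concat-⊞ [] [] = refl
concat-⊞ (x ∷ u) (y ∷ w) = trans (cong (zipWith _xor_ x y Vec.++_) (concat-⊞ u w)) (sym (Vec.zipWith-++ _xor_ x (concat u) y (concat w)))

-- The lower coefficients of X^n - μ c(X). Negation in `GF` is the identity, so this agrees with the
-- vector in `P₂` by computation.
lowμ : (R : Ops) → ∀ {n} → C R → Vec Bool n → Vec (C R) n
lowμ R μ c = tabulate (λ i → _⊗_ R μ (if lookup c i then 1# R else 0# R))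

module _ {m : ℕ} (pl : Vec Bool m) {φ : Vec Bool m → Vec Bool m} (lin : IsLinear (F2Vec m) (F2Vec m) φ) where
  private
    R : Ops
    R = Quot F2 m pl
    module Q = QuotProperties F2-ring m pl
    module R = IsRing₂ Q.quot-ring
    open Q using (_*q_)

  map-⊞ : ∀ {n} (u w : Vec (Vec Bool m) n) → Vec.map φ (u ⊞ w) ≡ Vec.map φ u ⊞ Vec.map φ w
  map-⊞ [] [] = refl
  map-⊞ (x ∷ u) (y ∷ w) = cong₂ _∷_ (IsLinear.add lin x y) (map-⊞ u w)

  blockMap-add : ∀ {n} (u w : Vec (Vec Bool m) n) → blockMap φ (u ⊞ w) ≡ zipWith _xor_ (blockMap φ u) (blockMap φ w)
  blockMap-add u w = trans (cong concat (map-⊞ u w)) (concat-⊞ (Vec.map φ u) (Vec.map φ w))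

  map-init : ∀ {d} (r : Vec (Vec Bool m) (suc d)) → Vec.map φ (init r) ≡ init (Vec.map φ r)
  map-init (x ∷ []) = refl
  map-init (x ∷ r@(_ ∷ _)) = cong (φ x ∷_) (map-init r)

  map-last : ∀ {d} (r : Vec (Vec Bool m) (suc d)) → φ (last r) ≡ last (Vec.map φ r)
  map-last (x ∷ []) = refl
  map-last (x ∷ r@(_ ∷ _)) = map-last r

  -- Modulo X^n - μc(X), multiplication by X shifts the coordinates and adds c_i μ times the last
  -- one to coordinate i; φ turns μ into A in every block. It is applied to an invertible B and also
  -- to the evaluation at e₀, before that is known to be injective.
  blockMap-xmul : ∀ {d} (A : Mat m) μ (c : Vec Bool (suc d)) → (∀ z → φ (μ *q z) ≡ matApply A (φ z)) →
    ∀ r → blockMap φ (xmul R (lowμ R μ c) r) ≡ matApply (tsr m (suc d) c A) (blockMap φ r)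
  blockMap-xmul {d} A μ c equi r = trans (cong concat (begin
      Vec.map φ ((zeros m ∷ init r) ⊞ Vec.map (last r *q_) (lowμ R μ c)) ≡⟨ map-⊞ (zeros m ∷ init r) _ ⟩
      (φ (zeros m) ∷ Vec.map φ (init r)) ⊞ Vec.map φ (Vec.map (last r *q_) (lowμ R μ c))
        ≡⟨ cong₂ _⊞_ (cong₂ _∷_ (IsLinear.zero-map lin) (map-init r)) (lookup-ext scaled) ⟩
      (zeros m ∷ init (Vec.map φ r)) ⊞ Vec.map (λ ci → Vec.map (ci ∧_) (matApply A (last (Vec.map φ r)))) c ∎))
    (sym (tsr-apply m d c A (Vec.map φ r)))
    where
    open ≡-Reasoning
    coefficient : ∀ b → φ (last r *q (μ *q (if b then 1# R else 0# R))) ≡ Vec.map (b ∧_) (matApply A (last (Vec.map φ r)))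
    coefficient true = begin
      φ (last r *q (μ *q 1# R)) ≡⟨ cong φ (trans (cong (last r *q_) (R.*-idʳ μ)) (R.*-comm (last r) μ)) ⟩
      φ (μ *q last r) ≡⟨ equi (last r) ⟩
      matApply A (φ (last r)) ≡⟨ cong (matApply A) (map-last r) ⟩
      matApply A (last (Vec.map φ r)) ≡⟨ Module₂.•-1 (F2Vec m) _ ⟨
      Vec.map (true ∧_) (matApply A (last (Vec.map φ r))) ∎
    coefficient false = begin
      φ (last r *q (μ *q 0# R)) ≡⟨ cong φ (trans (cong (last r *q_) (R.*-zeroʳ μ)) (R.*-zeroʳ (last r))) ⟩
      φ (zeros m) ≡⟨ IsLinear.zero-map lin ⟩
      zeros m ≡⟨ 0•-zero F2-ring (F2Vec m) _ ⟨
      Vec.map (false ∧_) (matApply A (last (Vec.map φ r))) ∎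
    scaled : ∀ I → lookup (Vec.map φ (Vec.map (last r *q_) (lowμ R μ c))) I ≡ lookup (Vec.map (λ ci → Vec.map (ci ∧_) (matApply A (last (Vec.map φ r)))) c) I
    scaled I = begin
      lookup (Vec.map φ (Vec.map (last r *q_) (lowμ R μ c))) I ≡⟨ trans (Vec.lookup-map I φ (Vec.map (last r *q_) (lowμ R μ c))) (cong φ (Vec.lookup-map I (last r *q_) (lowμ R μ c))) ⟩
      φ (last r *q lookup (lowμ R μ c) I) ≡⟨ cong (λ w → φ (last r *q w)) (Vec.lookup∘tabulate (λ i → μ *q (if lookup c i then 1# R else 0# R)) I) ⟩
      φ (last r *q (μ *q (if lookup c I then 1# R else 0# R))) ≡⟨ coefficient (lookup c I) ⟩
      Vec.map (lookup c I ∧_) (matApply A (last (Vec.map φ r))) ≡⟨ Vec.lookup-map I (λ ci → Vec.map (ci ∧_) (matApply A (last (Vec.map φ r)))) c ⟨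
      lookup (Vec.map (λ ci → Vec.map (ci ∧_) (matApply A (last (Vec.map φ r)))) c) I ∎

blockMap-surjective : ∀ {m n} {f g : Vec Bool m → Vec Bool m} → (∀ v → f (g v) ≡ v) → ∀ (v : Vec Bool (n * m)) → ∃[ u ] blockMap {m} {n} f u ≡ v
blockMap-surjective {m} {n} {f} {g} fg v = Vec.map g blocks , combine-ext n m λ I i → begin
  lookup (concat (Vec.map f (Vec.map g blocks))) (combine I i) ≡⟨ Vec.lookup-concat (Vec.map f (Vec.map g blocks)) I i ⟩
  lookup (lookup (Vec.map f (Vec.map g blocks)) I) i
    ≡⟨ cong (λ w → lookup w i) (trans (Vec.lookup-map I f (Vec.map g blocks)) (trans (cong f (Vec.lookup-map I g blocks)) (fg _))) ⟩
  lookup (lookup blocks I) i ≡⟨ lookup₂-tabulate (λ I i → lookup v (combine I i)) I i ⟩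
  lookup v (combine I i) ∎
  where
  open ≡-Reasoning
  blocks : Vec (Vec Bool m) n
  blocks = tabulate λ I → tabulate λ i → lookup v (combine I i)

-- The double count

HasOrder-cong : {A : Set} {one : A} {f g : A → A} {N : ℕ} → (∀ x → f x ≡ g x) → HasOrder one f N → HasOrder one g N
HasOrder-cong {one = one} {f} {g} {N} e (r , s) = trans (sym (same N)) r , λ k 0<k k<N q → s k 0<k k<N (trans (same k) q)
  where
  same : ∀ k → iter f k one ≡ iter g k one
  same k = iter-map (λ x → x) e k one

-- If X has order 2^m - 1 modulo ψ, a nonzero w with ψ(T)w = 0 is a cyclic vector, and evaluation at
-- w is an isomorphism from F₂[X]/(ψ) that turns X into T. It is used for T = A and for
-- multiplication by a root μ of ψ in K.
module Orbit {m : ℕ} (1≤m : 1 ≤ m) (ψ : Vec Bool m) (ord : HasOrder (oneVec F2 m) (xmul F2 ψ) (2 ^ m ∸ 1))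
  {T : Vec Bool m → Vec Bool m} (linT : IsLinear (F2Vec m) (F2Vec m) T)
  (w : Vec Bool m) (w≢0 : w ≢ zeros m) (ψw≡0 : Horner.monic (F2Vec m) T ψ w ≡ zeros m) where

  private
    module Q = QuotProperties F2-ring m ψ
    open Q using (X; one)
    0<Q = 0<2^n∸1 1≤m

  θ : Vec Bool m → Vec Bool m
  θ z = Horner.low (F2Vec m) T z w

  θ-linear : IsLinear (F2Vec m) (F2Vec m) θ
  θ-linear = low-coef-linear (F2Vec m) linT m w

  θ-X : ∀ z → θ (X z) ≡ T (θ z)
  θ-X = xmul-low (F2Vec m) linT (λ _ → refl) ψ w ψw≡0

  θ-one : θ one ≡ w
  θ-one = low-one (F2Vec m) linT ψ w ψw≡0

  private
    X0 = IsLinear.zero-map Q.xmul-linear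
    T0 = IsLinear.zero-map linT
    one≢0 : one ≢ zeros m
    one≢0 = oneVec≢0 F2 (λ ()) 1≤m
    θone≢0 : θ one ≢ zeros m
    θone≢0 e = w≢0 (trans (sym θ-one) e)

  θ-injective : ∀ {a b} → θ a ≡ θ b → a ≡ b
  θ-injective = IsLinear.kernel⇒injective θ-linear
    (equivariant-kernel _≟v_ _≟v_ {x′ = T} 0<Q X0 T0 θ θ-X (BoolVec-Size m) ord one≢0 θone≢0)

  T-cyclic : Cyclic (zeros m) T (2 ^ m ∸ 1)
  T-cyclic = cyclic-forward _≟v_ _≟v_ 0<Q X0 T0 θ θ-X (BoolVec-Size m) (BoolVec-Size m)
    (IsLinear.kernel⇒injective θ-linear) ord one≢0 θone≢0

  abstract
    orbit : ∀ y → y ≢ zeros m → ∃[ k ] y ≡ iter T k w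
    orbit y y≢0 =
      let (k , _ , e) = orbit-cover 0<Q T0 (T-cyclic w w≢0) _≟v_ (BoolVec-Size m) w≢0 y y≢0 in k , e

    preimage : ∀ y → ∃[ z ] θ z ≡ y
    preimage y with y ≟v zeros m
    ... | yes refl = zeros m , IsLinear.zero-map θ-linear
    ... | no y≢0 with orbit y y≢0
    ... | k , refl = iter X k one , trans (iter-map θ θ-X k one) (cong (iter T k) θ-one)

  θ⁻¹ : Vec Bool m → Vec Bool m
  θ⁻¹ y = proj₁ (preimage y)

  θ-θ⁻¹ : ∀ y → θ (θ⁻¹ y) ≡ y
  θ-θ⁻¹ y = proj₂ (preimage y)

  θ⁻¹-θ : ∀ z → θ⁻¹ (θ z) ≡ z
  θ⁻¹-θ z = θ-injective (θ-θ⁻¹ (θ z))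

  θ⁻¹-linear : IsLinear (F2Vec m) (F2Vec m) θ⁻¹
  θ⁻¹-linear = record
    { add = λ a b → θ-injective (trans (θ-θ⁻¹ _) (sym (trans (IsLinear.add θ-linear (θ⁻¹ a) (θ⁻¹ b)) (cong₂ (zipWith _xor_) (θ-θ⁻¹ a) (θ-θ⁻¹ b)))))
    ; scale = λ c a → θ-injective (trans (θ-θ⁻¹ _) (sym (trans (IsLinear.scale θ-linear c (θ⁻¹ a)) (cong (Vec.map (c ∧_)) (θ-θ⁻¹ a))))) }

  θ⁻¹-T : ∀ y → θ⁻¹ (T y) ≡ X (θ⁻¹ y)
  θ⁻¹-T y = θ-injective (trans (θ-θ⁻¹ _) (sym (trans (θ-X (θ⁻¹ y)) (cong T (θ-θ⁻¹ y)))))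

  θ⁻¹-w : θ⁻¹ w ≡ one
  θ⁻¹-w = θ-injective (trans (θ-θ⁻¹ w) (sym θ-one))

-- What cyclicity of a TSR matrix says about c and A

module Blocks (m d : ℕ) (2≤m : 2 ≤ m) where
  n : ℕ
  n = suc d

  N : ℕ
  N = 2 ^ (n * m) ∸ 1

  1≤m : 1 ≤ m
  1≤m = ℕ.≤-trans (s≤s z≤n) 2≤m

  1≤nm : 1 ≤ n * m
  1≤nm = ℕ.≤-trans 1≤m (ℕ.m≤m+n m _)

  0<N : 0 < N
  0<N = 0<2^n∸1 1≤nm

  q^n≡ : (2 ^ m) ^ n ≡ 2 ^ (n * m)
  q^n≡ = trans (ℕ.^-*-assoc 2 m n) (cong (2 ^_) (ℕ.*-comm m n))

  N≡ : suc N ≡ suc (2 ^ m ∸ 1) ^ n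
  N≡ = trans (suc-pred-2^ (n * m)) (trans (sym q^n≡) (cong (_^ n) (sym (suc-pred-2^ m))))

  Blk : Set
  Blk = Vec (Vec Bool m) n

  0b : Blk
  0b = replicate n (zeros m)

  Blk-Size : Size Blk (suc N)
  Blk-Size = subst (Size Blk) (sym N≡) (Vec-Size (BoolVec-Size m) n)

  2≤Q : 2 ≤ 2 ^ m ∸ 1
  2≤Q = ℕ.≤-pred (ℕ.≤-trans (ℕ.≤-trans (s≤s (s≤s (s≤s z≤n))) (ℕ.^-monoʳ-≤ 2 2≤m)) (ℕ.≤-reflexive (sym (suc-pred-2^ m))))

  firstIndex : Fin m
  firstIndex = fromℕ< 1≤m

  concat-head : ∀ (u : Vec Bool m) (us : Vec (Vec Bool m) d) → concat (u ∷ us) ≡ replicate (n * m) false → u ≡ zeros m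
  concat-head u us e = lookup-ext λ i → trans (sym (Vec.lookup-concat (u ∷ us) zero i))
    (trans (cong (λ v → lookup v (combine {n} zero i)) e)
      (trans (Vec.lookup-replicate (combine {n} {m} zero i) false) (sym (Vec.lookup-replicate i false))))

  -- T^N fixes a unit vector supported in the first block, so this vector lies in the image of T;
  -- for c₀ = 0 the first block row of T vanishes.
  cyclic-tsr⇒c₀ : ∀ {c A} → Cyclic (replicate (n * m) false) (matApply (tsr m n c A)) N → lookup c zero ≡ true
  cyclic-tsr⇒c₀ {c} {A} cyc with lookup c zero in c₀
  ... | true = refl
  ... | false = ⊥-elim (contradict (trans (sym at-r) (trans (cong (λ v → lookup v r) (sym period)) (tsr-head-zero m d c A c₀ (iter T (N ∸ 1) (unit r)) firstIndex))))
    where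
    T = matApply (tsr m n c A)
    r : Fin (n * m)
    r = combine {n} zero firstIndex
    at-r : lookup (unit r) r ≡ true
    at-r = trans (Vec.lookup∘tabulate (λ i → toℕ i ≡ᵇ toℕ r) r) (≡ᵇ-refl (toℕ r))
    contradict : true ≢ false
    contradict ()
    nonzero : unit r ≢ replicate (n * m) false
    nonzero e = contradict (trans (sym at-r) (trans (cong (λ v → lookup v r) e) (Vec.lookup-replicate r false)))
    period : T (iter T (N ∸ 1) (unit r)) ≡ unit r
    period = trans (cong (λ k → iter T k (unit r)) (ℕ.m+[n∸m]≡n 0<N)) (proj₁ (cyc (unit r) nonzero))

  -- The coefficient ring is any F₂[X]/(pl), because two cases are needed: K with φ = B, and
  -- F₂[X]/(ψ) with φ the evaluation at e₀.
  module Intertwine (pl : Vec Bool m) (c : Vec Bool n) (A : Mat m) (μ : Vec Bool m)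
    {φ : Vec Bool m → Vec Bool m} (lin : IsLinear (F2Vec m) (F2Vec m) φ)
    (equi : ∀ z → φ (_⊗_ (Quot F2 m pl) μ z) ≡ matApply A (φ z)) (φone≢0 : φ (oneVec F2 m) ≢ zeros m) where

    private
      R : Ops
      R = Quot F2 m pl
      ring : IsRing₂ R
      ring = QuotProperties.quot-ring F2-ring m pl
      fl = lowμ R μ c
      T = matApply (tsr m n c A)
      x0 : xmul R fl 0b ≡ 0b
      x0 = IsLinear.zero-map (QuotProperties.xmul-linear ring n fl)
      T0 = IsLinear.zero-map (matApply-linear (tsr m n c A))
      Φ-equi = blockMap-xmul pl lin A μ c equi
      Φone≢0 : blockMap φ (oneVec R n) ≢ replicate (n * m) false
      Φone≢0 e = φone≢0 (concat-head (φ (oneVec F2 m)) (Vec.map φ (Vec.tail (oneVec R n))) e)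
      group = Module₂.group (vecModule ring n)
      one≢0 : oneVec R n ≢ 0b
      one≢0 = oneVec≢0 R (oneVec≢0 F2 (λ ()) 1≤m) (s≤s z≤n)

    pull : Cyclic (replicate (n * m) false) T N → Cyclic 0b (xmul R fl) N
    pull cyc = cyclic-backward (Vec.≡-dec _≟v_) _≟v_ 0<N x0 T0 (blockMap φ) Φ-equi Blk-Size
      (additive-zero group (Module₂.group (F2Vec (n * m))) (blockMap-add pl lin)) {oneVec R n} (cyc _ Φone≢0) Φone≢0

    push : HasOrder (oneVec R n) (xmul R fl) N → Cyclic (replicate (n * m) false) T N
    push ord = cyclic-forward (Vec.≡-dec _≟v_) _≟v_ 0<N x0 T0 (blockMap φ) Φ-equi Blk-Size (BoolVec-Size (n * m))
      (additive-injective group (Module₂.group (F2Vec (n * m))) (blockMap-add pl lin)) ord one≢0 Φone≢0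

  module CyclicTSR (c : Vec Bool n) (A : Mat m) (cyc : Cyclic (replicate (n * m) false) (matApply (tsr m n c A)) N) where
    ψ : Vec Bool m
    ψ = lowCoeffs F2 m (charPoly A)

    private
      module Q = QuotProperties F2-ring m ψ
      e₀ : Vec Bool m
      e₀ = oneVec F2 m
      e₀≢0 : e₀ ≢ zeros m
      e₀≢0 = oneVec≢0 F2 (λ ()) 1≤m
      φ : Vec Bool m → Vec Bool m
      φ z = Horner.low (F2Vec m) (matApply A) z e₀
      φ-linear = low-coef-linear (F2Vec m) (matApply-linear A) m e₀
      φ-one : φ e₀ ≡ e₀
      φ-one = low-one (F2Vec m) (matApply-linear A) ψ e₀ (cayley-hamilton-e₀ A)
      equi : ∀ z → φ (Q._*q_ Q.root z) ≡ matApply A (φ z)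
      equi z = trans (cong φ (Q.root-mul z)) (xmul-low (F2Vec m) (matApply-linear A) (λ _ → refl) ψ e₀ (cayley-hamilton-e₀ A) z)
      fl = lowμ (Quot F2 m ψ) Q.root c
      module No = Norm Q.quot-ring _≟v_ e₀≢0 m (2 ^ m ∸ 1) (suc-pred-2^ m) 2≤Q (BoolVec-Size m) d N fl N≡
        (Intertwine.pull ψ c A Q.root φ-linear equi (λ e → e₀≢0 (trans (sym φ-one) e)) cyc)

    c₀ : lookup c zero ≡ true
    c₀ = cyclic-tsr⇒c₀ {c} {A} cyc

    -- Because c₀ = 1, the constant coefficient whose order the norm determines is the class of X
    -- modulo ψ.
    ψ-order : HasOrder e₀ (xmul F2 ψ) (2 ^ m ∸ 1)
    ψ-order = HasOrder-cong (λ z → trans (cong (λ r → Q._*q_ r z) head-root) (Q.root-mul z)) No.constant-order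
      where
      head-root : Vec.head fl ≡ Q.root
      head-root = trans (cong (λ b → Q._*q_ Q.root (if b then e₀ else zeros m)) c₀) (IsRing₂.*-idʳ Q.quot-ring Q.root)

    private module O = Orbit 1≤m ψ ψ-order (matApply-linear A) e₀ e₀≢0 (cayley-hamilton-e₀ A)

    A-cyclic : Cyclic (zeros m) (matApply A) (2 ^ m ∸ 1)
    A-cyclic = O.T-cyclic

    -- Cayley-Hamilton is available at e₀; it spreads to every v because e₀ has turned out to be a
    -- cyclic vector for A.
    ψ-annihilates : ∀ v → Horner.monic (F2Vec m) (matApply A) ψ v ≡ zeros m
    ψ-annihilates v = subst (λ u → Horner.monic (F2Vec m) (matApply A) ψ u ≡ zeros m) (O.θ-θ⁻¹ v)
      (monic-low (F2Vec m) (matApply-linear A) ψ (O.θ⁻¹ v) e₀ (cayley-hamilton-e₀ A))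

    A-nonzero : ∃[ v ] matApply A v ≢ zeros m
    A-nonzero = e₀ , orbit-≢ (0<2^n∸1 1≤m) (IsLinear.zero-map (matApply-linear A)) (A-cyclic e₀ e₀≢0) e₀≢0 1

monicPoly-low : (R : Ops) → ∀ {n} (a : Vec (C R) n) → lowCoeffs R n (monicPoly R a) ≡ a
monicPoly-low R {n} a = lookup-ext λ i → trans (Vec.lookup∘tabulate (monicPoly R a ∘ toℕ) i)
  (trans (cong (λ b → if b then 1# R else vcoef R a (toℕ i)) (<⇒≡ᵇ-false (Fin.toℕ<n i))) (at i))
  where
  at : ∀ i → vcoef R a (toℕ i) ≡ lookup a i
  at i with toℕ i ℕ.<? n
  ... | yes p = cong (lookup a) (Fin.fromℕ<-toℕ i p)
  ... | no ¬p = ⊥-elim (¬p (Fin.toℕ<n i))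

monicPoly-monic : (R : Ops) → ∀ {n} (a : Vec (C R) n) → Monic R n (monicPoly R a)
monicPoly-monic R {n} a = cong (λ b → if b then 1# R else vcoef R a n) (≡ᵇ-refl n) , beyond
  where
  beyond : ∀ k → n < k → monicPoly R a k ≡ 0# R
  beyond k lt with k ℕ.<? n
  ... | yes p = ⊥-elim (ℕ.<-asym lt p)
  ... | no _ = cong (λ b → if b then 1# R else 0# R) (trans (≡ᵇ-sym k n) (<⇒≡ᵇ-false lt))

-- Fibres over a matrix and over a pair

module Main (m d : ℕ) (2≤m : 2 ≤ m) (p : Poly F2) (mon : Monic F2 m p) (irr : Irreducible F2 m p) where
  open Blocks m d 2≤m

  pl : Vec Bool m
  pl = lowCoeffs F2 m p

  K : Ops
  K = Quot F2 m pl

  open BinaryQuot m pl using (one; _*q_; valueAt; mul-linear; quot-ring)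

  K-domain : Domain K
  K-domain = irreducible⇒domain mon irr

  1≢0 : one ≢ zeros m
  1≢0 = oneVec≢0 F2 (λ ()) 1≤m

  Commutes : Mat m → Vec Bool m → Mat m → Set
  Commutes A μ B = ∀ z → matApply B (μ *q z) ≡ matApply A (matApply B z)

  GL-nonzero : ∀ B {v} → GL m B → v ≢ zeros m → matApply B v ≢ zeros m
  GL-nonzero B {v} gl v≢0 e with GL-inverse B gl
  ... | C , _ , CB = v≢0 (trans (sym (CB v)) (trans (cong (matApply C) e) (IsLinear.zero-map (matApply-linear C))))

  GL-injective : ∀ B {u v} → GL m B → matApply B u ≡ matApply B v → u ≡ v
  GL-injective B {u} {v} gl e with GL-inverse B gl
  ... | C , _ , CB = trans (sym (CB u)) (trans (cong (matApply C) e) (CB v))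

  P₂-order : ∀ a → PrimitivePoly K (2 ^ m) n (monicPoly K a) → HasOrder (oneVec K n) (xmul K a) N
  P₂-order a (_ , _ , ord) = subst₂ (λ l k → HasOrder (oneVec K n) (xmul K l) k) (monicPoly-low K a) (cong (_∸ 1) q^n≡) ord

  cyclic⇒primitive : ∀ a → Cyclic 0b (xmul K a) N → PrimitivePoly K (2 ^ m) n (monicPoly K a)
  cyclic⇒primitive a cyc = monicPoly-monic K a ,
    order⇒irreducible quot-ring _≟v_ K-domain 1≢0 (monicPoly K a) (s≤s z≤n) 0<N Blk-Size (monicPoly-monic K a) ord′ ,
    subst (HasOrder (oneVec K n) (xmul K (lowCoeffs K n (monicPoly K a)))) (cong (_∸ 1) (sym q^n≡)) ord′
    where
    ord′ : HasOrder (oneVec K n) (xmul K (lowCoeffs K n (monicPoly K a))) N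
    ord′ = subst (λ l → HasOrder (oneVec K n) (xmul K l) N) (sym (monicPoly-low K a)) (cyc _ (oneVec≢0 K 1≢0 (s≤s z≤n)))

  lowμ-head : ∀ μ (c : Vec Bool n) → lookup c zero ≡ true → lookup (lowμ K μ c) zero ≡ μ
  lowμ-head μ c c₀ = trans (cong (λ b → μ *q (if b then one else zeros m)) c₀) (IsRing₂.*-idʳ quot-ring μ)

  -- M is conjugate, by the matrix with diagonal blocks B, to multiplication by X
  -- modulo X^n − μ c(X).
  Realizes : Mat (n * m) → Vec (Vec Bool m) n → Mat m → Set
  Realizes M a B = Σ (Vec Bool n) λ c → Σ (Vec Bool m) λ μ → Σ (Mat m) λ A →
    (M ≡ tsr m n c A) × (a ≡ lowμ K μ c) × (lookup c zero ≡ true) × Commutes A μ B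

  module Fiber (c : Vec Bool n) (A : Mat m) (cyc : Cyclic (replicate (n * m) false) (matApply (tsr m n c A)) N) where
    open CyclicTSR c A cyc

    IsRoot : Vec Bool m → Set
    IsRoot μ = valueAt ψ μ ≡ zeros m

    roots-size : IsRoot HasSize m
    roots-size = roots-count 2≤m pl ψ K-domain (proj₁ ψ-order)

    Conjugator : Vec Bool m → Mat m → Set
    Conjugator μ B = GL m B × Commutes A μ B

    module AtRoot (μ : Vec Bool m) (root : IsRoot μ) where
      module E = Orbit 1≤m ψ ψ-order (mul-linear μ) one 1≢0 root

      -- K under μ and F₂^m under A are both images of F₂[X]/(ψ) under X. Going back along the
      -- evaluation at 1 and forward along the evaluation at v gives B, with B(1) = v.
      conjugator : ∀ v → v ≢ zeros m → ∃[ B ] Conjugator μ B × (matApply B one ≡ v)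
      conjugator v v≢0 = matOf f , (GL-matOf f-linear g-linear fg gf ,
          λ z → trans (apply (μ *q z)) (trans (f-mul z) (cong (matApply A) (sym (apply z))))) ,
          trans (apply one) (trans (cong F.θ E.θ⁻¹-w) F.θ-one)
        where
        module F = Orbit 1≤m ψ ψ-order (matApply-linear A) v v≢0 (ψ-annihilates v)
        f g : Vec Bool m → Vec Bool m
        f z = F.θ (E.θ⁻¹ z)
        g z = E.θ (F.θ⁻¹ z)
        f-linear : IsLinear (F2Vec m) (F2Vec m) f
        f-linear = linear-∘ F.θ-linear E.θ⁻¹-linear
        g-linear : IsLinear (F2Vec m) (F2Vec m) g
        g-linear = linear-∘ E.θ-linear F.θ⁻¹-linear
        apply : ∀ z → matApply (matOf f) z ≡ f z
        apply = matApply-matOf f-linear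
        fg : ∀ z → f (g z) ≡ z
        fg z = trans (cong F.θ (E.θ⁻¹-θ (F.θ⁻¹ z))) (F.θ-θ⁻¹ z)
        gf : ∀ z → g (f z) ≡ z
        gf z = trans (cong E.θ (F.θ⁻¹-θ (E.θ⁻¹ z))) (E.θ-θ⁻¹ z)
        f-mul : ∀ z → f (μ *q z) ≡ matApply A (f z)
        f-mul z = trans (cong F.θ (E.θ⁻¹-T z)) (F.θ-X (E.θ⁻¹ z))

      commute-iter : ∀ B → Commutes A μ B → ∀ k z → matApply B (iter (μ *q_) k z) ≡ iter (matApply A) k (matApply B z)
      commute-iter B com = iter-map (matApply B) {μ *q_} {matApply A} com

      -- The powers of μ exhaust the nonzero elements of K, and B(μ^k) = A^k B(1).
      conjugator-unique : ∀ B B′ → Commutes A μ B → Commutes A μ B′ → matApply B one ≡ matApply B′ one → B ≡ B′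
      conjugator-unique B B′ com com′ e = matrix-ext λ y → agree y (y ≟v zeros m)
        where
        agree : ∀ y → Dec (y ≡ zeros m) → matApply B y ≡ matApply B′ y
        agree y (yes y≡0) = trans (cong (matApply B) y≡0) (trans (IsLinear.zero-map (matApply-linear B))
          (sym (trans (cong (matApply B′) y≡0) (IsLinear.zero-map (matApply-linear B′)))))
        agree y (no y≢0) = begin
          matApply B y ≡⟨ cong (matApply B) y≡ ⟩
          matApply B (iter (μ *q_) k one) ≡⟨ commute-iter B com k one ⟩
          iter (matApply A) k (matApply B one) ≡⟨ cong (iter (matApply A) k) e ⟩
          iter (matApply A) k (matApply B′ one) ≡⟨ commute-iter B′ com′ k one ⟨
          matApply B′ (iter (μ *q_) k one) ≡⟨ cong (matApply B′) y≡ ⟨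
          matApply B′ y ∎
          where
          open ≡-Reasoning
          k : ℕ
          k = proj₁ (E.orbit y y≢0)
          y≡ : y ≡ iter (μ *q_) k one
          y≡ = proj₂ (E.orbit y y≢0)

      conjugators-size : Conjugator μ HasSize (2 ^ m ∸ 1)
      conjugators-size = HasSize-transport (λ v B → matApply B one ≡ v)
        conjugator
        (λ B (gl , _) → matApply B one , GL-nonzero B gl 1≢0 , refl)
        (λ _ _ _ e e′ → trans (sym e) e′)
        (λ { {b = B} {B′} _ (_ , com) (_ , com′) e e′ → conjugator-unique B B′ com com′ (trans e (sym e′)) })
        (HasSize-remove _≟v_ (zeros m) (BoolVec-Size m))

      cyclic-at-root : ∀ B → Conjugator μ B → Cyclic 0b (xmul K (lowμ K μ c)) N
      cyclic-at-root B (gl , com) = Intertwine.pull pl c A μ (matApply-linear B) com (GL-nonzero B gl 1≢0) cyc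

      in-P₂ : ∀ B → Conjugator μ B → P₂ m n p (lowμ K μ c)
      in-P₂ B conj = cyclic⇒primitive (lowμ K μ c) (cyclic-at-root B conj) , μ , c , E.T-cyclic one 1≢0 , c₀ , refl

    -- B carries ψ(μ) to ψ(A)B(1) = 0 and is injective.
    commutes⇒root : ∀ μ B → GL m B → Commutes A μ B → IsRoot μ
    commutes⇒root μ B gl com = GL-injective B gl (begin
      matApply B (valueAt ψ μ) ≡⟨ horner-map (F2Vec m) (F2Vec m) (matApply-linear B) com ψ one one ⟩
      Horner.monic (F2Vec m) (matApply A) ψ (matApply B one) ≡⟨ ψ-annihilates _ ⟩
      zeros m ≡⟨ IsLinear.zero-map (matApply-linear B) ⟨
      matApply B (zeros m) ∎)
      where open ≡-Reasoning

    -- The matrix fixes c and A, and as c₀ = 1 the constant coefficient of a is μ. So the pairs (a,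
    -- B) over M correspond to the pairs of a root μ and a conjugator B.
    fiber-size : ∀ M → M ≡ tsr m n c A → (λ (aB : Vec (Vec Bool m) n × Mat m) →
        (P₂ m n p (proj₁ aB) × GL m (proj₂ aB)) × Realizes M (proj₁ aB) (proj₂ aB)) HasSize (m * (2 ^ m ∸ 1))
    fiber-size M M≡ = HasSize-transport Match forward backward
      (λ _ _ _ (e , f) (e′ , f′) → cong₂ _,_
        (trans (sym (lowμ-head _ c c₀)) (trans (cong (λ a → lookup a zero) (trans (sym e) e′)) (lowμ-head _ c c₀)))
        (trans (sym f) f′))
      (λ _ _ _ (e , f) (e′ , f′) → cong₂ _,_ (trans e (sym e′)) (trans f (sym f′)))
      (HasSize-Σ roots-size (λ μ root → AtRoot.conjugators-size μ root))
      where
      Match : Vec Bool m × Mat m → Vec (Vec Bool m) n × Mat m → Set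
      Match (μ , B) (a , B′) = (a ≡ lowμ K μ c) × (B′ ≡ B)
      InFiber : Vec (Vec Bool m) n × Mat m → Set
      InFiber (a , B) = (P₂ m n p a × GL m B) × Realizes M a B
      forward : ∀ μB → IsRoot (proj₁ μB) × Conjugator (proj₁ μB) (proj₂ μB) → ∃[ aB ] InFiber aB × Match μB aB
      forward (μ , B) (root , conj) = (lowμ K μ c , B) ,
        ((AtRoot.in-P₂ μ root B conj , proj₁ conj) , c , μ , A , M≡ , refl , c₀ , proj₂ conj) , refl , refl
      backward : ∀ aB → InFiber aB → ∃[ μB ] (IsRoot (proj₁ μB) × Conjugator (proj₁ μB) (proj₂ μB)) × Match μB aB
      backward (a , B) ((_ , gl) , c′ , μ , A′ , M≡′ , a≡ , c′₀ , com) =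
        (μ , B) , (commutes⇒root μ B gl com′ , gl , com′) , trans a≡ (cong (lowμ K μ) (sym (proj₁ same))) , refl
        where
        same : (c ≡ c′) × (A ≡ A′)
        same = tsr-injective m d c c′ A A′ c₀ c′₀ A-nonzero (trans (sym M≡) M≡′)
        com′ : Commutes A μ B
        com′ z = trans (com z) (cong (λ A → matApply A (matApply B z)) (sym (proj₂ same)))

  TSRP-cyclic : ∀ M → TSRP m n M → Cyclic (replicate (n * m) false) (matApply M) N
  TSRP-cyclic M (_ , prim) = charPoly-primitive⇒cyclic 1≤nm M prim

  realizing-size : ∀ M → TSRP m n M → (λ (aB : Vec (Vec Bool m) n × Mat m) →
        (P₂ m n p (proj₁ aB) × GL m (proj₂ aB)) × Realizes M (proj₁ aB) (proj₂ aB)) HasSize (m * (2 ^ m ∸ 1))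
  realizing-size M tsrp@((c , A , M≡) , _) =
    Fiber.fiber-size c A (subst (λ M → Cyclic (replicate (n * m) false) (matApply M) N) M≡ (TSRP-cyclic M tsrp)) M M≡

  realized : ∀ a B → P₂ m n p a → GL m B → ∃[ M ] TSRP m n M × Realizes M a B
  realized a B (prim , μ , c , _ , c₀ , a≡) gl =
    tsr m n c A , ((c , A , refl) , cyclic⇒charPoly-primitive 1≤nm (tsr m n c A) cyc) , c , μ , A , refl , a≡ , c₀ , com
    where
    B⁻¹ : Mat m
    B⁻¹ = proj₁ (GL-inverse B gl)
    f : Vec Bool m → Vec Bool m
    f v = matApply B (μ *q matApply B⁻¹ v)
    f-linear : IsLinear (F2Vec m) (F2Vec m) f
    f-linear = linear-∘ (matApply-linear B) (linear-∘ (mul-linear μ) (matApply-linear B⁻¹))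
    A : Mat m
    A = matOf f
    com : Commutes A μ B
    com z = sym (trans (matApply-matOf f-linear (matApply B z)) (cong (λ u → matApply B (μ *q u)) (proj₂ (proj₂ (GL-inverse B gl)) z)))
    order : HasOrder (oneVec K n) (xmul K (lowμ K μ c)) N
    order = subst (λ l → HasOrder (oneVec K n) (xmul K l) N) a≡ (P₂-order a prim)
    cyc : Cyclic (replicate (n * m) false) (matApply (tsr m n c A)) N
    cyc = Intertwine.push pl c A μ (matApply-linear B) com (GL-nonzero B gl 1≢0) order

  -- Instead of comparing the two presentations of a as μc(X), both matrices are compared with
  -- multiplication by X modulo the same polynomial: they agree on the image of the block map of B,
  -- which is the whole space.
  realized-unique : ∀ M M′ a B → GL m B → Realizes M a B → Realizes M′ a B → M ≡ M′
  realized-unique M M′ a B gl (c , μ , A , M≡ , a≡ , _ , com) (c′ , μ′ , A′ , M≡′ , a≡′ , _ , com′) =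
    trans M≡ (trans (matrix-ext agree) (sym M≡′))
    where
    open ≡-Reasoning
    on-image : ∀ u → matApply (tsr m n c A) (blockMap (matApply B) u) ≡ matApply (tsr m n c′ A′) (blockMap (matApply B) u)
    on-image u = begin
      matApply (tsr m n c A) (blockMap (matApply B) u) ≡⟨ blockMap-xmul pl (matApply-linear B) A μ c com u ⟨
      blockMap (matApply B) (xmul K (lowμ K μ c) u) ≡⟨ cong (λ l → blockMap (matApply B) (xmul K l u)) (trans (sym a≡) a≡′) ⟩
      blockMap (matApply B) (xmul K (lowμ K μ′ c′) u) ≡⟨ blockMap-xmul pl (matApply-linear B) A′ μ′ c′ com′ u ⟩
      matApply (tsr m n c′ A′) (blockMap (matApply B) u) ∎
    surjective : ∀ v → ∃[ u ] blockMap {m} {n} (matApply B) u ≡ v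
    surjective = blockMap-surjective {m} {n} {g = matApply (proj₁ (GL-inverse B gl))} (proj₁ (proj₂ (GL-inverse B gl)))
    agree : ∀ v → matApply (tsr m n c A) v ≡ matApply (tsr m n c′ A′) v
    agree v = subst (λ v → matApply (tsr m n c A) v ≡ matApply (tsr m n c′ A′) v) (proj₂ (surjective v)) (on-image (proj₁ (surjective v)))

  realized-size : ∀ aB → P₂ m n p (proj₁ aB) × GL m (proj₂ aB) →
    (λ M → TSRP m n M × Realizes M (proj₁ aB) (proj₂ aB)) HasSize 1
  realized-size (a , B) (pa , gl) = (M ∷ []) , refl , ([] ∷ []) , (λ { _ (here refl) → proj₂ (realized a B pa gl) }) ,
    λ M′ (_ , real) → here (realized-unique M′ M a B gl real (proj₂ (proj₂ (realized a B pa gl))))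
    where
    M : Mat (n * m)
    M = proj₁ (realized a B pa gl)

  -- The triples (M, a, B) are sorted by M on the left and by (a, B) on the right; the factor 1 is
  -- the single matrix over each pair.
  count : ∀ t b g → TSRP m n HasSize t → P₂ m n p HasSize b → GL m HasSize g → t * (m * (2 ^ m ∸ 1)) ≡ b * g * 1
  count t b g st sb sg = HasSize-unique
    (HasSize-transport (λ MaB aBM → aBM ≡ (proj₂ MaB , proj₁ MaB))
      (λ { (M , aB) (tsrp , pg , real) → (aB , M) , (pg , tsrp , real) , refl })
      (λ { (aB , M) (pg , tsrp , real) → (M , aB) , (tsrp , pg , real) , refl })
      (λ { _ _ _ refl refl → refl })
      (λ { _ _ _ refl refl → refl })
      (HasSize-Σ st realizing-size))
    (HasSize-Σ (HasSize-Σ sb (λ _ _ → sg)) realized-size)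

theorem3p5 : (m n : ℕ) → 2 ≤ m → 1 ≤ n →
    (p : Poly F2) → Monic F2 m p → Irreducible F2 m p →
    (t b g : ℕ) → TSRP m n HasSize t → P₂ m n p HasSize b → GL m HasSize g →
    t * m * (2 ^ m ∸ 1) ≡ b * g
theorem3p5 m (suc d) 2≤m (s≤s _) p mon irr t b g st sb sg =
  trans (ℕ.*-assoc t m _) (trans (Main.count m d 2≤m p mon irr t b g st sb sg) (ℕ.*-identityʳ (b * g)))
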